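{- Let $a,b$ be coprime positive integers and $d$ an integer with $1\le d<b-1$ and $d\mid(b-1)$. The map $S^d:(P,Q)\mapsto(S_P^d,S_Q^d)$ is a bijection from $NC_d(a,b)$ onto the set of good sequence pairs, and it commutes with rotation: $S^d(\mathrm{rot}(P,Q))=\mathrm{rot}(S^d(P,Q))$ for all $(P,Q)\in NC_d(a,b)$.
   Context: An $a,b$-Dyck path is a lattice path from $(0,0)$ to $(b,a)$ with unit north steps $N$ and east steps $E$ staying above the line $y=\frac{a}{b}x$; write it as $D=N^{v_0}EN^{v_1}E\cdots N^{v_{b-1}}E$, $v_i\ge 0$. A vertical run of length $v$ is a $P$-rise if $v>a/b$ and a $Q$-rise if $v<a/b$. For $1\le i\le b-1$ the label $i$ is the point $(i,v_0+\dots+v_{i-1})$. If $v_i>0$, the laser $\ell(i)$ is the segment of slope $a/b$ from label $i$ going northeast until it next meets $D$ (in the interior of an east step). $\ell(D)$ is the set of pairs $(i,j)$ with $\ell(i)$ ending on the east step whose west endpoint has $x$-coordinate $j$. The labeled pair $\pi(D)=(P,Q)$ of set partitions of $[b-1]$: $i,j$ in the same block of $P$ iff labels $i,j$ are not separated by any laser (label $k$ lies strictly below $\ell(k)$), and a block $B\in P$ gets rank $v_{\min(B)-1}$; $Q$ is the equivalence relation generated by $i\sim j$ whenever $\ell(i),\ell(j)$ end on the same east step immediately following a $Q$-rise, or $(i,j)\in\ell(D)$, or $(j,i)\in\ell(D)$, and a block $B\in Q$ gets rank $v_{\max(B)}$. $NC(a,b)=\{\pi(D)\}$ over all $a,b$-Dyck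 paths; $P$ and $Q$ are noncrossing. $\mathrm{rot}$ acts by $i\mapsto i+1$ ($b-1\mapsto1$) on all blocks of both partitions, ranks kept, and preserves $NC(a,b)$. $NC_d(a,b)$ is the set of $(P,Q)\in NC(a,b)$ with $\mathrm{rot}^d(P,Q)=(P,Q)$. For a $\mathrm{rot}^d$-invariant noncrossing partition of $[b-1]$, a block $B$ is central if $\mathrm{rot}^d(B)=B$, and wrapping if it is not central and every block in the $\langle\mathrm{rot}^d\rangle$-orbit of $B$ is contained in the interval $[\min B,\max B]$. For $(P,Q)\in NC_d(a,b)$ define $S_P^d=(p_1,\dots,p_d)$ and $S_Q^d=(q_1,\dots,q_d)$ by: $p_i=\mathrm{rank}_P(B)$ if $i=\min(B)$ for a noncentral, nonwrapping block $B\in P$, and $p_i=0$ otherwise; $q_i=\mathrm{rank}_Q(B)$ if $b-1-d+i=\max(B)$ for a noncentral, nonwrapping block $B\in Q$, and $q_i=0$ otherwise. A good sequence pair is a pair $((p_1,\dots,p_d),(q_1,\dots,q_d))$ of sequences of nonnegative integers with: $p_i=0$ or $p_i>a/b$ for each $i$; $q_i<a/b$ for each $i$; $\sum_{i=1}^d(p_i+q_i)\le ad/(b-1)$; and there is no $i\in[d]$ with both $p_{i+1}$ and $q_i$ nonzero (indices mod $d$). Rotation on sequence pairs is the cyclic shift $(s_1,\dots,s_d)\mapsto(s_d,s_1,\dots,s_{d-1})$ applied to both sequences. -}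

module Defs where

open import Data.Nat using (ℕ; zero; suc; _+_; _*_; _∸_; _≤_; _<_; _<ᵇ_; _≤ᵇ_; _≡ᵇ_)
open import Data.Bool using (Bool; true; false; _∧_; _∨_; not; _xor_; if_then_else_)
open import Data.Vec using (Vec; []; _∷_; tabulate; replicate; sum)
open import Data.Fin using (Fin; toℕ)
open import Data.Product using (_×_; _,_; ∃)
open import Data.Sum using (_⊎_)
open import Data.Empty using (⊥)
open import Relation.Nullary using (¬_)
open import Relation.Binary.PropositionalEquality using (_≡_; _≢_)

at : {A : Set} {m : ℕ} → A → Vec A m → ℕ → A
at dflt []       _       = dflt
at dflt (x ∷ xs) zero    = x
at dflt (x ∷ xs) (suc k) = at dflt xs k

sumUpTo : ℕ → (ℕ → ℕ) → ℕ
sumUpTo zero    f = 0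
sumUpTo (suc m) f = sumUpTo m f + f m

allUpTo : ℕ → (ℕ → Bool) → Bool
allUpTo zero    f = true
allUpTo (suc m) f = allUpTo m f ∧ f m

anyUpTo : ℕ → (ℕ → Bool) → Bool
anyUpTo zero    f = false
anyUpTo (suc m) f = anyUpTo m f ∨ f m

allLab : ℕ → (ℕ → Bool) → Bool
allLab n f = allUpTo n (λ k → f (suc k))

anyLab : ℕ → (ℕ → Bool) → Bool
anyLab n f = anyUpTo n (λ k → f (suc k))

firstFrom : ℕ → ℕ → (ℕ → Bool) → ℕ → ℕ
firstFrom zero       s p dflt = dflt
firstFrom (suc fuel) s p dflt = if p s then s else firstFrom fuel (suc s) p dflt

lastDown : ℕ → (ℕ → Bool) → ℕ → ℕ
lastDown zero    p dflt = dflt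
lastDown (suc m) p dflt = if p (suc m) then suc m else lastDown m p dflt

iter : ℕ → (ℕ → ℕ) → ℕ → ℕ
iter zero    f x = x
iter (suc k) f x = f (iter k f x)

beq : Bool → Bool → Bool
beq x y = not (x xor y)

-- Ranked (labeled) set partitions of [n] = {1..n}.
-- A ranked partition is stored canonically as its "same block" relation
-- (an n×n Boolean matrix, entry (i-1,j-1) for labels i,j) together with
-- the rank of the block containing each label.

record RP (n : ℕ) : Set where
  constructor mkRP
  field
    rel : Vec (Vec Bool n) n
    rnk : Vec ℕ n
open RP public

fromFun : (n : ℕ) → (ℕ → ℕ → Bool) → (ℕ → ℕ) → RP n
fromFun n R r = mkRP (tabulate (λ x → tabulate (λ y → R (suc (toℕ x)) (suc (toℕ y)))))
                     (tabulate (λ x → r (suc (toℕ x))))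

relOf : {n : ℕ} → RP n → ℕ → ℕ → Bool
relOf {n} P i j = at false (at (replicate n false) (rel P) (i ∸ 1)) (j ∸ 1)

rankOf : {n : ℕ} → RP n → ℕ → ℕ
rankOf P i = at 0 (rnk P) (i ∸ 1)

LP : ℕ → Set
LP n = RP n × RP n

minBlock : ℕ → (ℕ → ℕ → Bool) → ℕ → ℕ
minBlock n R i = firstFrom n 1 (R i) i

maxBlock : ℕ → (ℕ → ℕ → Bool) → ℕ → ℕ
maxBlock n R i = lastDown n (R i) i

-- a,b-Dyck paths D = N^{v_0} E N^{v_1} E ... N^{v_{b-1}} E, as v : Vec ℕ b

module Path (a b : ℕ) (v : Vec ℕ b) where

  vv : ℕ → ℕ
  vv = at 0 v

  hgt : ℕ → ℕ
  hgt i = sumUpTo i vv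

  n : ℕ
  n = b ∸ 1

  hasLaser : ℕ → Bool
  hasLaser i = 0 <ᵇ vv i

  -- the laser from label i (line y = hgt i + (a/b)(x - i)) is above the
  -- path at x = j+1, i.e. it has crossed the east step [j, j+1] × {hgt (j+1)}
  crosses : ℕ → ℕ → Bool
  crosses i j = (j <ᵇ b) ∧ (b * hgt (suc j) <ᵇ b * hgt i + a * (suc j ∸ i))

  -- x-coordinate of the west endpoint of the east step on which ℓ(i) ends
  target : ℕ → ℕ
  target i = firstFrom b i (crosses i) (b ∸ 1)

  -- label m lies strictly above the laser ℓ(k): m is within the x-range
  -- of the laser segment and the point (m , hgt m) is strictly above it
  -- (in particular label k itself is not above ℓ(k))
  above : ℕ → ℕ → Bool
  above k m = hasLaser k ∧ (k ≤ᵇ m) ∧ (m ≤ᵇ target k)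
              ∧ (b * hgt k + a * (m ∸ k) <ᵇ b * hgt m)

  separated : ℕ → ℕ → Bool
  separated i j = anyLab n (λ k → hasLaser k ∧ (above k i xor above k j))

  relP : ℕ → ℕ → Bool
  relP i j = not (separated i j)

  rankP : ℕ → ℕ
  rankP i = vv (minBlock n relP i ∸ 1)

  inL : ℕ → ℕ → Bool
  inL i j = hasLaser i ∧ (target i ≡ᵇ j)

  genQ : ℕ → ℕ → Bool
  genQ i j = (hasLaser i ∧ hasLaser j ∧ (target i ≡ᵇ target j) ∧ (b * vv (target i) <ᵇ a))
             ∨ inL i j ∨ inL j i

  reach : ℕ → ℕ → ℕ → Bool
  reach zero    i j = i ≡ᵇ j
  reach (suc s) i j = reach s i j ∨ anyLab n (λ m → reach s i m ∧ genQ m j)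

  -- equivalence relation generated by genQ (genQ is symmetric; paths of
  -- length ≤ n suffice on an n-element set)
  relQ : ℕ → ℕ → Bool
  relQ = reach n

  rankQ : ℕ → ℕ
  rankQ i = vv (maxBlock n relQ i)

  piD : LP n
  piD = fromFun n relP rankP , fromFun n relQ rankQ

IsDyck : (a b : ℕ) → Vec ℕ b → Set
IsDyck a b v = (sumUpTo b (at 0 v) ≡ a)
             × (∀ i → 1 ≤ i → i ≤ b → a * i ≤ b * sumUpTo i (at 0 v))

π : (a b : ℕ) → Vec ℕ b → LP (b ∸ 1)
π a b v = Path.piD a b v

NC : (a b : ℕ) → LP (b ∸ 1) → Set
NC a b x = ∃ λ (v : Vec ℕ b) → IsDyck a b v × π a b v ≡ x

rot1 : ℕ → ℕ → ℕ
rot1 n i = if i ≡ᵇ n then 1 else suc i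

unrot1 : ℕ → ℕ → ℕ
unrot1 n i = if i ≡ᵇ 1 then n else i ∸ 1

rotRP : {n : ℕ} → RP n → RP n
rotRP {n} P = fromFun n (λ i j → relOf P (unrot1 n i) (unrot1 n j))
                        (λ i → rankOf P (unrot1 n i))

rotLP : {n : ℕ} → LP n → LP n
rotLP (P , Q) = rotRP P , rotRP Q

rotLPN : {n : ℕ} → ℕ → LP n → LP n
rotLPN zero    x = x
rotLPN (suc k) x = rotLP (rotLPN k x)

NCd : (a b d : ℕ) → LP (b ∸ 1) → Set
NCd a b d x = NC a b x × rotLPN d x ≡ x

-- central / wrapping blocks for a rot^d-invariant partition, given as a
-- relation R on [n]; the block considered is the block B of label x.

module Blocks (n d : ℕ) (R : ℕ → ℕ → Bool) where

  rotk : ℕ → ℕ → ℕ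
  rotk k = iter k (rot1 n)

  central : ℕ → Bool
  central x = allLab n (λ z → beq (anyLab n (λ y → R x y ∧ (rotk d y ≡ᵇ z))) (R x z))

  -- every block rot^{kd}(B) of the orbit lies in [min B , max B]
  -- (k ranges over 0..n-1, which covers the whole orbit since rot^n = id)
  orbitInside : ℕ → Bool
  orbitInside x = allUpTo n (λ k → allLab n (λ y →
                    not (R x y) ∨ ((minBlock n R x ≤ᵇ rotk (k * d) y)
                                   ∧ (rotk (k * d) y ≤ᵇ maxBlock n R x))))

  wrapping : ℕ → Bool
  wrapping x = not (central x) ∧ orbitInside x

  ncnw : ℕ → Bool
  ncnw x = not (central x) ∧ not (wrapping x)

SeqPair : ℕ → Set
SeqPair d = Vec ℕ d × Vec ℕ d

SP : {n : ℕ} → (d : ℕ) → RP n → Vec ℕ d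
SP {n} d P = tabulate (λ f → let i = suc (toℕ f) in
  if (minBlock n (relOf P) i ≡ᵇ i) ∧ Blocks.ncnw n d (relOf P) i then rankOf P i else 0)

SQ : {n : ℕ} → (d : ℕ) → RP n → Vec ℕ d
SQ {n} d Q = tabulate (λ f → let m = n ∸ d + suc (toℕ f) in
  if (maxBlock n (relOf Q) m ≡ᵇ m) ∧ Blocks.ncnw n d (relOf Q) m then rankOf Q m else 0)

S : {n : ℕ} → (d : ℕ) → LP n → SeqPair d
S d (P , Q) = SP d P , SQ d Q

nextIdx : ℕ → ℕ → ℕ
nextIdx d i = if i ≡ᵇ d then 1 else suc i

Good : (a b d : ℕ) → SeqPair d → Set
Good a b d (p , q) =
    (∀ i → 1 ≤ i → i ≤ d → (pp i ≡ 0) ⊎ (a < b * pp i))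
  × (∀ i → 1 ≤ i → i ≤ d → b * qq i < a)
  × ((sum p + sum q) * (b ∸ 1) ≤ a * d)
  × (¬ (∃ λ i → 1 ≤ i × i ≤ d × pp (nextIdx d i) ≢ 0 × qq i ≢ 0))
  where
    pp qq : ℕ → ℕ
    pp i = at 0 p (i ∸ 1)
    qq i = at 0 q (i ∸ 1)

rotVec : {d : ℕ} → Vec ℕ d → Vec ℕ d
rotVec {d} s = tabulate (λ f → at 0 s (if toℕ f ≡ᵇ 0 then d ∸ 1 else toℕ f ∸ 1))

rotSP : {d : ℕ} → SeqPair d → SeqPair d
rotSP (p , q) = rotVec p , rotVec q

{-# OPTIONS --safe #-}
-- Let n = b − 1 = m d, and let H(i) be the height b y − a x of the path D at its label i.  Two labels lie in
-- one block of P iff the last lower height to their left (lf) agrees, and in one block of Q iff the first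
-- descent below them to their right (rt) agrees; the ranks are the rises found there.  So P and Q are the two
-- vertex classes of a plane tree with edges 1, …, n, and the rise in v is the weight of a vertex.
--
-- Deleting one vertex of the tree leaves a cyclic sequence of n rises, whose periodic walk determines the
-- labeled pair up to this central vertex, and rotation is a shift of this sequence.  A pair fixed by rot^d has
-- a central block; deleting it leaves a d-periodic sequence u.  Splitting u into its rises above and below a/b
-- gives S^d, since a noncentral block lies in a cyclic window of length d and its minimum (maximum) is read
-- off correctly unless it wraps.  Conversely, for a good sequence pair the merged sequence u has nonzero drift
-- by coprimality; cutting it at an extremal position and inserting the missing rise gives a Dyck path.
module Submission where

-- The sign of the drift of `u` tells which kind of block was deleted: without a central block of P
-- the remaining walk descends, without one of Q it ascends. So both cases must be carried along,
-- and zero drift must be excluded. The condition `d + d ≤ n`, which is `d < n` for a divisor of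
-- `n`, keeps a cyclic window of length `d` disjoint from its translate by `d`.
--
-- The obstacle is the existence of a central block. The label `e` of least height joins the block
-- of 1 in P to the block of `n` in Q, and invariance forces it to lie within distance `d` of one
-- end. If it is near `n`, the block of 1 is tested, otherwise the block of `n`. A tested block that
-- is not central has a gap of length at least `d`. Rotating so that the path is cut at the end of
-- this gap makes the gap label the new `e`, near the opposite end and strictly farther from it than
-- the old `e` was from its own. As this distance stays below `d`, the process stops.

open import Defs
open import Data.Nat using (ℕ; zero; suc; _+_; _*_; _∸_; _≤_; _<_; _<ᵇ_; _≤ᵇ_; _≡ᵇ_; z≤n; s≤s; NonZero; nonZero; >-nonZero; pred)
open import Data.Nat.Properties
open import Data.Nat.DivMod using (_%_; _/_; m≡m%n+[m/n]*n; [m+kn]%n≡m%n; m%n<n; m<n⇒m%n≡m; [m+n]%n≡m%n)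
open import Data.Nat.Divisibility using (_∣_; divides; ∣⇒≤; ∣m+n∣m⇒∣n)
open import Data.Nat.Coprimality using (Coprime; coprime-divisor) renaming (sym to coprime-sym)
open import Data.Bool using (Bool; true; false; _∧_; _∨_; not; _xor_; if_then_else_; T)
open import Data.Bool.Properties using (∧-zeroʳ; ∨-zeroʳ; T-≡)
open import Data.Vec using (Vec; []; _∷_; tabulate; replicate; sum)
open import Data.Vec.Properties using (tabulate-cong)
open import Data.Fin using (Fin; toℕ)
open import Data.Fin.Properties using (toℕ<n)
open import Data.List using (List; []; _∷_)
open import Data.Product using (_×_; _,_; ∃; proj₁; proj₂)
open import Data.Sum using (_⊎_; inj₁; inj₂)
open import Data.Unit using (tt)
open import Data.Empty using (⊥; ⊥-elim)
open import Relation.Binary.Definitions using (tri<; tri≈; tri>)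
open import Function using (Equivalence)
open import Relation.Nullary using (¬_; Dec; yes; no)
open import Relation.Binary.PropositionalEquality using (_≡_; _≢_; refl; sym; trans; cong; cong₂; subst; subst₂; module ≡-Reasoning)

-- Linear arithmetic by certificates: the conclusion is a combination of the hypotheses with the given
-- multiplicities (Farkas' lemma).  Coefficient lists start with the constant term.

infixl 6 _⊕_
infix 4 _≼_

data Expr : Set where
  κ   : ℕ → Expr
  #   : ℕ → Expr
  _⊕_ : Expr → Expr → Expr
  _⊛_ : ℕ → Expr → Expr

record Ineq : Set where
  constructor _≼_
  field lhs rhs : Expr

valueAt : List ℕ → ℕ → ℕ
valueAt []       _       = 0
valueAt (x ∷ _)  zero    = x
valueAt (_ ∷ xs) (suc k) = valueAt xs k

⟦_⟧ : Expr → List ℕ → ℕ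
⟦ κ k ⟧ ρ     = k
⟦ # i ⟧ ρ     = valueAt ρ i
⟦ e ⊕ f ⟧ ρ   = ⟦ e ⟧ ρ + ⟦ f ⟧ ρ
⟦ k ⊛ e ⟧ ρ   = k * ⟦ e ⟧ ρ

Holds : List ℕ → Ineq → Set
Holds ρ (l ≼ r) = ⟦ l ⟧ ρ ≤ ⟦ r ⟧ ρ

addCoeffs : List ℕ → List ℕ → List ℕ
addCoeffs []       ys       = ys
addCoeffs (x ∷ xs) []       = x ∷ xs
addCoeffs (x ∷ xs) (y ∷ ys) = (x + y) ∷ addCoeffs xs ys

scaleCoeffs : ℕ → List ℕ → List ℕ
scaleCoeffs k []       = []
scaleCoeffs k (x ∷ xs) = (k * x) ∷ scaleCoeffs k xs

unitCoeffs : ℕ → List ℕ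
unitCoeffs zero    = 1 ∷ []
unitCoeffs (suc k) = 0 ∷ unitCoeffs k

coeffs : Expr → List ℕ
coeffs (κ k)   = k ∷ []
coeffs (# i)   = 0 ∷ unitCoeffs i
coeffs (e ⊕ f) = addCoeffs (coeffs e) (coeffs f)
coeffs (k ⊛ e) = scaleCoeffs k (coeffs e)

dot : List ℕ → List ℕ → ℕ
dot []       _        = 0
dot (_ ∷ _)  []       = 0
dot (x ∷ xs) (y ∷ ys) = x * y + dot xs ys

leqCoeffs : List ℕ → List ℕ → Bool
leqCoeffs []       _        = true
leqCoeffs (x ∷ xs) []       = (x ≤ᵇ 0) ∧ leqCoeffs xs []
leqCoeffs (x ∷ xs) (y ∷ ys) = (x ≤ᵇ y) ∧ leqCoeffs xs ys

dot-add : ∀ xs ys ρ → dot (addCoeffs xs ys) ρ ≡ dot xs ρ + dot ys ρ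
dot-add [] ys ρ = refl
dot-add (x ∷ xs) [] ρ = sym (+-identityʳ _)
dot-add (x ∷ xs) (y ∷ ys) [] = refl
dot-add (x ∷ xs) (y ∷ ys) (r ∷ ρ) = begin
  (x + y) * r + dot (addCoeffs xs ys) ρ       ≡⟨ cong₂ _+_ (*-distribʳ-+ r x y) (dot-add xs ys ρ) ⟩
  (x * r + y * r) + (dot xs ρ + dot ys ρ)     ≡⟨ +-assoc (x * r) (y * r) _ ⟩
  x * r + (y * r + (dot xs ρ + dot ys ρ))     ≡⟨ cong (x * r +_) (sym (+-assoc (y * r) _ _)) ⟩
  x * r + ((y * r + dot xs ρ) + dot ys ρ)     ≡⟨ cong (λ z → x * r + (z + dot ys ρ)) (+-comm (y * r) _) ⟩
  x * r + ((dot xs ρ + y * r) + dot ys ρ)     ≡⟨ cong (x * r +_) (+-assoc (dot xs ρ) _ _) ⟩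
  x * r + (dot xs ρ + (y * r + dot ys ρ))     ≡⟨ sym (+-assoc (x * r) _ _) ⟩
  (x * r + dot xs ρ) + (y * r + dot ys ρ)     ∎
  where open ≡-Reasoning

dot-scale : ∀ k xs ρ → dot (scaleCoeffs k xs) ρ ≡ k * dot xs ρ
dot-scale k [] ρ = sym (*-zeroʳ k)
dot-scale k (x ∷ xs) [] = sym (*-zeroʳ k)
dot-scale k (x ∷ xs) (r ∷ ρ) =
  trans (cong₂ _+_ (*-assoc k x r) (dot-scale k xs ρ)) (sym (*-distribˡ-+ k (x * r) _))

dot-unit : ∀ i ρ → dot (unitCoeffs i) ρ ≡ valueAt ρ i
dot-unit zero    []      = refl
dot-unit zero    (r ∷ ρ) = trans (+-identityʳ _) (+-identityʳ r)
dot-unit (suc i) []      = refl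
dot-unit (suc i) (r ∷ ρ) = dot-unit i ρ

dot-coeffs : ∀ e ρ → dot (coeffs e) (1 ∷ ρ) ≡ ⟦ e ⟧ ρ
dot-coeffs (κ k)   ρ = trans (+-identityʳ _) (*-identityʳ k)
dot-coeffs (# i)   ρ = dot-unit i ρ
dot-coeffs (e ⊕ f) ρ = trans (dot-add (coeffs e) (coeffs f) _) (cong₂ _+_ (dot-coeffs e ρ) (dot-coeffs f ρ))
dot-coeffs (k ⊛ e) ρ = trans (dot-scale k (coeffs e) _) (cong (k *_) (dot-coeffs e ρ))

T-∧ˡ : ∀ {x y} → T (x ∧ y) → T x
T-∧ˡ {true} _ = tt

T-∧ʳ : ∀ {x y} → T (x ∧ y) → T y
T-∧ʳ {true} p = p

-- The values in `ρ` are natural numbers, so dominance coefficient by coefficient is enough. This is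
-- how the nonnegativity of all variables enters without being listed among the hypotheses.
dot-mono : ∀ xs ys ρ → T (leqCoeffs xs ys) → dot xs ρ ≤ dot ys ρ
dot-mono []       ys       ρ       p = z≤n
dot-mono (x ∷ xs) ys       []      p = z≤n
dot-mono (x ∷ xs) []       (r ∷ ρ) p =
  +-mono-≤ (*-monoˡ-≤ r (≤ᵇ⇒≤ x 0 (T-∧ˡ p))) (dot-mono xs [] ρ (T-∧ʳ {x ≤ᵇ 0} p))
dot-mono (x ∷ xs) (y ∷ ys) (r ∷ ρ) p =
  +-mono-≤ (*-monoˡ-≤ r (≤ᵇ⇒≤ x y (T-∧ˡ p))) (dot-mono xs ys ρ (T-∧ʳ {x ≤ᵇ y} p))

infix 4 _≈_

record Equation : Set where
  constructor _≈_
  field lhs rhs : Expr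

Solves : List ℕ → Equation → Set
Solves ρ (l ≈ r) = ⟦ l ⟧ ρ ≡ ⟦ r ⟧ ρ

infixr 5 _×_∋_∷_ _⇒_∋_∷_ _⇐_∋_∷_

-- The index records whether only equations occur.
data Hypotheses (ρ : List ℕ) : Bool → Set where
  []      : ∀ {b} → Hypotheses ρ b
  _×_∋_∷_ : ℕ → (c : Ineq) → Holds ρ c → Hypotheses ρ false → Hypotheses ρ false
  _⇒_∋_∷_ : ∀ {b} → ℕ → (c : Equation) → Solves ρ c → Hypotheses ρ b → Hypotheses ρ b
  _⇐_∋_∷_ : ∀ {b} → ℕ → (c : Equation) → Solves ρ c → Hypotheses ρ b → Hypotheses ρ b

plus : ℕ → Expr → List ℕ → List ℕ
plus k e = addCoeffs (scaleCoeffs k (coeffs e))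

sumˡ sumʳ : ∀ {ρ b} → Hypotheses ρ b → List ℕ
sumˡ []                     = []
sumˡ (k × (l ≼ r) ∋ _ ∷ hs) = plus k l (sumˡ hs)
sumˡ (k ⇒ (l ≈ r) ∋ _ ∷ hs) = plus k l (sumˡ hs)
sumˡ (k ⇐ (l ≈ r) ∋ _ ∷ hs) = plus k r (sumˡ hs)
sumʳ []                     = []
sumʳ (k × (l ≼ r) ∋ _ ∷ hs) = plus k r (sumʳ hs)
sumʳ (k ⇒ (l ≈ r) ∋ _ ∷ hs) = plus k r (sumʳ hs)
sumʳ (k ⇐ (l ≈ r) ∋ _ ∷ hs) = plus k l (sumʳ hs)

dot-plus : ∀ k e xs ρ → dot (plus k e xs) (1 ∷ ρ) ≡ k * ⟦ e ⟧ ρ + dot xs (1 ∷ ρ)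
dot-plus k e xs ρ = trans (dot-add (scaleCoeffs k (coeffs e)) xs _)
  (cong (_+ _) (trans (dot-scale k (coeffs e) _) (cong (k *_) (dot-coeffs e ρ))))

plus-≤ : ∀ {ρ xs ys} k e f → ⟦ e ⟧ ρ ≤ ⟦ f ⟧ ρ → dot xs (1 ∷ ρ) ≤ dot ys (1 ∷ ρ) →
  dot (plus k e xs) (1 ∷ ρ) ≤ dot (plus k f ys) (1 ∷ ρ)
plus-≤ {ρ} {xs} {ys} k e f p q =
  subst₂ _≤_ (sym (dot-plus k e xs ρ)) (sym (dot-plus k f ys ρ)) (+-mono-≤ (*-monoʳ-≤ k p) q)

sum-≤ : ∀ {ρ b} (hs : Hypotheses ρ b) → dot (sumˡ hs) (1 ∷ ρ) ≤ dot (sumʳ hs) (1 ∷ ρ)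
sum-≤ []                     = z≤n
sum-≤ (k × (l ≼ r) ∋ p ∷ hs) = plus-≤ {xs = sumˡ hs} {sumʳ hs} k l r p (sum-≤ hs)
sum-≤ (k ⇒ (l ≈ r) ∋ p ∷ hs) = plus-≤ {xs = sumˡ hs} {sumʳ hs} k l r (≤-reflexive p) (sum-≤ hs)
sum-≤ (k ⇐ (l ≈ r) ∋ p ∷ hs) = plus-≤ {xs = sumˡ hs} {sumʳ hs} k r l (≤-reflexive (sym p)) (sum-≤ hs)

sum-≡ : ∀ {ρ} (hs : Hypotheses ρ true) → dot (sumʳ hs) (1 ∷ ρ) ≤ dot (sumˡ hs) (1 ∷ ρ)
sum-≡ []                     = z≤n
sum-≡ (k ⇒ (l ≈ r) ∋ p ∷ hs) = plus-≤ {xs = sumʳ hs} {sumˡ hs} k r l (≤-reflexive (sym p)) (sum-≡ hs)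
sum-≡ (k ⇐ (l ≈ r) ∋ p ∷ hs) = plus-≤ {xs = sumʳ hs} {sumˡ hs} k l r (≤-reflexive p) (sum-≡ hs)

1+ : List ℕ → List ℕ
1+ = addCoeffs (1 ∷ [])

-- The negated conclusion `1 + r ≤ l` is added `k` times to the hypotheses; the smaller side of the
-- total must then dominate the larger one with 1 to spare in the constant term. A `k` above 1
-- permits rounding: `2 x ≤ 2 y + 1` gives `x ≤ y`.
certified : List ℕ → List ℕ → Ineq → ℕ → Bool
certified L R (l ≼ r) k = leqCoeffs (1+ (plus k l R)) (addCoeffs (scaleCoeffs k (1+ (coeffs r))) L)

farkas : ∀ {ρ L R} → dot L (1 ∷ ρ) ≤ dot R (1 ∷ ρ) → ∀ c k → T (certified L R c k) → Holds ρ c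
farkas {ρ} {L} {R} L≤R (l ≼ r) k p = ≮⇒≥ λ r<l → <⇒≱ ≤-refl (≤-trans (≤-reflexive (sym (dot-add (1 ∷ []) (plus k l R) (1 ∷ ρ))))
  (≤-trans (dot-mono (1+ (plus k l R)) (addCoeffs (scaleCoeffs k (1+ (coeffs r))) L) (1 ∷ ρ) p)
    (plus-≤ {xs = L} {R} k (κ 1 ⊕ r) l r<l L≤R)))

refute : ∀ {ρ} (hs : Hypotheses ρ false) → {T (leqCoeffs (1+ (sumʳ hs)) (sumˡ hs))} → ⊥
refute {ρ} hs {p} = <⇒≱ (≤-trans (≤-reflexive (sym (dot-add (1 ∷ []) (sumʳ hs) (1 ∷ ρ))))
                                 (dot-mono (1+ (sumʳ hs)) (sumˡ hs) (1 ∷ ρ) p)) (sum-≤ hs)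

linear : ∀ ρ c k (hs : Hypotheses ρ false) → {T (certified (sumˡ hs) (sumʳ hs) c k)} → Holds ρ c
linear ρ c k hs {p} = farkas (sum-≤ hs) c k p

linear≡ : ∀ ρ c k (hs : Hypotheses ρ true) →
  {T (certified (sumˡ hs) (sumʳ hs) (Equation.lhs c ≼ Equation.rhs c) k)} →
  {T (certified (sumʳ hs) (sumˡ hs) (Equation.rhs c ≼ Equation.lhs c) k)} → Solves ρ c
linear≡ ρ (l ≈ r) k hs {p} {q} = ≤-antisym (farkas (sum-≤ hs) (l ≼ r) k p) (farkas (sum-≡ hs) (r ≼ l) k q)

-- Reflection of the Boolean tests

true≢false : ∀ {x} → x ≡ true → x ≡ false → ⊥
true≢false refl ()

¬true⇒false : ∀ {x} → ¬ x ≡ true → x ≡ false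
¬true⇒false {true}  h = ⊥-elim (h refl)
¬true⇒false {false} h = refl

bool-ext : ∀ {x y} → (x ≡ true → y ≡ true) → (y ≡ true → x ≡ true) → x ≡ y
bool-ext {true}  {y}     f g = sym (f refl)
bool-ext {false} {true}  f g = g refl
bool-ext {false} {false} f g = refl

T⇒true : ∀ {x} → T x → x ≡ true
T⇒true = Equivalence.to T-≡

true⇒T : ∀ {x} → x ≡ true → T x
true⇒T = Equivalence.from T-≡

<⇒<ᵇ≡true : ∀ {m n} → m < n → (m <ᵇ n) ≡ true
<⇒<ᵇ≡true h = T⇒true (<⇒<ᵇ h)

<ᵇ≡true⇒< : ∀ {m n} → (m <ᵇ n) ≡ true → m < n
<ᵇ≡true⇒< {m} {n} h = <ᵇ⇒< m n (true⇒T h)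

≤⇒<ᵇ≡false : ∀ {m n} → n ≤ m → (m <ᵇ n) ≡ false
≤⇒<ᵇ≡false h = ¬true⇒false λ t → <⇒≱ (<ᵇ≡true⇒< t) h

<ᵇ≡false⇒≤ : ∀ {m n} → (m <ᵇ n) ≡ false → n ≤ m
<ᵇ≡false⇒≤ h = ≮⇒≥ λ l → true≢false (<⇒<ᵇ≡true l) h

≤⇒≤ᵇ≡true : ∀ {m n} → m ≤ n → (m ≤ᵇ n) ≡ true
≤⇒≤ᵇ≡true h = T⇒true (≤⇒≤ᵇ h)

≤ᵇ≡true⇒≤ : ∀ {m n} → (m ≤ᵇ n) ≡ true → m ≤ n
≤ᵇ≡true⇒≤ {m} {n} h = ≤ᵇ⇒≤ m n (true⇒T h)

≡⇒≡ᵇ≡true : ∀ {m n} → m ≡ n → (m ≡ᵇ n) ≡ true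
≡⇒≡ᵇ≡true {m} {n} h = T⇒true (≡⇒≡ᵇ m n h)

≡ᵇ≡true⇒≡ : ∀ {m n} → (m ≡ᵇ n) ≡ true → m ≡ n
≡ᵇ≡true⇒≡ {m} {n} h = ≡ᵇ⇒≡ m n (true⇒T h)

≢⇒≡ᵇ≡false : ∀ {m n} → m ≢ n → (m ≡ᵇ n) ≡ false
≢⇒≡ᵇ≡false h = ¬true⇒false λ t → h (≡ᵇ≡true⇒≡ t)

∧-intro : ∀ {x y} → x ≡ true → y ≡ true → (x ∧ y) ≡ true
∧-intro refl refl = refl

∧-elimˡ : ∀ {x y} → (x ∧ y) ≡ true → x ≡ true
∧-elimˡ {true} h = refl

∧-elimʳ : ∀ {x y} → (x ∧ y) ≡ true → y ≡ true
∧-elimʳ {true} h = h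

∨-introˡ : ∀ {x y} → x ≡ true → (x ∨ y) ≡ true
∨-introˡ refl = refl

∨-introʳ : ∀ {x y} → y ≡ true → (x ∨ y) ≡ true
∨-introʳ {x} refl = ∨-zeroʳ x

∨-elim : ∀ {x y} → (x ∨ y) ≡ true → x ≡ true ⊎ y ≡ true
∨-elim {true}  h = inj₁ refl
∨-elim {false} h = inj₂ h

not-true : ∀ {x} → not x ≡ true → x ≡ false
not-true {false} h = refl

beq-refl : ∀ x → beq x x ≡ true
beq-refl true  = refl
beq-refl false = refl

beq⇒≡ : ∀ {x y} → beq x y ≡ true → x ≡ y
beq⇒≡ {true}  {true}  h = refl
beq⇒≡ {false} {false} h = refl

xor≡false⇒≡ : ∀ {x y} → (x xor y) ≡ false → x ≡ y
xor≡false⇒≡ {true}  {true}  h = refl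
xor≡false⇒≡ {false} {false} h = refl

xor-same : ∀ {x y} → x ≡ y → (x xor y) ≡ false
xor-same {true}  refl = refl
xor-same {false} refl = refl

anyUpTo-intro : ∀ m f {k} → k < m → f k ≡ true → anyUpTo m f ≡ true
anyUpTo-intro (suc m) f {k} k<m h with k ≟ m
... | yes refl = ∨-introʳ h
... | no  k≢m  = ∨-introˡ (anyUpTo-intro m f (≤∧≢⇒< (s≤s⁻¹ k<m) k≢m) h)
  where s≤s⁻¹ : ∀ {x y} → suc x ≤ suc y → x ≤ y
        s≤s⁻¹ (s≤s p) = p

anyUpTo-elim : ∀ m f → anyUpTo m f ≡ true → ∃ λ k → k < m × f k ≡ true
anyUpTo-elim (suc m) f h with ∨-elim {anyUpTo m f} h
... | inj₁ l = let (k , k<m , p) = anyUpTo-elim m f l in k , m<n⇒m<1+n k<m , p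
... | inj₂ r = m , n<1+n m , r

allUpTo-intro : ∀ m f → (∀ k → k < m → f k ≡ true) → allUpTo m f ≡ true
allUpTo-intro zero    f h = refl
allUpTo-intro (suc m) f h = ∧-intro (allUpTo-intro m f (λ k k<m → h k (m<n⇒m<1+n k<m))) (h m (n<1+n m))

allUpTo-elim : ∀ m f → allUpTo m f ≡ true → ∀ k → k < m → f k ≡ true
allUpTo-elim (suc m) f h k k<m with k ≟ m
... | yes refl = ∧-elimʳ {allUpTo m f} h
... | no  k≢m  = allUpTo-elim m f (∧-elimˡ h) k (≤∧≢⇒< (≤-pred k<m) k≢m)

IsLabel : ℕ → ℕ → Set
IsLabel n i = 1 ≤ i × i ≤ n

anyLab-intro : ∀ n f {k} → IsLabel n k → f k ≡ true → anyLab n f ≡ true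
anyLab-intro n f {suc k} (_ , k≤n) h = anyUpTo-intro n (λ k → f (suc k)) k≤n h

anyLab-elim : ∀ n f → anyLab n f ≡ true → ∃ λ k → IsLabel n k × f k ≡ true
anyLab-elim n f h = let (k , k<n , p) = anyUpTo-elim n (λ k → f (suc k)) h in suc k , (s≤s z≤n , k<n) , p

allLab-intro : ∀ n f → (∀ k → IsLabel n k → f k ≡ true) → allLab n f ≡ true
allLab-intro n f h = allUpTo-intro n (λ k → f (suc k)) (λ k k<n → h (suc k) (s≤s z≤n , k<n))

allLab-elim : ∀ n f → allLab n f ≡ true → ∀ k → IsLabel n k → f k ≡ true
allLab-elim n f h (suc k) (_ , k≤n) = allUpTo-elim n (λ k → f (suc k)) h k k≤n

-- Bounded searches

firstFrom-found : ∀ fuel s p dflt {t} → s ≤ t → t < s + fuel → p t ≡ true →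
  (∀ k → s ≤ k → k < t → p k ≡ false) → firstFrom fuel s p dflt ≡ t
firstFrom-found zero s p dflt s≤t t< pt h = ⊥-elim (refute {_ ∷ _ ∷ []} (1 × κ 1 ⊕ # 0 ≼ # 1 ⊕ κ 0 ∋ t< ∷ 1 × # 1 ≼ # 0 ∋ s≤t ∷ []))
firstFrom-found (suc fuel) s p dflt {t} s≤t t< pt h with s ≟ t
... | yes refl rewrite pt = refl
... | no s≢t rewrite h s ≤-refl (≤∧≢⇒< s≤t s≢t) =
  firstFrom-found fuel (suc s) p dflt (≤∧≢⇒< s≤t s≢t) (linear (_ ∷ s ∷ fuel ∷ [])
      (κ 1 ⊕ # 0 ≼ κ 1 ⊕ # 1 ⊕ # 2) 1 (1 × κ 1 ⊕ # 0 ≼ # 1 ⊕ (κ 1 ⊕ # 2) ∋ t< ∷ [])) pt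
    (λ k s<k k<t → h k (linear (_ ∷ _ ∷ []) (# 1 ≼ # 0) 1 (1 × κ 1 ⊕ # 1 ≼ # 0 ∋ s<k ∷ [])) k<t)

firstFrom-none : ∀ fuel s p dflt → (∀ k → s ≤ k → k < s + fuel → p k ≡ false) → firstFrom fuel s p dflt ≡ dflt
firstFrom-none zero s p dflt h = refl
firstFrom-none (suc fuel) s p dflt h rewrite h s ≤-refl (m<m+n s (s≤s z≤n)) =
  firstFrom-none fuel (suc s) p dflt (λ k s<k k< → h k (linear (_ ∷ _ ∷ []) (# 1 ≼ # 0) 1 (1 × κ 1 ⊕ # 1 ≼ # 0 ∋ s<k ∷ [])) (linear (_ ∷
      s ∷ fuel ∷ []) (κ 1 ⊕ # 0 ≼ # 1 ⊕ (κ 1 ⊕ # 2)) 1 (1 × κ 1 ⊕ # 0 ≼ κ 1 ⊕ # 1 ⊕ # 2 ∋ k< ∷ [])))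

firstFrom-cong : ∀ fuel s {p q : ℕ → Bool} dflt → (∀ k → s ≤ k → k < s + fuel → p k ≡ q k) →
  firstFrom fuel s p dflt ≡ firstFrom fuel s q dflt
firstFrom-cong zero s dflt h = refl
firstFrom-cong (suc fuel) s {p} {q} dflt h
  rewrite h s ≤-refl (m<m+n s (s≤s z≤n))
        | firstFrom-cong fuel (suc s) {p} {q} dflt (λ k s<k k< → h k (linear (_ ∷ _ ∷ []) (# 1 ≼ # 0) 1 (1 × κ 1 ⊕ # 1 ≼ # 0 ∋ s<k ∷ []))
            (linear (_ ∷ s ∷ fuel ∷ []) (κ 1 ⊕ # 0 ≼ # 1 ⊕ (κ 1 ⊕ # 2)) 1 (1 × κ 1 ⊕ # 0 ≼ κ 1 ⊕ # 1 ⊕ # 2 ∋ k< ∷ []))) = refl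

data FirstSearch (fuel s : ℕ) (p : ℕ → Bool) : Set where
  none  : (∀ k → s ≤ k → k < s + fuel → p k ≡ false) → FirstSearch fuel s p
  found : ∀ t → s ≤ t → t < s + fuel → p t ≡ true → (∀ k → s ≤ k → k < t → p k ≡ false) → FirstSearch fuel s p

searchFirst : ∀ fuel s p → FirstSearch fuel s p
searchFirst zero s p = none (λ k s≤k k< → ⊥-elim (refute {_ ∷ _ ∷ []} (1 × κ 1 ⊕ # 0 ≼ # 1 ⊕ κ 0 ∋ k< ∷ 1 × # 1 ≼ # 0 ∋ s≤k ∷ [])))
searchFirst (suc fuel) s p with p s in eq
... | true = found s ≤-refl (m<m+n s (s≤s z≤n)) eq (λ k s≤k k<s → ⊥-elim (refute {_ ∷ _ ∷ []} (1 × κ 1 ⊕ # 0 ≼ # 1 ∋ k<s ∷ 1 × # 1 ≼ # 0 ∋ s≤k ∷ [])))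
... | false with searchFirst fuel (suc s) p
...   | none h = none λ k s≤k k< → split k s≤k (λ s<k → h k s<k (linear (s ∷ _ ∷ fuel ∷ [])
    (κ 1 ⊕ # 1 ≼ κ 1 ⊕ # 0 ⊕ # 2) 1 (1 × κ 1 ⊕ # 1 ≼ # 0 ⊕ (κ 1 ⊕ # 2) ∋ k< ∷ [])))
  where split : ∀ k → s ≤ k → (s < k → p k ≡ false) → p k ≡ false
        split k s≤k f with s ≟ k
        ... | yes refl = eq
        ... | no s≢k = f (≤∧≢⇒< s≤k s≢k)
...   | found t s<t t< pt h = found t (linear (_ ∷ _ ∷ []) (# 1 ≼ # 0) 1 (1 × κ 1 ⊕ # 1 ≼ # 0 ∋ s<t ∷ [])) (linear (_ ∷ s ∷ fuel ∷ [])
    (κ 1 ⊕ # 0 ≼ # 1 ⊕ (κ 1 ⊕ # 2)) 1 (1 × κ 1 ⊕ # 0 ≼ κ 1 ⊕ # 1 ⊕ # 2 ∋ t< ∷ [])) pt λ k s≤k k<t → split k s≤k (λ s<k → h k s<k k<t)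
  where split : ∀ k → s ≤ k → (s < k → p k ≡ false) → p k ≡ false
        split k s≤k f with s ≟ k
        ... | yes refl = eq
        ... | no s≢k = f (≤∧≢⇒< s≤k s≢k)

lastDown-found : ∀ m p dflt {t} → IsLabel m t → p t ≡ true → (∀ k → t < k → k ≤ m → p k ≡ false) → lastDown m p dflt ≡ t
lastDown-found zero p dflt (1≤t , t≤0) pt h = ⊥-elim (refute {_ ∷ []} (1 × # 0 ≼ κ 0 ∋ t≤0 ∷ 1 × κ 1 ≼ # 0 ∋ 1≤t ∷ []))
lastDown-found (suc m) p dflt {t} (1≤t , t≤m) pt h with t ≟ suc m
... | yes refl rewrite pt = refl
... | no t≢ rewrite h (suc m) (≤∧≢⇒< t≤m t≢) ≤-refl =
  lastDown-found m p dflt (1≤t , ≤-pred (≤∧≢⇒< t≤m t≢)) pt (λ k t<k k≤m → h k t<k (m≤n⇒m≤1+n k≤m))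

-- Tables and ranked partitions given by functions

at-tabulate : ∀ {A : Set} (dflt : A) n (g : ℕ → A) {i} → i < n → at dflt (tabulate {n = n} (λ x → g (toℕ x))) i ≡ g i
at-tabulate dflt (suc n) g {zero}  _         = refl
at-tabulate dflt (suc n) g {suc i} (s≤s i<n) = at-tabulate dflt n (λ k → g (suc k)) i<n

tabulate-at : ∀ {A : Set} (dflt : A) {n} (xs : Vec A n) → tabulate (λ x → at dflt xs (toℕ x)) ≡ xs
tabulate-at dflt []       = refl
tabulate-at dflt (x ∷ xs) = cong (x ∷_) (tabulate-at dflt xs)

tabulate-ext : ∀ {A : Set} n {f g : ℕ → A} → (∀ i → i < n → f i ≡ g i) →
  tabulate {n = n} (λ x → f (toℕ x)) ≡ tabulate (λ x → g (toℕ x))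
tabulate-ext n h = tabulate-cong (λ x → h (toℕ x) (toℕ<n x))

fromFun-cong : ∀ n {R R′ : ℕ → ℕ → Bool} {r r′ : ℕ → ℕ} →
  (∀ i j → IsLabel n i → IsLabel n j → R i j ≡ R′ i j) → (∀ i → IsLabel n i → r i ≡ r′ i) →
  fromFun n R r ≡ fromFun n R′ r′
fromFun-cong n h k = cong₂ mkRP
  (tabulate-ext n (λ i i<n → tabulate-ext n (λ j j<n → h (suc i) (suc j) (s≤s z≤n , i<n) (s≤s z≤n , j<n))))
  (tabulate-ext n (λ i i<n → k (suc i) (s≤s z≤n , i<n)))

relOf-fromFun : ∀ n R r {i j} → IsLabel n i → IsLabel n j → relOf (fromFun n R r) i j ≡ R i j
relOf-fromFun n R r {suc i} {suc j} (_ , i<n) (_ , j<n) = trans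
  (cong (λ row → at false row j)
    (at-tabulate (replicate n false) n (λ x → tabulate (λ y → R (suc x) (suc (toℕ y)))) i<n))
  (at-tabulate false n (λ y → R (suc i) (suc y)) j<n)

rankOf-fromFun : ∀ n R r {i} → IsLabel n i → rankOf (fromFun n R r) i ≡ r i
rankOf-fromFun n R r {suc i} (_ , i<n) = at-tabulate 0 n (λ x → r (suc x)) i<n

-- Nearest lower positions of a height function

LeftOf : (ℕ → ℕ) → ℕ → ℕ → Set
LeftOf H s i = s < i × H s < H i × (∀ k → s < k → k < i → H i ≤ H k)

-- The position named is `t`, just before the descent, and not the lower position `suc t`: it is the
-- west end of the east step where a laser from `i` ends, and the index of the rise that ranks the
-- block of `i` in Q.
RightOf : (ℕ → ℕ) → ℕ → ℕ → Set
RightOf H i t = i ≤ t × H (suc t) < H i × (∀ k → i ≤ k → k ≤ t → H i ≤ H k)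

LeftOf-unique : ∀ {H s s′ i} → LeftOf H s i → LeftOf H s′ i → s ≡ s′
LeftOf-unique {H} {s} {s′} (s<i , lo , hi) (s′<i , lo′ , hi′) with <-cmp s s′
... | tri≈ _ s≡s′ _ = s≡s′
... | tri< s<s′ _ _ = ⊥-elim (<⇒≱ lo′ (hi s′ s<s′ s′<i))
... | tri> _ _ s′<s = ⊥-elim (<⇒≱ lo (hi′ s s′<s s<i))

RightOf-unique : ∀ {H i t t′} → RightOf H i t → RightOf H i t′ → t ≡ t′
RightOf-unique {H} {i} {t} {t′} (i≤t , lo , hi) (i≤t′ , lo′ , hi′) with <-cmp t t′
... | tri≈ _ t≡t′ _ = t≡t′
... | tri< t<t′ _ _ = ⊥-elim (<⇒≱ lo (hi′ (suc t) (m≤n⇒m≤1+n i≤t) t<t′))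
... | tri> _ _ t′<t = ⊥-elim (<⇒≱ lo′ (hi (suc t′) (m≤n⇒m≤1+n i≤t′) t′<t))

lastBelow : (ℕ → ℕ) → ℕ → ℕ → ℕ
lastBelow H x zero    = 0
lastBelow H x (suc k) = if H k <ᵇ x then k else lastBelow H x k

lastBelow-spec : ∀ H x k → 0 < k → H 0 < x →
  lastBelow H x k < k × H (lastBelow H x k) < x × (∀ j → lastBelow H x k < j → j < k → x ≤ H j)
lastBelow-spec H x (suc k) _ H0<x with H k <ᵇ x in eq
... | true = ≤-refl , <ᵇ≡true⇒< eq , λ j k<j j<sk → ⊥-elim (<⇒≱ k<j (≤-pred j<sk))
... | false with k
...   | zero = ⊥-elim (true≢false (<⇒<ᵇ≡true H0<x) eq)
...   | suc k′ = let (lt , lo , hi) = lastBelow-spec H x (suc k′) (s≤s z≤n) H0<x in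
  m<n⇒m<1+n lt , lo , λ j l<j j<sk → beyond j l<j (≤-pred j<sk) hi
  where
  beyond : ∀ j → lastBelow H x (suc k′) < j → j ≤ suc k′ →
    (∀ j → lastBelow H x (suc k′) < j → j < suc k′ → x ≤ H j) → x ≤ H j
  beyond j l<j j≤k hi with j ≟ suc k′
  ... | yes refl = <ᵇ≡false⇒≤ eq
  ... | no j≢k = hi j l<j (≤∧≢⇒< j≤k j≢k)

leftOf : (ℕ → ℕ) → ℕ → ℕ
leftOf H i = lastBelow H (H i) i

rightOf : ℕ → (ℕ → ℕ) → ℕ → ℕ
rightOf n H i = firstFrom (suc n) i (λ j → H (suc j) <ᵇ H i) n

-- The heights b y − a x of a Dyck path along its labels; they are pairwise distinct because a and b are coprime.
record Excursion (n : ℕ) (H : ℕ → ℕ) : Set where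
  field
    start    : H 0 ≡ 0
    end      : H (suc n) ≡ 0
    positive : ∀ {i} → IsLabel n i → 0 < H i
    distinct : ∀ {i j} → IsLabel n i → IsLabel n j → H i ≡ H j → i ≡ j

module ExcursionProperties {n : ℕ} {H : ℕ → ℕ} (E : Excursion n H) where
  open Excursion E public

  lf rt : ℕ → ℕ
  lf = leftOf H
  rt = rightOf n H

  lf-spec : ∀ {i} → IsLabel n i → LeftOf H (lf i) i
  lf-spec {i} l@(1≤i , _) = lastBelow-spec H (H i) i 1≤i (linear (_ ∷ _ ∷ []) (κ 1 ⊕ # 0 ≼ # 1) 1 (1 ⇒ # 0 ≈ κ 0 ∋ start ∷ 1 × κ 1 ≼ # 1 ∋
      positive l ∷ []))

  rt-spec : ∀ {i} → IsLabel n i → RightOf H i (rt i) × rt i ≤ n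
  rt-spec {i} l@(1≤i , i≤n) with searchFirst (suc n) i (λ j → H (suc j) <ᵇ H i)
  ... | none h = ⊥-elim (true≢false (<⇒<ᵇ≡true end<) (h n i≤n (linear (_ ∷ _ ∷ []) (κ 1 ⊕ # 1 ≼ # 0 ⊕ (κ 1 ⊕ # 1)) 1 (1 × κ 1 ≼ # 0 ∋ 1≤i ∷ []))))
    where
    end< : H (suc n) < H i
    end< = linear (_ ∷ _ ∷ []) (κ 1 ⊕ # 0 ≼ # 1) 1 (1 ⇒ # 0 ≈ κ 0 ∋ end ∷ 1 × κ 1 ≼ # 1 ∋ positive l ∷ [])
  ... | found t i≤t t< pt before = subst (λ z → RightOf H i z × z ≤ n) (sym eq) ((i≤t , <ᵇ≡true⇒< pt , high) , t≤n)
    where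
    eq : rt i ≡ t
    eq = firstFrom-found (suc n) i _ n i≤t t< pt before
    end< : H (suc n) < H i
    end< = linear (_ ∷ _ ∷ []) (κ 1 ⊕ # 0 ≼ # 1) 1 (1 ⇒ # 0 ≈ κ 0 ∋ end ∷ 1 × κ 1 ≼ # 1 ∋ positive l ∷ [])
    t≤n : t ≤ n
    t≤n = ≮⇒≥ λ n<t → true≢false (<⇒<ᵇ≡true end<) (before n i≤n n<t)
    high : ∀ k → i ≤ k → k ≤ t → H i ≤ H k
    high k i≤k k≤t with m≤n⇒m<n∨m≡n i≤k
    ... | inj₂ refl = ≤-refl
    high (suc k) _ k<t | inj₁ (s≤s i≤k) = <ᵇ≡false⇒≤ (before k i≤k k<t)

  lf-unique : ∀ {s i} → IsLabel n i → LeftOf H s i → lf i ≡ s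
  lf-unique l L = LeftOf-unique {H} (lf-spec l) L

  rt-unique : ∀ {i t} → IsLabel n i → RightOf H i t → rt i ≡ t
  rt-unique l R = RightOf-unique {H} (proj₁ (rt-spec l)) R

  lf< : ∀ {i} → IsLabel n i → lf i < i
  lf< l = proj₁ (lf-spec l)

  lf-lower : ∀ {i} → IsLabel n i → H (lf i) < H i
  lf-lower l = proj₁ (proj₂ (lf-spec l))

  lf-high : ∀ {i} → IsLabel n i → ∀ k → lf i < k → k < i → H i ≤ H k
  lf-high l = proj₂ (proj₂ (lf-spec l))

  ≤rt : ∀ {i} → IsLabel n i → i ≤ rt i
  ≤rt l = proj₁ (proj₁ (rt-spec l))

  rt≤n : ∀ {i} → IsLabel n i → rt i ≤ n
  rt≤n l = proj₂ (rt-spec l)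

  rt-lower : ∀ {i} → IsLabel n i → H (suc (rt i)) < H i
  rt-lower l = proj₁ (proj₂ (proj₁ (rt-spec l)))

  rt-high : ∀ {i} → IsLabel n i → ∀ k → i ≤ k → k ≤ rt i → H i ≤ H k
  rt-high l = proj₂ (proj₂ (proj₁ (rt-spec l)))

  rt-label : ∀ {i} → IsLabel n i → IsLabel n (rt i)
  rt-label l@(1≤i , _) = ≤-trans 1≤i (≤rt l) , rt≤n l

  lf-suc-label : ∀ {i} → IsLabel n i → IsLabel n (suc (lf i))
  lf-suc-label l@(_ , i≤n) = s≤s z≤n , ≤-trans (lf< l) i≤n

  H-lf-suc : ∀ {i} → IsLabel n i → H (lf i) < H (suc (lf i))
  H-lf-suc {i} l with suc (lf i) ≟ i
  ... | yes eq = subst (λ z → H (lf i) < H z) (sym eq) (lf-lower l)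
  ... | no neq = <-≤-trans (lf-lower l) (lf-high l _ ≤-refl (≤∧≢⇒< (lf< l) neq))

  lf-suc : ∀ {s} → suc s ≤ n → H s < H (suc s) → lf (suc s) ≡ s
  lf-suc s<n up = lf-unique (s≤s z≤n , s<n) (≤-refl , up , λ k s<k k<ss → ⊥-elim (<⇒≱ s<k (≤-pred k<ss)))

  rt-self : ∀ {t} → IsLabel n t → H (suc t) < H t → rt t ≡ t
  rt-self {t} l down = rt-unique l (≤-refl , down , λ k t≤k k≤t → ≤-reflexive (cong H (≤-antisym t≤k k≤t)))

  -- The label `suc (lf i)` lies in the block of `i` in P and is its minimum, so the rank of the
  -- block is the rise at `lf i`. In the same way `rt i` is the maximum of the block of `i` in Q.
  lf-suc-lf : ∀ {i} → IsLabel n i → lf (suc (lf i)) ≡ lf i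
  lf-suc-lf {i} l = lf-suc (proj₂ (lf-suc-label l)) (H-lf-suc l)

  rt-rt : ∀ {i} → IsLabel n i → rt (rt i) ≡ rt i
  rt-rt {i} l = rt-self (rt-label l) (<-≤-trans (rt-lower l) (rt-high l _ (≤rt l) ≤-refl))

-- Lasers and labeled pairs of a Dyck path in terms of heights

height : (a b : ℕ) → Vec ℕ b → ℕ → ℕ
height a b v i = b * sumUpTo i (at 0 v) ∸ a * i

-- Blocks are the fibres of `f` and ranks factor through `f`. The pairs of paths and of cyclic walks
-- both get this form, so comparing them is a matter of renaming codes.
coded : ∀ n → (ℕ → ℕ) → (ℕ → ℕ) → RP n
coded n f w = fromFun n (λ i j → f i ≡ᵇ f j) (λ i → w (f i))

module DyckPath (a n : ℕ) (v : Vec ℕ (suc n)) (dyck : IsDyck a (suc n) v)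
                (1≤a : 1 ≤ a) (coprime : Coprime a (suc n)) (2≤n : 2 ≤ n) where

  open Path a (suc n) v using (vv; hgt; hasLaser; crosses; target; above; separated; relP; rankP; inL; genQ; reach; relQ; rankQ)

  H : ℕ → ℕ
  H = height a (suc n) v

  H-eq : ∀ i → i ≤ suc n → H i + a * i ≡ suc n * hgt i
  H-eq i i≤b = m∸n+n≡m (bound i i≤b)
    where
    bound : ∀ i → i ≤ suc n → a * i ≤ suc n * hgt i
    bound zero    _   = ≤-trans (≤-reflexive (*-zeroʳ a)) z≤n
    bound (suc i) i≤b = proj₂ dyck (suc i) (s≤s z≤n) i≤b

  H-suc : ∀ i → i ≤ n → H (suc i) + a ≡ H i + suc n * vv i
  H-suc i i≤n = linear≡ (H i ∷ a * i ∷ _ ∷ H (suc i) ∷ _ ∷ _ ∷ a ∷ suc n * vv i ∷ []) (# 3 ⊕ # 6 ≈ # 0 ⊕ # 7) 1 (1 ⇐ # 0 ⊕ # 1 ≈ # 2 ∋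
      H-eq i (m≤n⇒m≤1+n i≤n) ∷ 1 ⇒ # 3 ⊕ # 4 ≈ # 5 ∋ H-eq (suc i) (s≤s i≤n) ∷ 1 ⇐ # 4 ≈ # 6 ⊕ # 1 ∋ *-suc a i ∷ 1 ⇒ # 5 ≈ # 2 ⊕ # 7 ∋
      expand ∷ [])
    where
    expand : suc n * hgt (suc i) ≡ suc n * hgt i + suc n * vv i
    expand = *-distribˡ-+ (suc n) (hgt i) (vv i)

  -- Coprimality enters the geometry here: a label at height 0, or two labels at equal height, would
  -- make `b` divide `a k` for some `0 < k < b`.
  b∣⇒⊥ : ∀ {k} → IsLabel n k → ¬ suc n ∣ a * k
  b∣⇒⊥ {suc k} (_ , k≤n) h = <⇒≱ (s≤s k≤n) (∣⇒≤ (coprime-divisor (coprime-sym coprime) h))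

  excursion : Excursion n H
  excursion = record { start = H0 ; end = Hb ; positive = pos ; distinct = dist }
    where
    H0 : H 0 ≡ 0
    H0 = m≤n⇒m∸n≡0 {suc n * 0} {a * 0} (≤-trans (≤-reflexive (*-zeroʳ (suc n))) z≤n)
    Hb : H (suc n) ≡ 0
    Hb = m≤n⇒m∸n≡0 {suc n * hgt (suc n)} {a * suc n} (≤-reflexive (trans (cong (suc n *_) (proj₁ dyck)) (*-comm (suc n) a)))
    pos : ∀ {i} → IsLabel n i → 0 < H i
    pos {i} l@(_ , i≤n) = n≢0⇒n>0 λ Hi≡0 → b∣⇒⊥ l
      (divides (hgt i) (trans (trans (cong (_+ a * i) (sym Hi≡0)) (H-eq i (m≤n⇒m≤1+n i≤n))) (*-comm (suc n) _)))
    ordered : ∀ {i j} → IsLabel n i → IsLabel n j → H i ≡ H j → ¬ i < j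
    ordered {i} {j} (1≤i , i≤n) (_ , j≤n) Hi≡Hj i<j =
      b∣⇒⊥ (m<n⇒0<n∸m i<j , ≤-trans (m∸n≤m j i) j≤n) (∣m+n∣m⇒∣n {suc n} {suc n * hgt i} (divides (hgt j) eq) (divides (hgt i) (*-comm (suc n) _)))
      where
      eq : suc n * hgt i + a * (j ∸ i) ≡ hgt j * suc n
      eq = linear≡ (_ ∷ a * i ∷ _ ∷ _ ∷ _ ∷ _ ∷ _ ∷ a * (j ∸ i) ∷ []) (# 2 ⊕ # 7 ≈ # 6) 1 (1 ⇐ # 0 ⊕ # 1 ≈ # 2 ∋ H-eq i (m≤n⇒m≤1+n i≤n) ∷
          1 ⇒ # 3 ⊕ # 4 ≈ # 5 ∋ H-eq j (m≤n⇒m≤1+n j≤n) ∷ 1 ⇐ # 6 ≈ # 5 ∋ *-comm (hgt j) (suc n) ∷ 1 ⇒ # 1 ⊕ # 7 ≈ # 4 ∋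
          trans (sym (*-distribˡ-+ a i (j ∸ i))) (cong (a *_) (m+[n∸m]≡n (<⇒≤ i<j))) ∷ 1 ⇒ # 0 ≈ # 3 ∋ Hi≡Hj ∷ [])
    dist : ∀ {i j} → IsLabel n i → IsLabel n j → H i ≡ H j → i ≡ j
    dist {i} {j} li lj eq with <-cmp i j
    ... | tri≈ _ i≡j _ = i≡j
    ... | tri< i<j _ _ = ⊥-elim (ordered li lj eq i<j)
    ... | tri> _ _ j<i = ⊥-elim (ordered lj li (sym eq) j<i)

  open ExcursionProperties excursion public

  compare : ∀ i j → i ≤ j → j ≤ suc n → a * (j ∸ i) + a * i ≡ a * j × H i + a * i ≡ suc n * hgt i × H j + a * j ≡ suc n * hgt j
  compare i j i≤j j≤b = trans (sym (*-distribˡ-+ a (j ∸ i) i)) (cong (a *_) (m∸n+n≡m i≤j)) , H-eq i (≤-trans i≤j j≤b) , H-eq j j≤b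

  crosses⇒ : ∀ {i j} → i ≤ j → crosses i j ≡ true → j ≤ n × H (suc j) < H i
  crosses⇒ {i} {j} i≤j h = j≤n , linear (_ ∷ _ ∷ a * (suc j ∸ i) ∷ a * i ∷ _ ∷ _ ∷ _ ∷ []) (κ 1 ⊕ # 6 ≼ # 5) 1 (1 × κ 1 ⊕ # 0 ≼ # 1 ⊕ # 2 ∋
      raw ∷ 1 ⇒ # 2 ⊕ # 3 ≈ # 4 ∋ e₁ ∷ 1 ⇐ # 5 ⊕ # 3 ≈ # 1 ∋ e₂ ∷ 1 ⇒ # 6 ⊕ # 4 ≈ # 0 ∋ e₃ ∷ [])
    where
    raw : suc n * hgt (suc j) < suc n * hgt i + a * (suc j ∸ i)
    raw = <ᵇ≡true⇒< {suc n * hgt (suc j)} {suc n * hgt i + a * (suc j ∸ i)} (∧-elimʳ {j <ᵇ suc n} h)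
    j≤n : j ≤ n
    j≤n = ≤-pred (<ᵇ≡true⇒< (∧-elimˡ h))
    c = compare i (suc j) (m≤n⇒m≤1+n i≤j) (s≤s j≤n)
    e₁ : a * (suc j ∸ i) + a * i ≡ a * suc j
    e₁ = proj₁ c
    e₂ : H i + a * i ≡ suc n * hgt i
    e₂ = proj₁ (proj₂ c)
    e₃ : H (suc j) + a * suc j ≡ suc n * hgt (suc j)
    e₃ = proj₂ (proj₂ c)

  ⇒crosses : ∀ {i j} → i ≤ j → j ≤ n → H (suc j) < H i → crosses i j ≡ true
  ⇒crosses {i} {j} i≤j j≤n lt = ∧-intro (<⇒<ᵇ≡true (s≤s j≤n)) (<⇒<ᵇ≡true less)
    where
    c = compare i (suc j) (m≤n⇒m≤1+n i≤j) (s≤s j≤n)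
    e₁ : a * (suc j ∸ i) + a * i ≡ a * suc j
    e₁ = proj₁ c
    e₂ : H i + a * i ≡ suc n * hgt i
    e₂ = proj₁ (proj₂ c)
    e₃ : H (suc j) + a * suc j ≡ suc n * hgt (suc j)
    e₃ = proj₂ (proj₂ c)
    less : suc n * hgt (suc j) < suc n * hgt i + a * (suc j ∸ i)
    less = linear (a * (suc j ∸ i) ∷ a * i ∷ _ ∷ _ ∷ _ ∷ _ ∷ _ ∷ []) (κ 1 ⊕ # 6 ≼ # 4 ⊕ # 0) 1 (1 ⇐ # 0 ⊕ # 1 ≈ # 2 ∋ e₁ ∷
        1 ⇒ # 3 ⊕ # 1 ≈ # 4 ∋ e₂ ∷ 1 ⇐ # 5 ⊕ # 2 ≈ # 6 ∋ e₃ ∷ 1 × κ 1 ⊕ # 5 ≼ # 3 ∋ lt ∷ [])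

  -- Lines of slope `a/b` are the level lines of `H`, so the laser from `i` ends on the east step
  -- along which `H` first drops below its value at `i`.
  target≡rt : ∀ {i} → IsLabel n i → target i ≡ rt i
  target≡rt {i} l@(1≤i , i≤n) = firstFrom-found (suc n) i (crosses i) n (≤rt l)
    (linear (_ ∷ _ ∷ _ ∷ []) (κ 1 ⊕ # 0 ≼ # 2 ⊕ (κ 1 ⊕ # 1)) 1 (1 × # 0 ≼ # 1 ∋ rt≤n l ∷ 1 × κ 1 ≼ # 2 ∋ 1≤i ∷ [])) (⇒crosses (≤rt l)
        (rt≤n l) (rt-lower l))
    λ k i≤k k<t → ¬true⇒false λ c → <⇒≱ (proj₂ (crosses⇒ i≤k c)) (rt-high l (suc k) (m≤n⇒m≤1+n i≤k) k<t)

  up⇒laser : ∀ {k} → k ≤ n → H k < H (suc k) → hasLaser k ≡ true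
  up⇒laser {k} k≤n up = <⇒<ᵇ≡true (n≢0⇒n>0 λ v≡0 → refute {_ ∷ _ ∷ _ ∷ _ ∷ []} (1 × κ 1 ⊕ # 0 ≼ # 1 ∋ up ∷ 1 ⇒ # 1 ⊕ # 2 ≈ # 0 ⊕ # 3 ∋
      H-suc k k≤n ∷ 1 ⇒ # 3 ≈ κ 0 ∋ flat v≡0 ∷ 1 × κ 1 ≼ # 2 ∋ 1≤a ∷ []))
    where
    flat : vv k ≡ 0 → suc n * vv k ≡ 0
    flat v≡0 = trans (cong (suc n *_) v≡0) (*-zeroʳ (suc n))

  noLaser⇒down : ∀ {k} → k ≤ n → hasLaser k ≡ false → H (suc k) < H k
  noLaser⇒down {k} k≤n h = linear (_ ∷ _ ∷ _ ∷ _ ∷ []) (κ 1 ⊕ # 1 ≼ # 2) 1 (1 × κ 1 ≼ # 0 ∋ 1≤a ∷ 1 ⇒ # 1 ⊕ # 0 ≈ # 2 ⊕ # 3 ∋ H-suc k k≤n ∷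
      1 ⇒ # 3 ≈ κ 0 ∋ flat ∷ [])
    where
    flat : suc n * vv k ≡ 0
    flat = trans (cong (suc n *_) (n≤0⇒n≡0 (<ᵇ≡false⇒≤ {0} {vv k} h))) (*-zeroʳ (suc n))

  -- The height form of `above`. A label `k` seen in this way is followed by a rise of the height,
  -- so it does emit a laser. The inequality is strict because heights of distinct labels differ.
  Sees : ℕ → ℕ → Set
  Sees k m = k < m × (∀ j → k < j → j ≤ m → H k < H j)

  above⇒Sees : ∀ {k m} → IsLabel n k → IsLabel n m → above k m ≡ true → Sees k m
  above⇒Sees {k} {m} lk lm@(_ , m≤n) h = k<m , λ j k<j j≤m → ≤∧≢⇒< (rt-high lk j (<⇒≤ k<j) (≤-trans j≤m m≤rt))
      λ eq → <⇒≢ k<j (distinct lk (≤-trans (s≤s z≤n) k<j , ≤-trans j≤m m≤n) eq)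
    where
    rest = ∧-elimʳ {hasLaser k} h
    k≤m : k ≤ m
    k≤m = ≤ᵇ≡true⇒≤ (∧-elimˡ rest)
    rest₂ = ∧-elimʳ {k ≤ᵇ m} rest
    m≤rt : m ≤ rt k
    m≤rt = subst (m ≤_) (target≡rt lk) (≤ᵇ≡true⇒≤ (∧-elimˡ rest₂))
    c = compare k m k≤m (m≤n⇒m≤1+n m≤n)
    raw : suc n * hgt k + a * (m ∸ k) < suc n * hgt m
    raw = <ᵇ≡true⇒< {suc n * hgt k + a * (m ∸ k)} {suc n * hgt m} (∧-elimʳ {m ≤ᵇ target k} rest₂)
    lower : H k < H m
    lower = linear (_ ∷ a * (m ∸ k) ∷ _ ∷ a * k ∷ _ ∷ _ ∷ _ ∷ []) (κ 1 ⊕ # 5 ≼ # 6) 1 (1 × κ 1 ⊕ (# 0 ⊕ # 1) ≼ # 2 ∋ raw ∷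
        1 ⇐ # 1 ⊕ # 3 ≈ # 4 ∋ proj₁ c ∷ 1 ⇒ # 5 ⊕ # 3 ≈ # 0 ∋ proj₁ (proj₂ c) ∷ 1 ⇐ # 6 ⊕ # 4 ≈ # 2 ∋ proj₂ (proj₂ c) ∷ [])
    k<m : k < m
    k<m = ≤∧≢⇒< k≤m λ eq → <-irrefl (cong H eq) lower

  Sees⇒laser : ∀ {k m} → IsLabel n k → m ≤ n → Sees k m → hasLaser k ≡ true
  Sees⇒laser {k} lk m≤n (k<m , low) = up⇒laser (proj₂ lk) (low (suc k) ≤-refl k<m)

  Sees⇒above : ∀ {k m} → IsLabel n k → IsLabel n m → Sees k m → above k m ≡ true
  Sees⇒above {k} {m} lk lm@(_ , m≤n) s@(k<m , low) = ∧-intro (Sees⇒laser lk m≤n s)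
    (∧-intro (≤⇒≤ᵇ≡true (<⇒≤ k<m)) (∧-intro (≤⇒≤ᵇ≡true (subst (m ≤_) (sym (target≡rt lk)) m≤rt)) (<⇒<ᵇ≡true less)))
    where
    m≤rt : m ≤ rt k
    m≤rt = ≮⇒≥ λ rt<m → <⇒≱ (rt-lower lk) (<⇒≤ (low (suc (rt k)) (s≤s (≤rt lk)) rt<m))
    c = compare k m (<⇒≤ k<m) (m≤n⇒m≤1+n m≤n)
    less : suc n * hgt k + a * (m ∸ k) < suc n * hgt m
    less = linear (_ ∷ _ ∷ a * (m ∸ k) ∷ a * k ∷ _ ∷ _ ∷ _ ∷ []) (κ 1 ⊕ (# 5 ⊕ # 2) ≼ # 6) 1 (1 × κ 1 ⊕ # 0 ≼ # 1 ∋ low m k<m ≤-refl ∷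
        1 ⇒ # 2 ⊕ # 3 ≈ # 4 ∋ proj₁ c ∷ 1 ⇐ # 0 ⊕ # 3 ≈ # 5 ∋ proj₁ (proj₂ c) ∷ 1 ⇒ # 1 ⊕ # 4 ≈ # 6 ∋ proj₂ (proj₂ c) ∷ [])

  -- The labels seen by m are determined by lf m: they are lf m itself and the labels it sees.
  SeesLeft : ℕ → ℕ → Set
  SeesLeft k s = k ≤ s × (∀ j → k < j → j ≤ s → H k < H j)

  Sees⇒SeesLeft : ∀ {k m} → IsLabel n m → Sees k m → SeesLeft k (lf m)
  Sees⇒SeesLeft {k} {m} lm (k<m , low) =
    ≮⇒≥ (λ lf<k → <⇒≱ (low m k<m ≤-refl) (lf-high lm k lf<k k<m)) ,
    λ j k<j j≤s → low j k<j (≤-trans j≤s (<⇒≤ (lf< lm)))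

  SeesLeft⇒Sees : ∀ {k m} → IsLabel n m → SeesLeft k (lf m) → Sees k m
  SeesLeft⇒Sees {k} {m} lm (k≤s , low) = ≤-<-trans k≤s (lf< lm) , sees
    where
    base : H k < H m
    base with m≤n⇒m<n∨m≡n k≤s
    ... | inj₁ k<s  = <-trans (low (lf m) k<s ≤-refl) (lf-lower lm)
    ... | inj₂ refl = lf-lower lm
    sees : ∀ j → k < j → j ≤ m → H k < H j
    sees j k<j j≤m with j ≤? lf m | j ≟ m
    ... | yes j≤s | _        = low j k<j j≤s
    ... | no  _   | yes refl = base
    ... | no  s<j | no j≢m   = <-≤-trans base (lf-high lm j (≰⇒> s<j) (≤∧≢⇒< j≤m j≢m))

  -- If `lf i` is a label, then `i` sees it and lies above its laser. Unseparated labels lie above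
  -- the same lasers, so `j` sees it too, and whatever `j` sees is at most `lf j`. By symmetry the
  -- two positions agree.
  relP⇒lf : ∀ {i j} → IsLabel n i → IsLabel n j → relP i j ≡ true → lf i ≡ lf j
  relP⇒lf {i} {j} li lj h = ≤-antisym (half li lj same) (half lj li (λ k lk h → sym (same k lk h)))
    where
    same : ∀ k → IsLabel n k → hasLaser k ≡ true → above k i ≡ above k j
    same k lk hl = xor≡false⇒≡ (¬true⇒false λ x →
      true≢false (anyLab-intro n (λ k → hasLaser k ∧ (above k i xor above k j)) lk (∧-intro hl x)) (not-true h))
    half : ∀ {i j} → IsLabel n i → IsLabel n j → (∀ k → IsLabel n k → hasLaser k ≡ true → above k i ≡ above k j) → lf i ≤ lf j
    half {i} {j} li lj eq with lf i in e
    ... | zero  = z≤n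
    ... | suc s = proj₁ (Sees⇒SeesLeft lj (above⇒Sees lk lj (trans (sym (eq _ lk (Sees⇒laser lk (proj₂ li) sees))) (Sees⇒above lk li sees))))
      where
      lk : IsLabel n (suc s)
      lk = s≤s z≤n , ≤-trans (<⇒≤ (subst (_< i) e (lf< li))) (proj₂ li)
      sees : Sees (suc s) i
      sees = SeesLeft⇒Sees li (≤-reflexive (sym e) , λ j k<j j≤ → ⊥-elim (<⇒≱ k<j (≤-trans j≤ (≤-reflexive e))))

  lf⇒relP : ∀ {i j} → IsLabel n i → IsLabel n j → lf i ≡ lf j → relP i j ≡ true
  lf⇒relP {i} {j} li lj eq = cong not (¬true⇒false λ h →
    let (k , lk , p) = anyLab-elim n (λ k → hasLaser k ∧ (above k i xor above k j)) h in
    true≢false (∧-elimʳ {hasLaser k} p) (xor-same (bool-ext (half li lj eq lk) (half lj li (sym eq) lk))))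
    where
    half : ∀ {i j} → IsLabel n i → IsLabel n j → lf i ≡ lf j → ∀ {k} → IsLabel n k → above k i ≡ true → above k j ≡ true
    half li lj eq {k} lk p = Sees⇒above lk lj (SeesLeft⇒Sees lj (subst (SeesLeft k) eq (Sees⇒SeesLeft li (above⇒Sees lk li p))))

  rankP≡ : ∀ {i} → IsLabel n i → rankP i ≡ vv (lf i)
  rankP≡ {i} l = cong (λ z → vv (z ∸ 1)) (firstFrom-found n 1 (relP i) i (s≤s z≤n) (s≤s (proj₂ (lf-suc-label l)))
    (lf⇒relP l (lf-suc-label l) (sym (lf-suc-lf l)))
    λ k 1≤k k≤s → ¬true⇒false λ h → let lk = 1≤k , ≤-trans (<⇒≤ k≤s) (proj₂ (lf-suc-label l)) in
      <⇒≱ (≤-<-trans (≤-reflexive (relP⇒lf l lk h)) (lf< lk)) (≤-pred k≤s))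

  inL⇒rt : ∀ {i j} → IsLabel n i → inL i j ≡ true → rt i ≡ rt j
  inL⇒rt {i} {j} li p = trans (sym (rt-rt li)) (cong rt (trans (sym (target≡rt li)) (≡ᵇ≡true⇒≡ (∧-elimʳ {hasLaser i} p))))

  genQ⇒rt : ∀ {i j} → IsLabel n i → IsLabel n j → genQ i j ≡ true → rt i ≡ rt j
  genQ⇒rt {i} {j} li lj h with ∨-elim {hasLaser i ∧ hasLaser j ∧ (target i ≡ᵇ target j) ∧ (suc n * vv (target i) <ᵇ a)} h
  ... | inj₁ h₁ = trans (sym (target≡rt li)) (trans (≡ᵇ≡true⇒≡ (∧-elimˡ (∧-elimʳ {hasLaser j} (∧-elimʳ {hasLaser i} h₁)))) (target≡rt lj))
  ... | inj₂ h₂ with ∨-elim {inL i j} h₂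
  ...   | inj₁ p = inL⇒rt li p
  ...   | inj₂ p = sym (inL⇒rt lj p)

  reach⇒rt : ∀ s {i j} → IsLabel n i → IsLabel n j → reach s i j ≡ true → rt i ≡ rt j
  reach⇒rt zero    li lj h = cong rt (≡ᵇ≡true⇒≡ h)
  reach⇒rt (suc s) {i} {j} li lj h with ∨-elim {reach s i j} h
  ... | inj₁ p = reach⇒rt s li lj p
  ... | inj₂ p = let (m , lm , q) = anyLab-elim n (λ m → reach s i m ∧ genQ m j) p in
    trans (reach⇒rt s li lm (∧-elimˡ q)) (genQ⇒rt lm lj (∧-elimʳ {reach s i m} q))

  reach-mono : ∀ {s t i j} → s ≤ t → reach s i j ≡ true → reach t i j ≡ true
  reach-mono {s} {zero} z≤n h = h
  reach-mono {s} {suc t} s≤t h with m≤n⇒m<n∨m≡n s≤t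
  ... | inj₁ (s≤s s≤t′) = ∨-introˡ (reach-mono s≤t′ h)
  ... | inj₂ refl       = h

  reach-step : ∀ s {i m j} → IsLabel n m → reach s i m ≡ true → genQ m j ≡ true → reach (suc s) i j ≡ true
  reach-step s {i} {m} {j} lm h g = ∨-introʳ {reach s i j} (anyLab-intro n (λ m → reach s i m ∧ genQ m j) lm (∧-intro h g))

  laser-ends : ∀ {i} → IsLabel n i → i ≡ rt i ⊎ inL i (rt i) ≡ true
  laser-ends {i} l with hasLaser i in eq
  ... | true  = inj₂ (≡⇒≡ᵇ≡true (target≡rt l))
  ... | false = inj₁ (sym (rt-self l (noLaser⇒down (proj₂ l) eq)))

  -- Two generator steps suffice, from `i` to the common `rt i` and from there to `j`; a label
  -- without a laser already equals its `rt`. The bound `2 ≤ n` lets both steps fit into `reach n`.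
  rt⇒relQ : ∀ {i j} → IsLabel n i → IsLabel n j → rt i ≡ rt j → relQ i j ≡ true
  rt⇒relQ {i} {j} li lj eq = reach-mono 2≤n (second (laser-ends lj))
    where
    first : i ≡ rt i ⊎ inL i (rt i) ≡ true → reach 1 i (rt i) ≡ true
    first (inj₁ e) = ∨-introˡ (≡⇒≡ᵇ≡true e)
    first (inj₂ p) = reach-step 0 {i} {i} {rt i} li (≡⇒≡ᵇ≡true {i} refl) (∨-introʳ {hasLaser i ∧ _} (∨-introˡ p))
    toRt : reach 1 i (rt j) ≡ true
    toRt = subst (λ z → reach 1 i z ≡ true) eq (first (laser-ends li))
    second : j ≡ rt j ⊎ inL j (rt j) ≡ true → reach 2 i j ≡ true
    second (inj₁ e) = ∨-introˡ (subst (λ z → reach 1 i z ≡ true) (sym e) toRt)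
    second (inj₂ p) = reach-step 1 {i} {rt j} {j} (rt-label lj) toRt
      (∨-introʳ {hasLaser (rt j) ∧ hasLaser j ∧ (target (rt j) ≡ᵇ target j) ∧ (suc n * vv (target (rt j)) <ᵇ a)} (∨-introʳ {inL (rt j) j} p))

  rankQ≡ : ∀ {i} → IsLabel n i → rankQ i ≡ vv (rt i)
  rankQ≡ {i} l = cong vv (lastDown-found n (relQ i) i (rt-label l) (rt⇒relQ l (rt-label l) (sym (rt-rt l)))
    λ k t<k k≤n → ¬true⇒false λ h → let lk = ≤-trans (s≤s z≤n) t<k , k≤n in
      <⇒≱ (<-≤-trans t<k (≤rt lk)) (≤-reflexive (sym (reach⇒rt n l lk h))))

  π-coded : π a (suc n) v ≡ (coded n lf vv , coded n rt vv)
  π-coded = cong₂ _,_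
    (fromFun-cong n (λ i j li lj → bool-ext (λ h → ≡⇒≡ᵇ≡true (relP⇒lf li lj h)) (λ h → lf⇒relP li lj (≡ᵇ≡true⇒≡ h))) (λ i → rankP≡))
    (fromFun-cong n (λ i j li lj → bool-ext (λ h → ≡⇒≡ᵇ≡true (reach⇒rt n li lj h)) (λ h → rt⇒relQ li lj (≡ᵇ≡true⇒≡ h))) (λ i → rankQ≡))

-- Rotation of the labeled pair of a path

if-true : ∀ {A : Set} {x y : A} {c} → c ≡ true → (if c then x else y) ≡ x
if-true refl = refl

if-false : ∀ {A : Set} {x y : A} {c} → c ≡ false → (if c then x else y) ≡ y
if-false refl = refl

sumUpTo-cong : ∀ m {f g : ℕ → ℕ} → (∀ k → k < m → f k ≡ g k) → sumUpTo m f ≡ sumUpTo m g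
sumUpTo-cong zero    h = refl
sumUpTo-cong (suc m) h = cong₂ _+_ (sumUpTo-cong m (λ k k<m → h k (m<n⇒m<1+n k<m))) (h m (n<1+n m))

unrot1-label : ∀ {n i} → IsLabel n i → IsLabel n (unrot1 n i)
unrot1-label {n} {suc zero}    (_ , i≤n) = i≤n , ≤-refl
unrot1-label {n} {suc (suc i)} (_ , i≤n) = s≤s z≤n , <⇒≤ i≤n

rotRP-fromFun : ∀ n R r → rotRP (fromFun n R r) ≡ fromFun n (λ i j → R (unrot1 n i) (unrot1 n j)) (λ i → r (unrot1 n i))
rotRP-fromFun n R r = fromFun-cong n
  (λ i j li lj → relOf-fromFun n R r (unrot1-label li) (unrot1-label lj))
  (λ i li → rankOf-fromFun n R r (unrot1-label li))

-- Only the injectivity of `σ` on codes up to `n` matters; `τ` is a left inverse that witnesses it.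
coded-relabel : ∀ n {f f′ w w′} (σ τ : ℕ → ℕ) → (∀ {i} → IsLabel n i → f i ≤ n) → (∀ {u} → u ≤ n → τ (σ u) ≡ u) →
  (∀ {u} → u ≤ n → w′ (σ u) ≡ w u) → (∀ {i} → IsLabel n i → f′ i ≡ σ (f i)) → coded n f w ≡ coded n f′ w′
coded-relabel n {f} {f′} {w} {w′} σ τ f≤n τσ w′σ f′≡ = fromFun-cong n
  (λ i j li lj → bool-ext
    (λ h → ≡⇒≡ᵇ≡true (trans (f′≡ li) (trans (cong σ (≡ᵇ≡true⇒≡ h)) (sym (f′≡ lj)))))
    (λ h → ≡⇒≡ᵇ≡true (trans (sym (back li)) (trans (cong τ (≡ᵇ≡true⇒≡ h)) (back lj)))))
  (λ i li → sym (trans (cong w′ (f′≡ li)) (w′σ (f≤n li))))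
  where
  back : ∀ {i} → IsLabel n i → τ (f′ i) ≡ f i
  back li = trans (cong τ (f′≡ li)) (τσ (f≤n li))

rotRP-coded : ∀ n {f f′ w w′} (σ τ : ℕ → ℕ) → (∀ {i} → IsLabel n i → f i ≤ n) → (∀ {u} → u ≤ n → τ (σ u) ≡ u) →
  (∀ {u} → u ≤ n → w′ (σ u) ≡ w u) → (∀ {i} → IsLabel n i → f′ i ≡ σ (f (unrot1 n i))) →
  rotRP (coded n f w) ≡ coded n f′ w′
rotRP-coded n {f} {f′} {w} {w′} σ τ f≤n τσ w′σ f′≡ = trans (rotRP-fromFun n (λ i j → f i ≡ᵇ f j) (λ i → w (f i)))
  (coded-relabel n {λ i → f (unrot1 n i)} {f′} {w} {w′} σ τ (λ l → f≤n (unrot1-label l)) τσ w′σ f′≡)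

-- Rotating π(v) moves the rise of the block of n to the front and puts the last rise into the vacated place.
module Rotation (a n : ℕ) (v : Vec ℕ (suc n)) (dyck : IsDyck a (suc n) v)
                (1≤a : 1 ≤ a) (coprime : Coprime a (suc n)) (2≤n : 2 ≤ n) where

  open DyckPath a n v dyck 1≤a coprime 2≤n
  open Path a (suc n) v using (vv; hgt)

  last-label : IsLabel n n
  last-label = <⇒≤ 2≤n , ≤-refl

  s : ℕ
  s = lf n

  s<n : s < n
  s<n = lf< last-label

  Hs<Hn : H s < H n
  Hs<Hn = lf-lower last-label

  Hn≤ : ∀ {k} → s < k → k ≤ n → H n ≤ H k
  Hn≤ {k} s<k k≤n with m≤n⇒m<n∨m≡n k≤n
  ... | inj₁ k<n  = lf-high last-label k s<k k<n
  ... | inj₂ refl = ≤-refl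

  -- `σ` renames the vertices. The rotated block of `n` in P contains 1 and becomes vertex 0. The
  -- block of `n` in Q, vertex `n`, contains no label strictly between `s` and `n`, and it contains
  -- `s` if `s` is a label; after rotation its maximum is therefore `suc s`. All other names grow by
  -- one.
  σ τ : ℕ → ℕ
  σ u = if u ≡ᵇ s then 0 else if u ≡ᵇ n then suc s else suc u
  τ zero    = s
  τ (suc j) = if j ≡ᵇ s then n else j

  σ-s : ∀ {u} → u ≡ s → σ u ≡ 0
  σ-s e = if-true (≡⇒≡ᵇ≡true e)

  σ-n : σ n ≡ suc s
  σ-n = trans (if-false (≢⇒≡ᵇ≡false (λ e → <⇒≢ s<n (sym e)))) (if-true (≡⇒≡ᵇ≡true {n} refl))

  σ-suc : ∀ {u} → u ≢ s → u ≢ n → σ u ≡ suc u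
  σ-suc u≢s u≢n = trans (if-false (≢⇒≡ᵇ≡false u≢s)) (if-false (≢⇒≡ᵇ≡false u≢n))

  τσ : ∀ {u} → u ≤ n → τ (σ u) ≡ u
  τσ {u} u≤n with u ≟ s | u ≟ n
  ... | yes e | _        = trans (cong τ (σ-s e)) (sym e)
  ... | no _  | yes refl = trans (cong τ σ-n) (if-true (≡⇒≡ᵇ≡true {s} refl))
  ... | no ≢s | no ≢n    = trans (cong τ (σ-suc ≢s ≢n)) (if-false (≢⇒≡ᵇ≡false ≢s))

  v′ : Vec ℕ (suc n)
  v′ = tabulate (λ x → vv (τ (toℕ x)))

  open Path a (suc n) v′ using () renaming (vv to vv′; hgt to hgt′)

  vv′≡ : ∀ {j} → j ≤ n → vv′ j ≡ vv (τ j)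
  vv′≡ j≤n = at-tabulate 0 (suc n) (λ x → vv (τ x)) (s≤s j≤n)

  vv′σ : ∀ {u} → u ≤ n → vv′ (σ u) ≡ vv u
  vv′σ {u} u≤n = trans (vv′≡ {σ u} (σ≤ u≤n)) (cong vv (τσ u≤n))
    where
    σ≤ : ∀ {u} → u ≤ n → σ u ≤ n
    σ≤ {u} u≤n with u ≟ s | u ≟ n
    ... | yes e | _        = ≤-trans (≤-reflexive (σ-s e)) z≤n
    ... | no _  | yes refl = ≤-trans (≤-reflexive σ-n) s<n
    ... | no ≢s | no ≢n    = ≤-trans (≤-reflexive (σ-suc ≢s ≢n)) (≤∧≢⇒< u≤n ≢n)

  hgt′-low : ∀ j → j ≤ s → hgt′ (suc j) ≡ hgt j + vv s
  hgt′-low zero    _   = vv′≡ {0} z≤n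
  hgt′-low (suc j) j<s = begin
    hgt′ (suc j) + vv′ (suc j)  ≡⟨ cong₂ _+_ (hgt′-low j (<⇒≤ j<s)) (vv′≡ {suc j} (<-trans j<s s<n)) ⟩
    hgt j + vv s + vv (τ (suc j)) ≡⟨ cong (λ z → hgt j + vv s + vv z) (if-false (≢⇒≡ᵇ≡false (<⇒≢ j<s))) ⟩
    hgt j + vv s + vv j         ≡⟨ +-assoc (hgt j) _ _ ⟩
    hgt j + (vv s + vv j)       ≡⟨ cong (hgt j +_) (+-comm (vv s) _) ⟩
    hgt j + (vv j + vv s)       ≡⟨ sym (+-assoc (hgt j) _ _) ⟩
    hgt j + vv j + vv s         ∎
    where open ≡-Reasoning

  hgt′-high : ∀ j → s < j → j ≤ n → hgt′ (suc j) ≡ hgt j + vv n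
  hgt′-high (suc j) s<sj j<n with m≤n⇒m<n∨m≡n (≤-pred s<sj)
  ... | inj₂ refl = cong₂ _+_ (hgt′-low j ≤-refl) (trans (vv′≡ {suc j} j<n) (cong vv (if-true (≡⇒≡ᵇ≡true {j} refl))))
  ... | inj₁ s<j = begin
    hgt′ (suc j) + vv′ (suc j)  ≡⟨ cong₂ _+_ (hgt′-high j s<j (<⇒≤ j<n)) (vv′≡ {suc j} j<n) ⟩
    hgt j + vv n + vv (τ (suc j)) ≡⟨ cong (λ z → hgt j + vv n + vv z) (if-false (≢⇒≡ᵇ≡false λ e → <⇒≢ s<j (sym e))) ⟩
    hgt j + vv n + vv j         ≡⟨ +-assoc (hgt j) _ _ ⟩
    hgt j + (vv n + vv j)       ≡⟨ cong (hgt j +_) (+-comm (vv n) _) ⟩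
    hgt j + (vv j + vv n)       ≡⟨ sym (+-assoc (hgt j) _ _) ⟩
    hgt j + vv j + vv n         ∎
    where open ≡-Reasoning

  scaled-low : ∀ j → j ≤ s → suc n * hgt′ (suc j) + H s ≡ H j + H (suc s) + (a * suc j)
  scaled-low j j≤s = linear≡ (_ ∷ _ ∷ suc n * vv s ∷ H (suc s) ∷ a ∷ H s ∷ H j ∷ a * j ∷ _ ∷ [])
      (# 0 ⊕ # 5 ≈ # 6 ⊕ # 3 ⊕ # 8) 1 (1 ⇒ # 0 ≈ # 1 ⊕ # 2 ∋ expand ∷ 1 ⇐ # 3 ⊕ # 4 ≈ # 5 ⊕ # 2 ∋ H-suc s (<⇒≤ s<n) ∷ 1 ⇐ # 6 ⊕ # 7 ≈ # 1 ∋
      H-eq j (≤-trans j≤s (m≤n⇒m≤1+n (<⇒≤ s<n))) ∷ 1 ⇐ # 8 ≈ # 4 ⊕ # 7 ∋ *-suc a j ∷ [])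
    where
    expand : suc n * hgt′ (suc j) ≡ suc n * hgt j + suc n * vv s
    expand = trans (cong (suc n *_) (hgt′-low j j≤s)) (*-distribˡ-+ (suc n) (hgt j) (vv s))

  scaled-high : ∀ j → s < j → j ≤ n → suc n * hgt′ (suc j) + H n ≡ H j + (a * suc j)
  scaled-high j s<j j≤n = linear≡ (_ ∷ _ ∷ suc n * vv n ∷ _ ∷ a ∷ H n ∷ H j ∷ a * j ∷ _ ∷ [])
      (# 0 ⊕ # 5 ≈ # 6 ⊕ # 8) 1 (1 ⇒ # 0 ≈ # 1 ⊕ # 2 ∋ expand ∷ 1 ⇒ # 3 ≈ κ 0 ∋ end ∷ 1 ⇐ # 3 ⊕ # 4 ≈ # 5 ⊕ # 2 ∋ H-suc n ≤-refl ∷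
      1 ⇐ # 6 ⊕ # 7 ≈ # 1 ∋ H-eq j (m≤n⇒m≤1+n j≤n) ∷ 1 ⇐ # 8 ≈ # 4 ⊕ # 7 ∋ *-suc a j ∷ [])
    where
    expand : suc n * hgt′ (suc j) ≡ suc n * hgt j + suc n * vv n
    expand = trans (cong (suc n *_) (hgt′-high j s<j j≤n)) (*-distribˡ-+ (suc n) (hgt j) (vv n))

  Hs<Hs+1 : H s < H (suc s)
  Hs<Hs+1 = H-lf-suc last-label

  dyck′ : IsDyck a (suc n) v′
  dyck′ = trans (hgt′-high n s<n ≤-refl) (proj₁ dyck) , above′
    where
    bound : ∀ j → j ≤ n → Dec (j ≤ s) → a * suc j ≤ suc n * hgt′ (suc j)
    bound j j≤n (yes j≤s) = linear (_ ∷ _ ∷ H j ∷ _ ∷ _ ∷ []) (# 4 ≼ # 0) 1 (1 ⇐ # 0 ⊕ # 1 ≈ # 2 ⊕ # 3 ⊕ # 4 ∋ scaled-low j j≤s ∷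
        1 × κ 1 ⊕ # 1 ≼ # 3 ∋ Hs<Hs+1 ∷ [])
    bound j j≤n (no j≰s) = linear (_ ∷ _ ∷ _ ∷ _ ∷ []) (# 3 ≼ # 0) 1 (1 ⇐ # 0 ⊕ # 1 ≈ # 2 ⊕ # 3 ∋ scaled-high j (≰⇒> j≰s) j≤n ∷
        1 × # 1 ≼ # 2 ∋ Hn≤ (≰⇒> j≰s) j≤n ∷ [])
    above′ : ∀ i → 1 ≤ i → i ≤ suc n → a * i ≤ suc n * hgt′ i
    above′ (suc j) _ (s≤s j≤n) = bound j j≤n (j ≤? s)

  module R′ = DyckPath a n v′ dyck′ 1≤a coprime 2≤n

  -- Up to the index shift, the part of the path up to `s` is raised by the constant
  -- `H (suc s) - H s` and the part after `s` is lowered by the constant `H n`. Within each part the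
  -- order of heights is unchanged, so only nearest lower positions that involve `s` or `n` need
  -- attention.
  H′-low : ∀ {j} → j ≤ s → R′.H (suc j) + H s ≡ H j + H (suc s)
  H′-low {j} j≤s = linear≡ (R′.H (suc j) ∷ a * suc j ∷ _ ∷ H s ∷ H j ∷ H (suc s) ∷ []) (# 0 ⊕ # 3 ≈ # 4 ⊕ # 5) 1 (1 ⇒ # 0 ⊕ # 1 ≈ # 2 ∋
      R′.H-eq (suc j) (s≤s (≤-trans j≤s (<⇒≤ s<n))) ∷ 1 ⇒ # 2 ⊕ # 3 ≈ # 4 ⊕ # 5 ⊕ # 1 ∋ scaled-low j j≤s ∷ [])

  H′-high : ∀ {j} → s < j → j ≤ n → R′.H (suc j) + H n ≡ H j
  H′-high {j} s<j j≤n = linear≡ (R′.H (suc j) ∷ a * suc j ∷ _ ∷ H n ∷ _ ∷ []) (# 0 ⊕ # 3 ≈ # 4) 1 (1 ⇒ # 0 ⊕ # 1 ≈ # 2 ∋ R′.H-eq (suc j)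
      (s≤s j≤n) ∷ 1 ⇒ # 2 ⊕ # 3 ≈ # 4 ⊕ # 1 ∋ scaled-high j s<j j≤n ∷ [])

  Hn<H : ∀ {i} → s < i → i < n → H n < H i
  Hn<H {i} s<i i<n = ≤∧≢⇒< (Hn≤ s<i (<⇒≤ i<n)) λ e → <⇒≢ i<n (sym (distinct last-label (≤-trans (s≤s z≤n) s<i , <⇒≤ i<n) e))

  left-rot : ∀ {i} → IsLabel n i → i < n → LeftOf R′.H (σ (lf i)) (suc i)
  left-rot {i} l@(1≤i , i≤n) i<n with i ≤? s
  ... | yes i≤s = subst (λ z → LeftOf R′.H z (suc i)) (sym (σ-suc (<⇒≢ u<s) (<⇒≢ (<-trans u<s s<n))))
      (s≤s (lf< l) , linear (_ ∷ _ ∷ _ ∷ H s ∷ H (suc s) ∷ _ ∷ []) (κ 1 ⊕ # 5 ≼ # 2) 1 (1 × κ 1 ⊕ # 0 ≼ # 1 ∋ lf-lower l ∷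
          1 ⇐ # 2 ⊕ # 3 ≈ # 1 ⊕ # 4 ∋ H′-low i≤s ∷ 1 ⇒ # 5 ⊕ # 3 ≈ # 0 ⊕ # 4 ∋ H′-low (<⇒≤ u<s) ∷ []) , high)
    where
    u<s : lf i < s
    u<s = <-≤-trans (lf< l) i≤s
    high : ∀ k → suc (lf i) < k → k < suc i → R′.H (suc i) ≤ R′.H k
    high (suc k) (s≤s u<k) (s≤s k<i) = linear (_ ∷ _ ∷ _ ∷ H s ∷ H (suc s) ∷ _ ∷ []) (# 2 ≼ # 5) 1 (1 × # 0 ≼ # 1 ∋ lf-high l k u<k k<i ∷
        1 ⇒ # 2 ⊕ # 3 ≈ # 0 ⊕ # 4 ∋ H′-low i≤s ∷ 1 ⇐ # 5 ⊕ # 3 ≈ # 1 ⊕ # 4 ∋ H′-low (<⇒≤ (<-≤-trans k<i i≤s)) ∷ [])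
  ... | no i≰s with lf i ≟ s
  -- The part after `s` has been lowered and the part before it raised, so no position from 1 on is
  -- below the new label any more and its nearest lower position becomes 0.
  ...   | yes eq = subst (λ z → LeftOf R′.H z (suc i)) (sym (σ-s eq))
      (s≤s z≤n , subst (_< R′.H (suc i)) (sym R′.start) (R′.positive (s≤s z≤n , i<n)) , high)
    where
    s<i = ≰⇒> i≰s
    Hi≤ : ∀ {k} → s < k → k ≤ i → H i ≤ H k
    Hi≤ {k} s<k k≤i with m≤n⇒m<n∨m≡n k≤i
    ... | inj₂ refl = ≤-refl
    ... | inj₁ k<i = lf-high l k (subst (_< k) (sym eq) s<k) k<i
    high : ∀ k → 0 < k → k < suc i → R′.H (suc i) ≤ R′.H k
    high (suc k) _ (s≤s k<i) with k ≤? s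
    ... | yes k≤s = linear (_ ∷ _ ∷ H k ∷ _ ∷ _ ∷ _ ∷ _ ∷ []) (# 4 ≼ # 0) 1 (1 ⇐ # 0 ⊕ # 1 ≈ # 2 ⊕ # 3 ∋ H′-low k≤s ∷ 1 ⇒ # 4 ⊕ # 5 ≈ # 6 ∋
        H′-high s<i i≤n ∷ 1 × # 6 ≼ # 3 ∋ Hi≤ ≤-refl s<i ∷ 1 × κ 1 ⊕ # 1 ≼ # 5 ∋ Hs<Hn ∷ [])
    ... | no k≰s = linear (_ ∷ H n ∷ _ ∷ _ ∷ _ ∷ []) (# 3 ≼ # 0) 1 (1 ⇐ # 0 ⊕ # 1 ≈ # 2 ∋ H′-high (≰⇒> k≰s) (≤-trans (<⇒≤ k<i) i≤n) ∷
        1 ⇒ # 3 ⊕ # 1 ≈ # 4 ∋ H′-high s<i i≤n ∷ 1 × # 4 ≼ # 2 ∋ Hi≤ (≰⇒> k≰s) (<⇒≤ k<i) ∷ [])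
  ...   | no u≢s = subst (λ z → LeftOf R′.H z (suc i)) (sym (σ-suc u≢s (<⇒≢ (<-trans (lf< l) i<n))))
      (s≤s (lf< l) , linear (_ ∷ _ ∷ _ ∷ H n ∷ _ ∷ []) (κ 1 ⊕ # 4 ≼ # 2) 1 (1 × κ 1 ⊕ # 0 ≼ # 1 ∋ lf-lower l ∷ 1 ⇐ # 2 ⊕ # 3 ≈ # 1 ∋
          H′-high s<i i≤n ∷ 1 ⇒ # 4 ⊕ # 3 ≈ # 0 ∋ H′-high s<u (≤-trans (<⇒≤ (lf< l)) i≤n) ∷ []) , high)
    where
    s<i = ≰⇒> i≰s
    s<u : s < lf i
    s<u = ≤∧≢⇒< (≮⇒≥ λ u<s → <⇒≱ (<-trans Hs<Hn (Hn<H s<i i<n)) (lf-high l s u<s s<i)) (λ e → u≢s (sym e))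
    high : ∀ k → suc (lf i) < k → k < suc i → R′.H (suc i) ≤ R′.H k
    high (suc k) (s≤s u<k) (s≤s k<i) = linear (_ ∷ _ ∷ _ ∷ H n ∷ _ ∷ []) (# 2 ≼ # 4) 1 (1 × # 0 ≼ # 1 ∋ lf-high l k u<k k<i ∷
        1 ⇒ # 2 ⊕ # 3 ≈ # 0 ∋ H′-high s<i i≤n ∷ 1 ⇐ # 4 ⊕ # 3 ≈ # 1 ∋ H′-high (<-trans s<u u<k) (≤-trans (<⇒≤ k<i) i≤n) ∷ [])

  left-rot-last : LeftOf R′.H (σ s) 1
  left-rot-last = subst (λ z → LeftOf R′.H z 1) (sym (σ-s refl))
    (s≤s z≤n , subst (_< R′.H 1) (sym R′.start) (R′.positive (s≤s z≤n , <⇒≤ 2≤n)) , λ k 0<k k<1 → ⊥-elim (<⇒≱ k<1 0<k))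

  right-rot : ∀ {i} → IsLabel n i → i < n → RightOf R′.H (suc i) (σ (rt i))
  right-rot {i} l@(1≤i , i≤n) i<n with i ≤? s
  ... | no i≰s = subst (RightOf R′.H (suc i)) (sym (σ-suc (λ e → <⇒≢ (<-≤-trans s<i (≤rt l)) (sym e)) (<⇒≢ t<n)))
      (s≤s (≤rt l) , linear (_ ∷ _ ∷ _ ∷ H n ∷ _ ∷ []) (κ 1 ⊕ # 4 ≼ # 2) 1 (1 × κ 1 ⊕ # 0 ≼ # 1 ∋ rt-lower l ∷ 1 ⇐ # 2 ⊕ # 3 ≈ # 1 ∋
          H′-high s<i i≤n ∷ 1 ⇒ # 4 ⊕ # 3 ≈ # 0 ∋ H′-high (m<n⇒m<1+n (<-≤-trans s<i (≤rt l))) t<n ∷ []) , high)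
    where
    s<i = ≰⇒> i≰s
    t<n : rt i < n
    t<n = ≤∧≢⇒< (rt≤n l) λ e → <⇒≱ (Hn<H s<i i<n) (rt-high l n i≤n (≤-reflexive (sym e)))
    high : ∀ k → suc i ≤ k → k ≤ suc (rt i) → R′.H (suc i) ≤ R′.H k
    high (suc k) (s≤s i≤k) (s≤s k≤t) = linear (_ ∷ _ ∷ _ ∷ H n ∷ _ ∷ []) (# 2 ≼ # 4) 1 (1 × # 0 ≼ # 1 ∋ rt-high l k i≤k k≤t ∷
        1 ⇒ # 2 ⊕ # 3 ≈ # 0 ∋ H′-high s<i i≤n ∷ 1 ⇐ # 4 ⊕ # 3 ≈ # 1 ∋ H′-high (<-≤-trans s<i i≤k) (≤-trans k≤t (rt≤n l)) ∷ [])
  ... | yes i≤s with suc (rt i) ≤? s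
  ...   | yes t<s = subst (RightOf R′.H (suc i)) (sym (σ-suc (<⇒≢ t<s) (<⇒≢ (<-trans t<s s<n))))
      (s≤s (≤rt l) , linear (_ ∷ _ ∷ _ ∷ H s ∷ H (suc s) ∷ _ ∷ []) (κ 1 ⊕ # 5 ≼ # 2) 1 (1 × κ 1 ⊕ # 0 ≼ # 1 ∋ rt-lower l ∷
          1 ⇐ # 2 ⊕ # 3 ≈ # 1 ⊕ # 4 ∋ H′-low i≤s ∷ 1 ⇒ # 5 ⊕ # 3 ≈ # 0 ⊕ # 4 ∋ H′-low t<s ∷ []) , high)
    where
    high : ∀ k → suc i ≤ k → k ≤ suc (rt i) → R′.H (suc i) ≤ R′.H k
    high (suc k) (s≤s i≤k) (s≤s k≤t) = linear (_ ∷ _ ∷ _ ∷ H s ∷ H (suc s) ∷ _ ∷ []) (# 2 ≼ # 5) 1 (1 × # 0 ≼ # 1 ∋ rt-high l k i≤k k≤t ∷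
        1 ⇒ # 2 ⊕ # 3 ≈ # 0 ⊕ # 4 ∋ H′-low i≤s ∷ 1 ⇐ # 5 ⊕ # 3 ≈ # 1 ⊕ # 4 ∋ H′-low (≤-trans k≤t (<⇒≤ t<s)) ∷ [])
  -- A level that survives up to `s` survives up to `n`, since all later labels are higher than `s`.
  -- In the new path the descent comes right after `suc s`, where the lowered part begins.
  ...   | no t≮s = subst (RightOf R′.H (suc i)) (sym (trans (cong σ t≡n) σ-n))
      (s≤s i≤s , linear (_ ∷ _ ∷ _ ∷ _ ∷ _ ∷ _ ∷ []) (κ 1 ⊕ # 4 ≼ # 0) 1 (1 ⇐ # 0 ⊕ # 1 ≈ # 2 ⊕ # 3 ∋ H′-low i≤s ∷ 1 ⇒ # 4 ⊕ # 5 ≈ # 3 ∋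
          H′-high ≤-refl s<n ∷ 1 × κ 1 ⊕ # 1 ≼ # 5 ∋ Hs<Hn ∷ 1 × κ 1 ≼ # 2 ∋ positive l ∷ []) , high)
    where
    s≤t : s ≤ rt i
    s≤t = ≤-pred (≰⇒> t≮s)
    low : ∀ k → i ≤ k → k ≤ n → H i ≤ H k
    low k i≤k k≤n with k ≤? s
    ... | yes k≤s = rt-high l k i≤k (≤-trans k≤s s≤t)
    ... | no k≰s = ≤-trans (rt-high l s i≤s s≤t) (≤-trans (<⇒≤ Hs<Hn) (Hn≤ (≰⇒> k≰s) k≤n))
    t≡n : rt i ≡ n
    t≡n = rt-unique l (i≤n , subst (_< H i) (sym end) (positive l) , low)
    high : ∀ k → suc i ≤ k → k ≤ suc s → R′.H (suc i) ≤ R′.H k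
    high (suc k) (s≤s i≤k) (s≤s k≤s) = linear (_ ∷ _ ∷ _ ∷ H s ∷ H (suc s) ∷ _ ∷ []) (# 2 ≼ # 5) 1 (1 × # 0 ≼ # 1 ∋
        rt-high l k i≤k (≤-trans k≤s s≤t) ∷ 1 ⇒ # 2 ⊕ # 3 ≈ # 0 ⊕ # 4 ∋ H′-low i≤s ∷ 1 ⇐ # 5 ⊕ # 3 ≈ # 1 ⊕ # 4 ∋ H′-low k≤s ∷ [])

  right-rot-last : RightOf R′.H 1 (σ (rt n))
  right-rot-last = subst (RightOf R′.H 1) (sym (trans (cong σ (≤-antisym (rt≤n last-label) (≤rt last-label))) σ-n))
    (s≤s z≤n , linear (_ ∷ _ ∷ _ ∷ _ ∷ _ ∷ _ ∷ []) (κ 1 ⊕ # 4 ≼ # 0) 1 (1 ⇐ # 0 ⊕ # 1 ≈ # 2 ⊕ # 3 ∋ H′-low z≤n ∷ 1 ⇒ # 4 ⊕ # 5 ≈ # 3 ∋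
        H′-high ≤-refl s<n ∷ 1 × κ 1 ⊕ # 1 ≼ # 5 ∋ Hs<Hn ∷ 1 ⇐ # 2 ≈ κ 0 ∋ start ∷ []) , high)
    where
    high : ∀ k → 1 ≤ k → k ≤ suc s → R′.H 1 ≤ R′.H k
    high (suc k) _ (s≤s k≤s) = linear (_ ∷ H s ∷ H k ∷ H (suc s) ∷ _ ∷ _ ∷ []) (# 4 ≼ # 0) 1 (1 ⇐ # 0 ⊕ # 1 ≈ # 2 ⊕ # 3 ∋ H′-low k≤s ∷
        1 ⇒ # 4 ⊕ # 1 ≈ # 5 ⊕ # 3 ∋ H′-low z≤n ∷ 1 ⇒ # 5 ≈ κ 0 ∋ start ∷ [])

  lf′≡ : ∀ {i} → IsLabel n i → R′.lf i ≡ σ (lf (unrot1 n i))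
  lf′≡ {suc zero}    l = R′.lf-unique l left-rot-last
  lf′≡ {suc (suc i)} l = R′.lf-unique l (left-rot (s≤s z≤n , <⇒≤ (proj₂ l)) (proj₂ l))

  rt′≡ : ∀ {i} → IsLabel n i → R′.rt i ≡ σ (rt (unrot1 n i))
  rt′≡ {suc zero}    l = R′.rt-unique l right-rot-last
  rt′≡ {suc (suc i)} l = R′.rt-unique l (right-rot (s≤s z≤n , <⇒≤ (proj₂ l)) (proj₂ l))

  rot-π : rotLP (π a (suc n) v) ≡ π a (suc n) v′
  rot-π = trans (cong rotLP π-coded) (trans (cong₂ _,_
      (rotRP-coded n {lf} {R′.lf} {vv} {vv′} σ τ (λ l → <⇒≤ (<-≤-trans (lf< l) (proj₂ l))) τσ vv′σ lf′≡)
      (rotRP-coded n {rt} {R′.rt} {vv} {vv′} σ τ rt≤n τσ vv′σ rt′≡))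
    (sym R′.π-coded))

NC-rot : ∀ a n → 1 ≤ a → Coprime a (suc n) → 2 ≤ n → ∀ {x} → NC a (suc n) x → NC a (suc n) (rotLP x)
NC-rot a n 1≤a coprime 2≤n (v , dyck , refl) = v′ , dyck′ , sym rot-π
  where open Rotation a n v dyck 1≤a coprime 2≤n

-- Congruences

module Congruence (n : ℕ) where

  -- Multiples are added on both sides, which avoids truncated subtraction and lets equations
  -- between positions be used as they come.
  Congruent : ℕ → ℕ → Set
  Congruent x y = ∃ λ p → ∃ λ q → x + p * n ≡ y + q * n

  Congruent-close : ∀ {x y} → Congruent x y → x < y + n → y < x + n → x ≡ y
  Congruent-close {x} {y} (p , q , h) x< y< with <-cmp p q
  ... | tri≈ _ refl _ = +-cancelʳ-≡ (p * n) x y h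
  ... | tri< p<q _ _ = ⊥-elim (refute {n ∷ p * n ∷ _ ∷ y ∷ _ ∷ []} (1 × # 0 ⊕ # 1 ≼ # 2 ∋ step p<q ∷ 1 × κ 1 ⊕ # 4 ≼ # 3 ⊕ # 0 ∋ x< ∷
      1 ⇐ # 4 ⊕ # 1 ≈ # 3 ⊕ # 2 ∋ h ∷ []))
    where
    step : p < q → suc p * n ≤ q * n
    step = *-monoˡ-≤ n
  ... | tri> _ _ q<p = ⊥-elim (refute {n ∷ q * n ∷ _ ∷ _ ∷ x ∷ []} (1 × # 0 ⊕ # 1 ≼ # 2 ∋ step q<p ∷ 1 × κ 1 ⊕ # 3 ≼ # 4 ⊕ # 0 ∋ y< ∷
      1 ⇒ # 4 ⊕ # 2 ≈ # 3 ⊕ # 1 ∋ h ∷ []))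
    where
    step : q < p → suc q * n ≤ p * n
    step = *-monoˡ-≤ n

  Congruent-sym : ∀ {x y} → Congruent x y → Congruent y x
  Congruent-sym (p , q , h) = q , p , sym h

  Congruent-trans : ∀ {x y z} → Congruent x y → Congruent y z → Congruent x z
  Congruent-trans {x} {y} {z} (p , q , h) (r , s , k) = p + r , s + q ,
    linear≡ (x ∷ p * n ∷ y ∷ q * n ∷ r * n ∷ z ∷ s * n ∷ _ ∷ _ ∷ []) (# 0 ⊕ # 7 ≈ # 5 ⊕ # 8) 1 (1 ⇒ # 0 ⊕ # 1 ≈ # 2 ⊕ # 3 ∋ h ∷
        1 ⇒ # 2 ⊕ # 4 ≈ # 5 ⊕ # 6 ∋ k ∷ 1 ⇒ # 7 ≈ # 1 ⊕ # 4 ∋ *-distribʳ-+ n p r ∷ 1 ⇐ # 8 ≈ # 6 ⊕ # 3 ∋ *-distribʳ-+ n s q ∷ [])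

  Congruent-+ : ∀ {x y} k → Congruent x y → Congruent (x + k) (y + k)
  Congruent-+ {x} {y} k (p , q , h) = p , q , linear≡ (x ∷ p * n ∷ y ∷ q * n ∷ k ∷ [])
      (# 0 ⊕ # 4 ⊕ # 1 ≈ # 2 ⊕ # 4 ⊕ # 3) 1 (1 ⇒ # 0 ⊕ # 1 ≈ # 2 ⊕ # 3 ∋ h ∷ [])

  Congruent-cancel : ∀ {x y} k → Congruent (x + k) (y + k) → Congruent x y
  Congruent-cancel {x} {y} k (p , q , h) = p , q , linear≡ (x ∷ k ∷ p * n ∷ y ∷ q * n ∷ [])
      (# 0 ⊕ # 2 ≈ # 3 ⊕ # 4) 1 (1 ⇒ # 0 ⊕ # 1 ⊕ # 2 ≈ # 3 ⊕ # 1 ⊕ # 4 ∋ h ∷ [])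

  Congruent-wrap : ∀ {x y} → x + n ≡ y → Congruent x y
  Congruent-wrap {x} {y} h = 1 , 0 , linear≡ (x ∷ n ∷ _ ∷ []) (# 0 ⊕ (1 ⊛ # 1) ≈ # 2 ⊕ (0 ⊛ # 1)) 1 (1 ⇒ # 0 ⊕ # 1 ≈ # 2 ∋ h ∷ [])

  Congruent-≡ : ∀ {x y} → x ≡ y → Congruent x y
  Congruent-≡ refl = 0 , 0 , refl

module Residues (n : ℕ) .{{_ : NonZero n}} where

  open Congruence n public

  %⇒Congruent : ∀ {x y} → x % n ≡ y % n → Congruent x y
  %⇒Congruent {x} {y} h = y / n , x / n , linear≡ (_ ∷ _ ∷ x / n * n ∷ _ ∷ _ ∷ y / n * n ∷ [])
      (# 0 ⊕ # 5 ≈ # 3 ⊕ # 2) 1 (1 ⇒ # 0 ≈ # 1 ⊕ # 2 ∋ m≡m%n+[m/n]*n x n ∷ 1 ⇐ # 3 ≈ # 4 ⊕ # 5 ∋ m≡m%n+[m/n]*n y n ∷ 1 ⇒ # 1 ≈ # 4 ∋ h ∷ [])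

  Congruent⇒% : ∀ {x y} → Congruent x y → x % n ≡ y % n
  Congruent⇒% {x} {y} (p , q , h) = trans (sym ([m+kn]%n≡m%n x p n)) (trans (cong (_% n) h) ([m+kn]%n≡m%n y q n))

  %-+ : ∀ x y → ((x % n) + y) % n ≡ (x + y) % n
  %-+ x y = Congruent⇒% (x / n , 0 , linear≡ (_ ∷ x % n ∷ x / n * n ∷ y ∷ n ∷ [])
      (# 1 ⊕ # 3 ⊕ # 2 ≈ # 0 ⊕ # 3 ⊕ (0 ⊛ # 4)) 1 (1 ⇐ # 0 ≈ # 1 ⊕ # 2 ∋ m≡m%n+[m/n]*n x n ∷ []))

-- Periodic sequences and cyclic walks

+-right-comm : ∀ x y z → x + y + z ≡ x + z + y
+-right-comm x y z = trans (+-assoc x y z) (trans (cong (x +_) (+-comm y z)) (sym (+-assoc x z y)))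

sumUpTo-+ : ∀ f m k → sumUpTo (m + k) f ≡ sumUpTo m f + sumUpTo k (λ j → f (m + j))
sumUpTo-+ f m zero    = trans (cong (λ z → sumUpTo z f) (+-identityʳ m)) (sym (+-identityʳ _))
sumUpTo-+ f m (suc k) = trans (cong (λ z → sumUpTo z f) (+-suc m k))
  (trans (cong (_+ f (m + k)) (sumUpTo-+ f m k)) (+-assoc (sumUpTo m f) _ _))

Periodic : ℕ → (ℕ → ℕ) → Set
Periodic d u = ∀ I → u (I + d) ≡ u I

Periodic-* : ∀ {d u} → Periodic d u → ∀ k → Periodic (k * d) u
Periodic-* {d} {u} per zero    I = cong u (+-identityʳ I)
Periodic-* {d} {u} per (suc k) I =
  trans (cong u (sym (+-assoc I d (k * d)))) (trans (Periodic-* per k (I + d)) (per I))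

shift : ℕ → (ℕ → ℕ) → ℕ → ℕ
shift k u I = u (I + k)

Periodic-shift : ∀ {d u} k → Periodic d u → Periodic d (shift k u)
Periodic-shift {d} {u} k per I = trans (cong u (+-right-comm I d k)) (per (I + k))

sumUpTo-shift : ∀ {n u} → Periodic n u → ∀ k → sumUpTo n (shift k u) ≡ sumUpTo n u
sumUpTo-shift {n} {u} per k = +-cancelˡ-≡ (sumUpTo k u) _ _ (begin
  sumUpTo k u + sumUpTo n (shift k u)            ≡⟨ cong (sumUpTo k u +_) (sumUpTo-cong n (λ j _ → cong u (+-comm j k))) ⟩
  sumUpTo k u + sumUpTo n (λ j → u (k + j))      ≡⟨ sym (sumUpTo-+ u k n) ⟩
  sumUpTo (k + n) u                              ≡⟨ cong (λ z → sumUpTo z u) (+-comm k n) ⟩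
  sumUpTo (n + k) u                              ≡⟨ sumUpTo-+ u n k ⟩
  sumUpTo n u + sumUpTo k (λ j → u (n + j))      ≡⟨ cong (sumUpTo n u +_) (sumUpTo-cong k (λ j _ → trans (cong u (+-comm n j)) (per j))) ⟩
  sumUpTo n u + sumUpTo k u                      ≡⟨ +-comm (sumUpTo n u) _ ⟩
  sumUpTo k u + sumUpTo n u                      ∎)
  where open ≡-Reasoning

-- `back` runs over the positions `I - 1` down to `I - k` and `fwd` over `I` up to `I + k - 1`. The
-- subtraction truncates, so `back` has its meaning only for `k ≤ I`.
back fwd : (ℕ → ℕ) → ℕ → ℕ → ℕ
back u I zero    = 0
back u I (suc k) = back u I k + u (I ∸ suc k)
fwd u I zero    = 0
fwd u I (suc k) = fwd u I k + u (I + k)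

back-cong : ∀ {u u′ I I′} k → (∀ j → 1 ≤ j → j ≤ k → u (I ∸ j) ≡ u′ (I′ ∸ j)) → back u I k ≡ back u′ I′ k
back-cong zero    h = refl
back-cong (suc k) h = cong₂ _+_ (back-cong k (λ j 1≤j j≤k → h j 1≤j (m≤n⇒m≤1+n j≤k))) (h (suc k) (s≤s z≤n) ≤-refl)

fwd-cong : ∀ {u u′ I I′} k → (∀ j → j < k → u (I + j) ≡ u′ (I′ + j)) → fwd u I k ≡ fwd u′ I′ k
fwd-cong zero    h = refl
fwd-cong (suc k) h = cong₂ _+_ (fwd-cong k (λ j j<k → h j (m<n⇒m<1+n j<k))) (h k (n<1+n k))

-- A d-periodic sequence u of rises describes a bi-infinite walk of slope a/b.  Its position I sees the walk
-- strictly below itself first `leftDist` steps to the left and `rightDist` steps to the right (0 if never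
-- within a period, hence never); these are the two ends of label I in the cyclic picture.
module CyclicWalk (a b d : ℕ) where

  leftTest rightTest : (ℕ → ℕ) → ℕ → ℕ → Bool
  leftTest u I k  = a * k <ᵇ b * back u I k
  rightTest u I k = b * fwd u I k <ᵇ a * k

  leftDist rightDist : (ℕ → ℕ) → ℕ → ℕ
  leftDist u I  = firstFrom d 1 (leftTest u I) 0
  rightDist u I = firstFrom d 1 (rightTest u I) 0

  leftDist-cong : ∀ {u u′ I I′} → (∀ j → 1 ≤ j → j ≤ d → u (I ∸ j) ≡ u′ (I′ ∸ j)) → leftDist u I ≡ leftDist u′ I′
  leftDist-cong {u} {u′} {I} {I′} h = firstFrom-cong d 1 0 λ k 1≤k k≤d →
    cong (λ z → a * k <ᵇ b * z) (back-cong k (λ j 1≤j j≤k → h j 1≤j (≤-trans j≤k (≤-pred k≤d))))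

  rightDist-cong : ∀ {u u′ I I′} → (∀ j → j < d → u (I + j) ≡ u′ (I′ + j)) → rightDist u I ≡ rightDist u′ I′
  rightDist-cong {u} {u′} {I} {I′} h = firstFrom-cong d 1 0 λ k 1≤k k≤d →
    cong (λ z → b * z <ᵇ a * k) (fwd-cong k (λ j j<k → h j (<-≤-trans j<k (≤-pred k≤d))))

  leftDist-periodic : ∀ {u} → Periodic d u → ∀ k I → d ≤ I → leftDist u (I + k * d) ≡ leftDist u I
  leftDist-periodic {u} per k I d≤I = leftDist-cong λ j 1≤j j≤d →
    trans (cong u (trans (cong (_∸ j) (+-comm I _)) (trans (+-∸-assoc (k * d) (≤-trans j≤d d≤I)) (+-comm (k * d) _)))) (Periodic-* per k (I ∸ j))

  rightDist-periodic : ∀ {u} → Periodic d u → ∀ k I → rightDist u (I + k * d) ≡ rightDist u I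
  rightDist-periodic {u} per k I = rightDist-cong λ j j<d →
    trans (cong u (+-right-comm I (k * d) j)) (Periodic-* per k (I + j))

  leftDist-shift : ∀ u s I → d ≤ I → leftDist (shift s u) I ≡ leftDist u (I + s)
  leftDist-shift u s I d≤I = leftDist-cong λ j 1≤j j≤d →
    cong u (trans (+-comm (I ∸ j) s) (trans (sym (+-∸-assoc s (≤-trans j≤d d≤I))) (cong (_∸ j) (+-comm s I))))

  rightDist-shift : ∀ u s I → rightDist (shift s u) I ≡ rightDist u (I + s)
  rightDist-shift u s I = rightDist-cong λ j j<d → cong u (+-right-comm I j s)

  data LeftView (u : ℕ → ℕ) (I : ℕ) : Set where
    none  : (∀ k → 1 ≤ k → k ≤ d → b * back u I k ≤ a * k) → leftDist u I ≡ 0 → LeftView u I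
    found : ∀ k → 1 ≤ k → k ≤ d → a * k < b * back u I k → (∀ j → 1 ≤ j → j < k → b * back u I j ≤ a * j) →
            leftDist u I ≡ k → LeftView u I

  leftView : ∀ u I → LeftView u I
  leftView u I with searchFirst d 1 (leftTest u I)
  ... | none h = none (λ k 1≤k k≤d → <ᵇ≡false⇒≤ (h k 1≤k (s≤s k≤d))) (firstFrom-none d 1 _ 0 h)
  ... | found k 1≤k k≤d t before = found k 1≤k (≤-pred k≤d) (<ᵇ≡true⇒< t) (λ j 1≤j j<k → <ᵇ≡false⇒≤ (before j 1≤j j<k))
          (firstFrom-found d 1 _ 0 1≤k k≤d t before)

  data RightView (u : ℕ → ℕ) (I : ℕ) : Set where
    none  : (∀ k → 1 ≤ k → k ≤ d → a * k ≤ b * fwd u I k) → rightDist u I ≡ 0 → RightView u I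
    found : ∀ k → 1 ≤ k → k ≤ d → b * fwd u I k < a * k → (∀ j → 1 ≤ j → j < k → a * j ≤ b * fwd u I j) →
            rightDist u I ≡ k → RightView u I

  rightView : ∀ u I → RightView u I
  rightView u I with searchFirst d 1 (rightTest u I)
  ... | none h = none (λ k 1≤k k≤d → <ᵇ≡false⇒≤ (h k 1≤k (s≤s k≤d))) (firstFrom-none d 1 _ 0 h)
  ... | found k 1≤k k≤d t before = found k 1≤k (≤-pred k≤d) (<ᵇ≡true⇒< t) (λ j 1≤j j<k → <ᵇ≡false⇒≤ (before j 1≤j j<k))
          (firstFrom-found d 1 _ 0 1≤k k≤d t before)

  leftDist≤ : ∀ u I → leftDist u I ≤ d
  leftDist≤ u I with leftView u I
  ... | none _ e = ≤-trans (≤-reflexive e) z≤n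
  ... | found k _ k≤d _ _ e = ≤-trans (≤-reflexive e) k≤d

  rightDist≤ : ∀ u I → rightDist u I ≤ d
  rightDist≤ u I with rightView u I
  ... | none _ e = ≤-trans (≤-reflexive e) z≤n
  ... | found k _ k≤d _ _ e = ≤-trans (≤-reflexive e) k≤d

-- The labeled pair of the cyclic walk; n encodes the central block, and the other blocks are named by the
-- residue of the rise that bounds them.
module CyclicPair (a d m n : ℕ) (n≡md : n ≡ m * d) (1≤d : 1 ≤ d) (2≤m : 2 ≤ m) .{{nz : NonZero n}} where

  open Residues n public
  open CyclicWalk a (suc n) d public

  centre : ℕ → ℕ → ℕ
  centre k r = if k ≡ᵇ 0 then n else r % n

  centre-0 : ∀ {k r} → k ≡ 0 → centre k r ≡ n
  centre-0 refl = refl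

  centre-≢0 : ∀ {k r} → k ≢ 0 → centre k r ≡ r % n
  centre-≢0 h = if-false (≢⇒≡ᵇ≡false h)

  leftCode rightCode : (ℕ → ℕ) → ℕ → ℕ
  leftCode u I  = centre (leftDist u I) (I ∸ leftDist u I)
  rightCode u I = centre (rightDist u I) (I + rightDist u I ∸ 1)

  -- The rises of a Dyck path sum to `a`, so the code `n` of the deleted block receives what is
  -- missing from the sum of `u` over `n` positions.
  weight : (ℕ → ℕ) → ℕ → ℕ
  weight u r = if r ≡ᵇ n then a ∸ sumUpTo n u else u r

  -- Label `i` is read at position `i + n`, from which looking back by at most `d ≤ n` positions
  -- never truncates.
  cyclicPair : (ℕ → ℕ) → LP n
  cyclicPair u = coded n (λ i → leftCode u (i + n)) (weight u) , coded n (λ i → rightCode u (i + n)) (weight u)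

  d≤n : d ≤ n
  d≤n = subst (d ≤_) (sym n≡md) (≤-trans (≤-reflexive (sym (*-identityˡ d))) (*-monoˡ-≤ d (<⇒≤ 2≤m)))

  2d≤n : d + d ≤ n
  2d≤n = subst (d + d ≤_) (sym n≡md) (≤-trans (≤-reflexive (cong (d +_) (sym (+-identityʳ d)))) (*-monoˡ-≤ d 2≤m))

  periodic-n : ∀ {u} → Periodic d u → Periodic n u
  periodic-n {u} per I = trans (cong (λ z → u (I + z)) n≡md) (Periodic-* per m I)

  periodic-% : ∀ {u} → Periodic d u → ∀ I → u (I % n) ≡ u I
  periodic-% {u} per I = sym (trans (cong u (trans (m≡m%n+[m/n]*n I n) refl)) (Periodic-* (periodic-n per) (I / n) (I % n)))

  weight-n : ∀ u → weight u n ≡ a ∸ sumUpTo n u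
  weight-n u = if-true (≡⇒≡ᵇ≡true {n} refl)

  weight-< : ∀ u {r} → r < n → weight u r ≡ u r
  weight-< u r<n = if-false (≢⇒≡ᵇ≡false (<⇒≢ r<n))

  weight-% : ∀ {u} → Periodic d u → ∀ I → weight u (I % n) ≡ u I
  weight-% {u} per I = trans (weight-< u (m%n<n I n)) (periodic-% per I)

  leftDist-n : ∀ {u} → Periodic d u → ∀ I → d ≤ I → leftDist u (I + n) ≡ leftDist u I
  leftDist-n {u} per I d≤I = trans (cong (λ z → leftDist u (I + z)) n≡md) (leftDist-periodic per m I d≤I)

  rightDist-n : ∀ {u} → Periodic d u → ∀ I → rightDist u (I + n) ≡ rightDist u I
  rightDist-n {u} per I = trans (cong (λ z → rightDist u (I + z)) n≡md) (rightDist-periodic per m I)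

  centre-cong : ∀ {k l r s} → k ≡ l → r % n ≡ s % n → centre k r ≡ centre l s
  centre-cong {zero}  refl h = refl
  centre-cong {suc k} refl h = h

  leftCode-n : ∀ {u} → Periodic d u → ∀ I → d ≤ I → leftCode u (I + n) ≡ leftCode u I
  leftCode-n {u} per I d≤I = centre-cong (leftDist-n per I d≤I) (trans (cong (_% n) move) ([m+n]%n≡m%n (I ∸ leftDist u I) n))
    where
    move : I + n ∸ leftDist u (I + n) ≡ I ∸ leftDist u I + n
    move = trans (cong₂ _∸_ (+-comm I n) (leftDist-n per I d≤I))
      (trans (+-∸-assoc n (≤-trans (leftDist≤ u I) d≤I)) (+-comm n _))

  rightCode-n : ∀ {u} → Periodic d u → ∀ I → 1 ≤ I → rightCode u (I + n) ≡ rightCode u I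
  rightCode-n {u} per (suc I) _ = centre-cong (rightDist-n per (suc I))
    (trans (cong (_% n) (trans (cong ((I + n) +_) (rightDist-n per (suc I))) (+-right-comm I n _))) ([m+n]%n≡m%n (I + rightDist u (suc I)) n))

  code≤n : ∀ k r → centre k r ≤ n
  code≤n zero    r = ≤-refl
  code≤n (suc k) r = <⇒≤ (m%n<n r n)

  step unstep : ℕ → ℕ
  step r   = if r ≡ᵇ n then n else (suc r % n)
  unstep r = if r ≡ᵇ n then n else ((r + pred n) % n)

  suc-pred-n : suc (pred n) ≡ n
  suc-pred-n = suc-pred n

  step-n : step n ≡ n
  step-n = if-true (≡⇒≡ᵇ≡true {n} refl)

  step-% : ∀ x → step (x % n) ≡ suc x % n
  step-% x = trans (if-false (≢⇒≡ᵇ≡false (<⇒≢ (m%n<n x n))))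
    (trans (cong (_% n) (+-comm 1 (x % n))) (trans (%-+ x 1) (cong (_% n) (+-comm x 1))))

  unstep-step : ∀ {r} → r ≤ n → unstep (step r) ≡ r
  unstep-step {r} r≤n with r ≟ n
  ... | yes refl = trans (cong unstep step-n) (if-true (≡⇒≡ᵇ≡true {r} refl))
  ... | no  r≢n  = trans (cong unstep (if-false (≢⇒≡ᵇ≡false r≢n)))
    (trans (if-false (≢⇒≡ᵇ≡false (<⇒≢ (m%n<n (suc r) n))))
    (trans (%-+ (suc r) (pred n)) (trans (cong (_% n) (trans (sym (+-suc r (pred n))) (cong (r +_) suc-pred-n)))
    (trans ([m+n]%n≡m%n r n) (m<n⇒m%n≡m (≤∧≢⇒< r≤n r≢n))))))

  weight-step : ∀ {u} → Periodic d u → ∀ {r} → r ≤ n → weight (shift (pred n) u) (step r) ≡ weight u r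
  weight-step {u} per {r} r≤n with r ≟ n
  ... | yes refl = trans (cong (weight (shift (pred n) u)) step-n)
    (trans (weight-n (shift (pred n) u)) (trans (cong (a ∸_) (sumUpTo-shift (periodic-n per) (pred n))) (sym (weight-n u))))
  ... | no  r≢n  = trans (cong (weight (shift (pred n) u)) (if-false (≢⇒≡ᵇ≡false r≢n)))
    (trans (weight-% (Periodic-shift (pred n) per) (suc r))
    (trans (cong u (trans (sym (+-suc r (pred n))) (cong (r +_) suc-pred-n)))
    (trans (periodic-n per r) (sym (weight-< u (≤∧≢⇒< r≤n r≢n))))))

  centre-step : ∀ k {x y} → suc x % n ≡ y % n → centre k y ≡ step (centre k x)
  centre-step zero    h = sym step-n
  centre-step (suc k) {x} h = trans (sym h) (sym (step-% x))

  pred-position : ∀ {u} → Periodic d u → ∀ {i} → IsLabel n i →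
    (leftCode u (i + n + pred n) ≡ leftCode u (unrot1 n i + n)) × (rightCode u (i + n + pred n) ≡ rightCode u (unrot1 n i + n))
  pred-position {u} per {suc zero}    l = cong (leftCode u) pos , cong (rightCode u) pos
    where
    pos : 1 + n + pred n ≡ n + n
    pos = linear≡ (_ ∷ _ ∷ []) (κ 1 ⊕ # 1 ⊕ # 0 ≈ # 1 ⊕ # 1) 1 (1 ⇒ κ 1 ⊕ # 0 ≈ # 1 ∋ suc-pred-n ∷ [])
  pred-position {u} per {suc (suc i)} l =
    trans (cong (leftCode u) pos) (leftCode-n per (suc i + n) (≤-trans d≤n (m≤n+m n (suc i)))) ,
    trans (cong (rightCode u) pos) (rightCode-n per (suc i + n) (s≤s z≤n))
    where
    pos : suc (suc i) + n + pred n ≡ suc i + n + n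
    pos = linear≡ (_ ∷ _ ∷ i ∷ []) (κ 1 ⊕ (κ 1 ⊕ # 2) ⊕ # 1 ⊕ # 0 ≈ κ 1 ⊕ # 2 ⊕ # 1 ⊕ # 1) 1 (1 ⇒ κ 1 ⊕ # 0 ≈ # 1 ∋ suc-pred-n ∷ [])

  -- As `n` is a period, a shift by `pred n` is a shift back by one: what label `i - 1` saw before
  -- is seen by label `i` now, and the residues naming the blocks move on by one.
  rot-cyclicPair : ∀ {u} → Periodic d u → rotLP (cyclicPair u) ≡ cyclicPair (shift (pred n) u)
  rot-cyclicPair {u} per = cong₂ _,_
    (rotRP-coded n {λ i → leftCode u (i + n)} {λ i → leftCode (shift (pred n) u) (i + n)} {weight u} {weight (shift (pred n) u)}
      step unstep (λ {i} _ → code≤n (leftDist u (i + n)) _) unstep-step (weight-step per)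
      (λ {i} l → trans (left i) (cong step (proj₁ (pred-position per l)))))
    (rotRP-coded n {λ i → rightCode u (i + n)} {λ i → rightCode (shift (pred n) u) (i + n)} {weight u} {weight (shift (pred n) u)}
      step unstep (λ {i} _ → code≤n (rightDist u (i + n)) _) unstep-step (weight-step per)
      (λ {i} l → trans (right i) (cong step (proj₂ (pred-position per l)))))
    where
    left : ∀ i → leftCode (shift (pred n) u) (i + n) ≡ step (leftCode u (i + n + pred n))
    left i = trans (cong (λ k → centre k (i + n ∸ k)) eq)
      (centre-step (leftDist u (i + n + pred n)) (trans (cong (_% n) move) ([m+n]%n≡m%n (i + n ∸ k) n)))
      where
      k = leftDist u (i + n + pred n)
      k≤ : k ≤ i + n
      k≤ = ≤-trans (leftDist≤ u (i + n + pred n)) (≤-trans d≤n (m≤n+m n i))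
      eq : leftDist (shift (pred n) u) (i + n) ≡ k
      eq = leftDist-shift u (pred n) (i + n) (≤-trans d≤n (m≤n+m n i))
      move : suc (i + n + pred n ∸ k) ≡ i + n ∸ k + n
      move = linear≡ (i + n ∸ k ∷ k ∷ i ∷ _ ∷ _ ∷ _ ∷ []) (κ 1 ⊕ # 4 ≈ # 0 ⊕ # 3) 1 (1 ⇐ # 0 ⊕ # 1 ≈ # 2 ⊕ # 3 ∋ m∸n+n≡m k≤ ∷
          1 ⇒ # 4 ⊕ # 1 ≈ # 2 ⊕ # 3 ⊕ # 5 ∋ m∸n+n≡m (≤-trans k≤ (m≤m+n (i + n) (pred n))) ∷ 1 ⇒ κ 1 ⊕ # 5 ≈ # 3 ∋ suc-pred-n ∷ [])
    right : ∀ i → rightCode (shift (pred n) u) (i + n) ≡ step (rightCode u (i + n + pred n))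
    right i = trans (cong (λ k → centre k (i + n + k ∸ 1)) (rightDist-shift u (pred n) (i + n)))
      (last (rightDist u (i + n + pred n)))
      where
      last : ∀ k → centre k (i + n + k ∸ 1) ≡ step (centre k (i + n + pred n + k ∸ 1))
      last zero    = sym step-n
      last (suc k) = centre-step (suc k) (trans (cong (_% n) move) ([m+n]%n≡m%n (i + n + suc k ∸ 1) n))
        where
        move : suc (i + n + pred n + suc k ∸ 1) ≡ i + n + suc k ∸ 1 + n
        drop : ∀ x → x + suc k ∸ 1 ≡ x + k
        drop x = cong (_∸ 1) (+-suc x k)
        move = linear≡ (_ ∷ i ∷ _ ∷ k ∷ _ ∷ _ ∷ []) (κ 1 ⊕ # 4 ≈ # 0 ⊕ # 2) 1 (1 ⇐ # 0 ≈ # 1 ⊕ # 2 ⊕ # 3 ∋ drop (i + n) ∷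
            1 ⇒ # 4 ≈ # 1 ⊕ # 2 ⊕ # 5 ⊕ # 3 ∋ drop (i + n + pred n) ∷ 1 ⇒ κ 1 ⊕ # 5 ≈ # 2 ∋ suc-pred-n ∷ [])

-- Central and wrapping blocks

rot1-label : ∀ {n i} → 1 ≤ n → IsLabel n i → IsLabel n (rot1 n i)
rot1-label {n} {i} 1≤n (1≤i , i≤n) with i ≟ n
... | yes e = subst (IsLabel n) (sym (if-true (≡⇒≡ᵇ≡true e))) (≤-refl , 1≤n)
... | no ≢n = subst (IsLabel n) (sym (if-false (≢⇒≡ᵇ≡false ≢n))) (s≤s z≤n , ≤∧≢⇒< i≤n ≢n)

iter-rot1-label : ∀ {n} k {i} → 1 ≤ n → IsLabel n i → IsLabel n (iter k (rot1 n) i)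
iter-rot1-label zero    1≤n l = l
iter-rot1-label (suc k) 1≤n l = rot1-label 1≤n (iter-rot1-label k 1≤n l)

module _ (n : ℕ) .{{_ : NonZero n}} where
  open Residues n

  rot1-Congruent : ∀ i → Congruent (rot1 n i) (suc i)
  rot1-Congruent i with i ≟ n
  ... | yes e = subst (λ z → Congruent z (suc i)) (sym (if-true (≡⇒≡ᵇ≡true e))) (Congruent-wrap (cong suc (sym e)))
  ... | no ≢n = Congruent-≡ (if-false (≢⇒≡ᵇ≡false ≢n))

  iter-rot1-Congruent : ∀ k i → Congruent (iter k (rot1 n) i) (i + k)
  iter-rot1-Congruent zero    i = Congruent-≡ (sym (+-identityʳ i))
  iter-rot1-Congruent (suc k) i = Congruent-trans (rot1-Congruent _)
    (subst (λ z → Congruent (suc (iter k (rot1 n) i)) z) (sym (+-suc i k)) (suc-cong (iter-rot1-Congruent k i)))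
    where
    suc-cong : ∀ {x y} → Congruent x y → Congruent (suc x) (suc y)
    suc-cong (p , q , h) = p , q , cong suc h

module BlockExtremes (n : ℕ) (R : ℕ → ℕ → Bool) {i : ℕ} (li : IsLabel n i) (refl-i : R i i ≡ true) where

  minBlock-spec : IsLabel n (minBlock n R i) × R i (minBlock n R i) ≡ true × (∀ {k} → IsLabel n k → R i k ≡ true → minBlock n R i ≤ k)
  minBlock-spec with searchFirst n 1 (R i)
  ... | none h = ⊥-elim (true≢false refl-i (h i (proj₁ li) (s≤s (proj₂ li))))
  ... | found t 1≤t t≤n Rt before = subst (λ z → IsLabel n z × R i z ≡ true × (∀ {k} → IsLabel n k → R i k ≡ true → z ≤ k))
      (sym (firstFrom-found n 1 (R i) i 1≤t t≤n Rt before))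
      ((1≤t , ≤-pred t≤n) , Rt , λ {k} lk Rk → ≮⇒≥ λ k<t → true≢false Rk (before k (proj₁ lk) k<t))

  maxBlock-spec : IsLabel n (maxBlock n R i) × R i (maxBlock n R i) ≡ true × (∀ {k} → IsLabel n k → R i k ≡ true → k ≤ maxBlock n R i)
  maxBlock-spec = go n ≤-refl (λ k n<k k≤n → ⊥-elim (<⇒≱ n<k k≤n))
    where
    go : ∀ m → m ≤ n → (∀ k → m < k → k ≤ n → R i k ≡ false) →
      IsLabel n (lastDown m (R i) i) × R i (lastDown m (R i) i) ≡ true × (∀ {k} → IsLabel n k → R i k ≡ true → k ≤ lastDown m (R i) i)
    go zero m≤n out = ⊥-elim (true≢false refl-i (out i (proj₁ li) (proj₂ li)))
    go (suc m) m<n out with R i (suc m) in eq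
    ... | true  = (s≤s z≤n , m<n) , eq , λ {k} lk Rk → ≮⇒≥ λ m<k → true≢false Rk (out k m<k (proj₂ lk))
    ... | false = go m (<⇒≤ m<n) λ k m<k k≤n → still k m<k k≤n (k ≟ suc m)
      where
      still : ∀ k → m < k → k ≤ n → Dec (k ≡ suc m) → R i k ≡ false
      still k m<k k≤n (yes refl) = eq
      still k m<k k≤n (no ≢)     = out k (≤∧≢⇒< m<k λ e → ≢ (sym e)) k≤n

-- A block in a cyclic window of length d is wrapping exactly when the window passes from n to 1 inside it.
module Windows (d m n : ℕ) (n≡md : n ≡ m * d) (1≤d : 1 ≤ d) (2≤m : 2 ≤ m) (2d≤n : d + d ≤ n) .{{_ : NonZero n}}
               (R : ℕ → ℕ → Bool) {i : ℕ} (li : IsLabel n i) (refl-i : R i i ≡ true) where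

  open Residues n
  open Blocks n d R
  open BlockExtremes n R li refl-i public

  1≤n : 1 ≤ n
  1≤n = ≤-trans (proj₁ li) (proj₂ li)

  rotk-label : ∀ k {y} → IsLabel n y → IsLabel n (rotk k y)
  rotk-label k l = iter-rot1-label k 1≤n l

  stable : ℕ → Bool
  stable z = beq (anyLab n (λ y → R i y ∧ (rotk d y ≡ᵇ z))) (R i z)

  enclosed : ℕ → ℕ → Bool
  enclosed k y = not (R i y) ∨ ((minBlock n R i ≤ᵇ rotk (k * d) y) ∧ (rotk (k * d) y ≤ᵇ maxBlock n R i))

  central-block : (∀ {z} → IsLabel n z → R i z ≡ true → R i (rotk d z) ≡ true) →
    (∀ {z} → IsLabel n z → R i z ≡ true → ∃ λ y → IsLabel n y × R i y ≡ true × rotk d y ≡ z) → ncnw i ≡ false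
  central-block closed onto = cong (λ c → not c ∧ not (not c ∧ orbitInside i)) central-i
    where
    central-i : central i ≡ true
    central-i = allLab-intro n stable λ z lz → subst (λ x → beq x (R i z) ≡ true)
      (sym (bool-ext {y = R i z}
        (λ h → let (y , ly , p) = anyLab-elim n (λ y → R i y ∧ (rotk d y ≡ᵇ z)) h in
               subst (λ w → R i w ≡ true) (≡ᵇ≡true⇒≡ (∧-elimʳ {R i y} p)) (closed ly (∧-elimˡ p)))
        (λ h → let (y , ly , Ry , e) = onto lz h in anyLab-intro n (λ y → R i y ∧ (rotk d y ≡ᵇ z)) ly (∧-intro Ry (≡⇒≡ᵇ≡true e)))))
      (beq-refl (R i z))

  -- `rot^d` moves `i` by `d` along the circle, and by `2 d ≤ n` this leads out of the window on
  -- either side of the passage from `n` to 1. So the block is not fixed, and already its first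
  -- translate leaves `[min, max]`.
  straight-block : ∀ st → (∀ {y} → IsLabel n y → R i y ≡ true → st ≤ y × y < st + d) → ncnw i ≡ true
  straight-block st inside = ∧-intro (cong not noncentral) (cong not nonwrapping)
    where
    z = rotk d i
    lz : IsLabel n z
    lz = rotk-label d li
    z-outside : st ≤ z → z < st + d → ⊥
    z-outside st≤z z< = cases (inside li refl-i) (z ≤? i)
      where
      straight : i < z → z ≡ i + d
      straight i<z = Congruent-close (iter-rot1-Congruent n d i) (linear (_ ∷ _ ∷ _ ∷ _ ∷ [])
          (κ 1 ⊕ # 0 ≼ # 2 ⊕ # 3 ⊕ # 1) 1 (1 × # 0 ≼ # 1 ∋ proj₂ lz ∷ 1 × κ 1 ≼ # 2 ∋ proj₁ li ∷ 1 × κ 1 ≼ # 3 ∋ 1≤d ∷ [])) (linear (_ ∷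
          _ ∷ _ ∷ _ ∷ []) (κ 1 ⊕ (# 2 ⊕ # 0) ≼ # 3 ⊕ # 1) 1 (1 × # 0 ⊕ # 0 ≼ # 1 ∋ 2d≤n ∷ 1 × κ 1 ⊕ # 2 ≼ # 3 ∋ i<z ∷ 1 × κ 1 ≼ # 0 ∋ 1≤d ∷
          []))
      around : z ≤ i → z + n ≡ i + d
      around z≤i = Congruent-close (Congruent-trans (Congruent-sym (Congruent-wrap refl)) (iter-rot1-Congruent n d i))
          (linear (_ ∷ _ ∷ _ ∷ n ∷ []) (κ 1 ⊕ (# 0 ⊕ # 3) ≼ # 1 ⊕ # 2 ⊕ # 3) 1 (1 × # 0 ≼ # 1 ∋ z≤i ∷ 1 × κ 1 ≼ # 2 ∋ 1≤d ∷ []))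
              (linear (_ ∷ _ ∷ _ ∷ d ∷ _ ∷ []) (κ 1 ⊕ (# 1 ⊕ # 3) ≼ # 0 ⊕ # 2 ⊕ # 2) 2 (2 × κ 1 ≼ # 0 ∋ proj₁ lz ∷ 2 × # 1 ≼ # 2 ∋
              proj₂ li ∷ 1 × # 3 ⊕ # 3 ≼ # 2 ∋ 2d≤n ∷ 1 ⇐ # 2 ≈ # 4 ∋ n≡md ∷ []))
      cases : st ≤ i × i < st + d → Dec (z ≤ i) → ⊥
      cases (st≤i , i<) (no z≰i)  = refute {_ ∷ _ ∷ d ∷ _ ∷ []} (1 ⇐ # 0 ≈ # 1 ⊕ # 2 ∋ straight (≰⇒> z≰i) ∷ 1 × # 3 ≼ # 1 ∋ st≤i ∷
          1 × κ 1 ⊕ # 0 ≼ # 3 ⊕ # 2 ∋ z< ∷ [])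
      cases (st≤i , i<) (yes z≤i) = refute {_ ∷ _ ∷ _ ∷ d ∷ _ ∷ []} (1 ⇒ # 0 ⊕ # 1 ≈ # 2 ⊕ # 3 ∋ around z≤i ∷ 1 × # 3 ⊕ # 3 ≼ # 1 ∋ 2d≤n ∷
          1 × κ 1 ⊕ # 2 ≼ # 4 ⊕ # 3 ∋ i< ∷ 1 × # 4 ≼ # 0 ∋ st≤z ∷ [])
    noncentral : central i ≡ false
    noncentral = ¬true⇒false λ c →
      let eq = beq⇒≡ (allLab-elim n stable c z lz)
          (st≤z , z<) = inside lz (trans (sym eq) (anyLab-intro n (λ y → R i y ∧ (rotk d y ≡ᵇ z)) li (∧-intro refl-i (≡⇒≡ᵇ≡true {z} refl))))
      in z-outside st≤z z<
    1<n : 1 < n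
    1<n = ≤-trans (+-mono-≤ 1≤d 1≤d) 2d≤n
    nonwrapping : wrapping i ≡ false
    nonwrapping = ¬true⇒false λ w →
      let o = allLab-elim n (enclosed 1) (allUpTo-elim n (λ k → allLab n (enclosed k)) (∧-elimʳ {not (central i)} w) 1 1<n) i li
          o′ = subst (λ x → (not x ∨ ((minBlock n R i ≤ᵇ rotk (1 * d) i) ∧ (rotk (1 * d) i ≤ᵇ maxBlock n R i))) ≡ true) refl-i o
          o″ = subst (λ x → ((minBlock n R i ≤ᵇ rotk x i) ∧ (rotk x i ≤ᵇ maxBlock n R i)) ≡ true) (*-identityˡ d) o′
          (lmin , Rmin , _) = minBlock-spec
          (lmax , Rmax , _) = maxBlock-spec
      in z-outside (≤-trans (proj₁ (inside lmin Rmin)) (≤ᵇ≡true⇒≤ (∧-elimˡ o″)))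
                   (≤-<-trans (≤ᵇ≡true⇒≤ (∧-elimʳ {minBlock n R i ≤ᵇ z} o″)) (proj₂ (inside lmax Rmax)))

  -- Every label outside `[x, y]` lies in the cyclic window. A translate of a member `z` by a
  -- multiple of `d` falls either into `[x, y]` or into the window; in the latter case its offset
  -- agrees with that of `z` modulo `d`, so it is `z` itself. The whole orbit thus stays in
  -- `[min, max]`, and the block is central or wrapping.
  wrapped-block : ∀ st → (∀ {y} → IsLabel n y → R i y ≡ true → ∃ λ o → o < d × Congruent y (st + o)) →
    ∀ {x y} → IsLabel n x → IsLabel n y → R i x ≡ true → R i y ≡ true → x < st → st ≤ y → ncnw i ≡ false
  wrapped-block st window {x} {y} lx ly Rx Ry x<st st≤y = collapse (central i) (allUpTo-intro n (λ k → allLab n (enclosed k)) λ k _ → allLab-intro n (enclosed k) λ z lz → inside k lz)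
    where
    collapse : ∀ c {o} → o ≡ true → (not c ∧ not (not c ∧ o)) ≡ false
    collapse true  refl = refl
    collapse false refl = refl
    x≡ : x + n ≡ st + proj₁ (window lx Rx)
    x≡ with window lx Rx
    ... | o , o<d , c = Congruent-close {x + n} {st + o} (Congruent-trans (Congruent-sym (Congruent-wrap refl)) c)
          (linear (_ ∷ _ ∷ o ∷ n ∷ []) (κ 1 ⊕ (# 1 ⊕ # 3) ≼ # 0 ⊕ # 2 ⊕ # 3) 1 (1 × κ 1 ⊕ # 1 ≼ # 0 ∋ x<st ∷ [])) (linear (_ ∷ _ ∷ _ ∷ _ ∷
              _ ∷ _ ∷ _ ∷ []) (κ 1 ⊕ (# 4 ⊕ # 5) ≼ # 0 ⊕ # 2 ⊕ # 2) 2 (2 × κ 1 ≼ # 0 ∋ proj₁ lx ∷ 2 × # 1 ≼ # 2 ∋ proj₂ ly ∷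
              1 × # 3 ⊕ # 3 ≼ # 2 ∋ 2d≤n ∷ 2 × # 4 ≼ # 1 ∋ st≤y ∷ 2 × κ 1 ⊕ # 5 ≼ # 3 ∋ o<d ∷ 1 ⇐ # 2 ≈ # 6 ∋ n≡md ∷ []))
    same-offset : ∀ {z w r o} k → Congruent z (st + r) → Congruent z (w + k * d) → Congruent w (st + o) → r < d → o < d → Congruent z w
    same-offset {z} {w} {r} {o} k zr zw wo r<d o<d
      with Congruent-cancel {r} {o + k * d} st (regroup (Congruent-trans (Congruent-sym zr) (Congruent-trans zw (Congruent-+ (k * d) wo))))
      where
      regroup : Congruent (st + r) (st + o + k * d) → Congruent (r + st) (o + k * d + st)
      regroup (p , q , e) = p , q , linear≡ (st ∷ r ∷ p * n ∷ o ∷ k * d ∷ q * n ∷ [])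
          (# 1 ⊕ # 0 ⊕ # 2 ≈ # 3 ⊕ # 4 ⊕ # 0 ⊕ # 5) 1 (1 ⇒ # 0 ⊕ # 1 ⊕ # 2 ≈ # 0 ⊕ # 3 ⊕ # 4 ⊕ # 5 ∋ e ∷ [])
    ... | p , q , e = Congruent-trans zr (subst (λ c → Congruent (st + c) w) (sym r≡o) (Congruent-sym wo))
      where
      -- As `d` divides `n`, the congruence modulo `n` reduces to one modulo `d`, and offsets below
      -- `d` are determined by it.
      r≡o : r ≡ o
      r≡o = Congruence.Congruent-close d (p * m , k + q * m , linear≡ (r ∷ _ ∷ o ∷ k * d ∷ _ ∷ _ ∷ _ ∷ _ ∷ [])
          (# 0 ⊕ # 5 ≈ # 2 ⊕ # 7) 1 (1 ⇒ # 0 ⊕ # 1 ≈ # 2 ⊕ # 3 ⊕ # 4 ∋ e ∷ 1 ⇒ # 5 ≈ # 1 ∋ times p ∷ 1 ⇐ # 6 ≈ # 4 ∋ times q ∷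
          1 ⇐ # 7 ≈ # 3 ⊕ # 6 ∋ *-distribʳ-+ d k (q * m) ∷ [])) (linear (o ∷ _ ∷ _ ∷ []) (κ 1 ⊕ # 2 ≼ # 0 ⊕ # 1) 1 (1 × κ 1 ⊕ # 2 ≼ # 1 ∋
          r<d ∷ [])) (linear (_ ∷ _ ∷ r ∷ []) (κ 1 ⊕ # 0 ≼ # 2 ⊕ # 1) 1 (1 × κ 1 ⊕ # 0 ≼ # 1 ∋ o<d ∷ []))
        where
        times : ∀ p → p * m * d ≡ p * n
        times p = trans (*-assoc p m d) (cong (p *_) (sym n≡md))
    bounds : ∀ k {z} → IsLabel n z → R i z ≡ true → minBlock n R i ≤ rotk (k * d) z × rotk (k * d) z ≤ maxBlock n R i
    bounds k {z} lz Rz = go (x ≤? z′) (z′ ≤? y)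
      where
      z′ = rotk (k * d) z
      lz′ : IsLabel n z′
      lz′ = rotk-label (k * d) lz
      min≤ : ∀ {k} → IsLabel n k → R i k ≡ true → minBlock n R i ≤ k
      min≤ = proj₂ (proj₂ minBlock-spec)
      ≤max : ∀ {k} → IsLabel n k → R i k ≡ true → k ≤ maxBlock n R i
      ≤max = proj₂ (proj₂ maxBlock-spec)
      fixed : ∀ r → r < d → Congruent z′ (st + r) → minBlock n R i ≤ z′ × z′ ≤ maxBlock n R i
      fixed r r<d c = min≤ lz′ Rz′ , ≤max lz′ Rz′
        where
        o = proj₁ (window lz Rz)
        z′≡z : z′ ≡ z
        z′≡z = Congruent-close (same-offset k c (iter-rot1-Congruent n (k * d) z) (proj₂ (proj₂ (window lz Rz))) r<d (proj₁ (proj₂ (window lz Rz))))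
          (linear (_ ∷ _ ∷ _ ∷ []) (κ 1 ⊕ # 1 ≼ # 0 ⊕ # 2) 1 (1 × κ 1 ≼ # 0 ∋ proj₁ lz ∷ 1 × # 1 ≼ # 2 ∋ proj₂ lz′ ∷ [])) (linear (_ ∷ _ ∷
              _ ∷ []) (κ 1 ⊕ # 1 ≼ # 0 ⊕ # 2) 1 (1 × κ 1 ≼ # 0 ∋ proj₁ lz′ ∷ 1 × # 1 ≼ # 2 ∋ proj₂ lz ∷ []))
        Rz′ : R i z′ ≡ true
        Rz′ = subst (λ w → R i w ≡ true) (sym z′≡z) Rz
      go : Dec (x ≤ z′) → Dec (z′ ≤ y) → minBlock n R i ≤ z′ × z′ ≤ maxBlock n R i
      go (yes x≤z′) (yes z′≤y) = ≤-trans (min≤ lx Rx) x≤z′ , ≤-trans z′≤y (≤max ly Ry)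
      go (no x≰z′) _ = fixed (z′ + n ∸ st) (linear (st ∷ _ ∷ _ ∷ n ∷ _ ∷ _ ∷ _ ∷ []) (κ 1 ⊕ # 1 ≼ # 6) 1 (1 ⇒ # 0 ⊕ # 1 ≈ # 2 ⊕ # 3 ∋
          m+[n∸m]≡n st≤ ∷ 1 ⇒ # 4 ⊕ # 3 ≈ # 0 ⊕ # 5 ∋ x≡ ∷ 1 × κ 1 ⊕ # 5 ≼ # 6 ∋ proj₁ (proj₂ (window lx Rx)) ∷ 1 × κ 1 ⊕ # 2 ≼ # 4 ∋
          ≰⇒> x≰z′ ∷ []))
          (Congruent-wrap (sym (m+[n∸m]≡n st≤)))
        where
        st≤ : st ≤ z′ + n
        st≤ = linear (_ ∷ _ ∷ _ ∷ z′ ∷ []) (# 2 ≼ # 3 ⊕ # 1) 1 (1 × # 0 ≼ # 1 ∋ proj₂ ly ∷ 1 × # 2 ≼ # 0 ∋ st≤y ∷ [])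
      go (yes _) (no z′≰y) = fixed (z′ ∸ st) (linear (st ∷ _ ∷ _ ∷ _ ∷ _ ∷ _ ∷ _ ∷ []) (κ 1 ⊕ # 1 ≼ # 6) 1 (1 ⇒ # 0 ⊕ # 1 ≈ # 2 ∋
          m+[n∸m]≡n st≤ ∷ 1 ⇒ # 3 ⊕ # 4 ≈ # 0 ⊕ # 5 ∋ x≡ ∷ 1 × κ 1 ⊕ # 5 ≼ # 6 ∋ proj₁ (proj₂ (window lx Rx)) ∷ 1 × # 2 ≼ # 4 ∋ proj₂ lz′ ∷
          1 × κ 1 ≼ # 3 ∋ proj₁ lx ∷ []))
          (Congruent-≡ (sym (m+[n∸m]≡n st≤)))
        where
        st≤ : st ≤ z′
        st≤ = linear (_ ∷ _ ∷ _ ∷ []) (# 2 ≼ # 1) 1 (1 × κ 1 ⊕ # 0 ≼ # 1 ∋ ≰⇒> z′≰y ∷ 1 × # 2 ≼ # 0 ∋ st≤y ∷ [])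
    inside : ∀ k {z} → IsLabel n z → enclosed k z ≡ true
    inside k {z} lz with R i z in eq
    ... | false = refl
    ... | true  = let (lo , hi) = bounds k lz eq in ∧-intro (≤⇒≤ᵇ≡true lo) (≤⇒≤ᵇ≡true hi)

-- Reading the sequence pair off a cyclic walk

-- The offsets differ by one because a block of P with minimum `i` is ranked by the rise at `i - 1`,
-- whereas a block of Q with maximum `n - d + i` is ranked by the rise at that very position, which
-- is congruent to `i` modulo `d`.
decode : (a b d : ℕ) → (ℕ → ℕ) → SeqPair d
decode a b d u = tabulate (λ f → if a <ᵇ b * u (toℕ f) then u (toℕ f) else 0) ,
                 tabulate (λ f → if b * u (suc (toℕ f)) <ᵇ a then u (suc (toℕ f)) else 0)

module Decoding (a d m n : ℕ) (n≡md : n ≡ m * d) (1≤d : 1 ≤ d) (2≤m : 2 ≤ m) .{{nz : NonZero n}}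
                {u : ℕ → ℕ} (per : Periodic d u) where

  open CyclicPair a d m n n≡md 1≤d 2≤m

  P Q : RP n
  P = proj₁ (cyclicPair u)
  Q = proj₂ (cyclicPair u)

  lc rc lk rk : ℕ → ℕ
  lk i = leftDist u (i + n)
  rk i = rightDist u (i + n)
  lc i = leftCode u (i + n)
  rc i = rightCode u (i + n)

  relP⇒ : ∀ {i j} → IsLabel n i → IsLabel n j → relOf P i j ≡ true → lc i ≡ lc j
  relP⇒ li lj h = ≡ᵇ≡true⇒≡ (trans (sym (relOf-fromFun n (λ i j → lc i ≡ᵇ lc j) (λ i → weight u (lc i)) li lj)) h)

  ⇒relP : ∀ {i j} → IsLabel n i → IsLabel n j → lc i ≡ lc j → relOf P i j ≡ true
  ⇒relP li lj h = trans (relOf-fromFun n (λ i j → lc i ≡ᵇ lc j) (λ i → weight u (lc i)) li lj) (≡⇒≡ᵇ≡true h)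

  relQ⇒ : ∀ {i j} → IsLabel n i → IsLabel n j → relOf Q i j ≡ true → rc i ≡ rc j
  relQ⇒ li lj h = ≡ᵇ≡true⇒≡ (trans (sym (relOf-fromFun n (λ i j → rc i ≡ᵇ rc j) (λ i → weight u (rc i)) li lj)) h)

  ⇒relQ : ∀ {i j} → IsLabel n i → IsLabel n j → rc i ≡ rc j → relOf Q i j ≡ true
  ⇒relQ li lj h = trans (relOf-fromFun n (λ i j → rc i ≡ᵇ rc j) (λ i → weight u (rc i)) li lj) (≡⇒≡ᵇ≡true h)

  d≤+n : ∀ i → d ≤ i + n
  d≤+n i = ≤-trans d≤n (m≤n+m n i)

  leftDist-Congruent : ∀ {I J} → d ≤ I → d ≤ J → Congruent I J → leftDist u I ≡ leftDist u J
  leftDist-Congruent {I} {J} d≤I d≤J (p , q , h) = trans (sym (multiple p I d≤I)) (trans (cong (leftDist u) h) (multiple q J d≤J))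
    where
    multiple : ∀ p I → d ≤ I → leftDist u (I + p * n) ≡ leftDist u I
    multiple p I d≤I = trans (cong (λ z → leftDist u (I + z)) (trans (cong (p *_) n≡md) (sym (*-assoc p m d)))) (leftDist-periodic per (p * m) I d≤I)

  rightDist-Congruent : ∀ {I J} → Congruent I J → rightDist u I ≡ rightDist u J
  rightDist-Congruent {I} {J} (p , q , h) = trans (sym (multiple p I)) (trans (cong (rightDist u) h) (multiple q J))
    where
    multiple : ∀ p I → rightDist u (I + p * n) ≡ rightDist u I
    multiple p I = trans (cong (λ z → rightDist u (I + z)) (trans (cong (p *_) n≡md) (sym (*-assoc p m d)))) (rightDist-periodic per (p * m) I)

  rotd : ℕ → ℕ
  rotd = iter d (rot1 n)

  lk-rotd : ∀ z → lk (rotd z) ≡ lk z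
  lk-rotd z = trans (leftDist-Congruent {rotd z + n} {z + n + 1 * d} (d≤+n (rotd z)) (≤-trans (d≤+n z) (m≤m+n (z + n) (1 * d))) close)
    (leftDist-periodic per 1 (z + n) (d≤+n z))
    where
    close : Congruent (rotd z + n) (z + n + 1 * d)
    close = Congruent-trans (Congruent-+ n (iter-rot1-Congruent n d z)) (Congruent-≡ {z + d + n} {z + n + 1 * d} (linear≡ (d ∷ n ∷ z ∷ [])
        (# 2 ⊕ # 0 ⊕ # 1 ≈ # 2 ⊕ # 1 ⊕ (1 ⊛ # 0)) 1 ([])))

  rk-rotd : ∀ z → rk (rotd z) ≡ rk z
  rk-rotd z = trans (rightDist-Congruent {rotd z + n} {z + n + 1 * d} close) (rightDist-periodic per 1 (z + n))
    where
    close : Congruent (rotd z + n) (z + n + 1 * d)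
    close = Congruent-trans (Congruent-+ n (iter-rot1-Congruent n d z)) (Congruent-≡ {z + d + n} {z + n + 1 * d} (linear≡ (d ∷ n ∷ z ∷ [])
        (# 2 ⊕ # 0 ⊕ # 1 ≈ # 2 ⊕ # 1 ⊕ (1 ⊛ # 0)) 1 ([])))

  rotd-onto : ∀ {z} → IsLabel n z → ∃ λ y → IsLabel n y × rotd y ≡ z
  rotd-onto {z} lz = y , ly , Congruent-close (Congruent-trans (iter-rot1-Congruent n d y)
      (Congruent-trans (Congruent-+ d (iter-rot1-Congruent n (n ∸ d) z)) (Congruent-sym (Congruent-wrap back-to))))
      (linear (_ ∷ _ ∷ _ ∷ []) (κ 1 ⊕ # 0 ≼ # 2 ⊕ # 1) 1 (1 × # 0 ≼ # 1 ∋ proj₂ ly′ ∷ 1 × κ 1 ≼ # 2 ∋ proj₁ lz ∷ [])) (linear (_ ∷ _ ∷ _ ∷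
          []) (κ 1 ⊕ # 1 ≼ # 0 ⊕ # 2) 1 (1 × κ 1 ≼ # 0 ∋ proj₁ ly′ ∷ 1 × # 1 ≼ # 2 ∋ proj₂ lz ∷ []))
    where
    y = iter (n ∸ d) (rot1 n) z
    1≤n = ≤-trans (proj₁ lz) (proj₂ lz)
    ly : IsLabel n y
    ly = iter-rot1-label (n ∸ d) 1≤n lz
    ly′ : IsLabel n (rotd y)
    ly′ = iter-rot1-label d 1≤n ly
    back-to : z + n ≡ z + (n ∸ d) + d
    back-to = linear≡ (n ∸ d ∷ d ∷ _ ∷ z ∷ []) (# 3 ⊕ # 2 ≈ # 3 ⊕ # 0 ⊕ # 1) 1 (1 ⇐ # 0 ⊕ # 1 ≈ # 2 ∋ m∸n+n≡m d≤n ∷ [])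

  lc-0 : ∀ {i} → lk i ≡ 0 → lc i ≡ n
  lc-0 h = centre-0 h

  rc-0 : ∀ {i} → rk i ≡ 0 → rc i ≡ n
  rc-0 h = centre-0 h

  lc-0⁻¹ : ∀ {i} → lc i ≡ n → lk i ≡ 0
  lc-0⁻¹ {i} h with lk i
  ... | zero  = refl
  ... | suc k = ⊥-elim (<⇒≢ (m%n<n (i + n ∸ suc k) n) h)

  rc-0⁻¹ : ∀ {i} → rc i ≡ n → rk i ≡ 0
  rc-0⁻¹ {i} h with rk i
  ... | zero  = refl
  ... | suc k = ⊥-elim (<⇒≢ (m%n<n (i + n + suc k ∸ 1) n) h)

  -- Equal codes of noncentral blocks mean that the bounding positions `j - lk j` and `i - lk i`
  -- agree modulo `n`; the form chosen moves the subtracted terms across.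
  lc-Congruent : ∀ {i j} → lk i ≢ 0 → lc i ≡ lc j → 1 ≤ lk j × Congruent (j + lk i) (i + lk j)
  lc-Congruent {i} {j} ≢0 h = n≢0⇒n>0 j≢0 , p , q , linear≡ (j + n ∸ lk j ∷ p * n ∷ i + n ∸ lk i ∷ q * n ∷ lk i ∷ i ∷ n ∷ lk j ∷ j ∷ [])
      (# 8 ⊕ # 4 ⊕ # 1 ≈ # 5 ⊕ # 7 ⊕ # 3) 1 (1 ⇒ # 0 ⊕ # 1 ≈ # 2 ⊕ # 3 ∋ e ∷ 1 ⇒ # 2 ⊕ # 4 ≈ # 5 ⊕ # 6 ∋ m∸n+n≡m i≤ ∷
      1 ⇐ # 0 ⊕ # 7 ≈ # 8 ⊕ # 6 ∋ m∸n+n≡m j≤ ∷ [])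
    where
    i≤ : lk i ≤ i + n
    i≤ = ≤-trans (leftDist≤ u (i + n)) (d≤+n i)
    j≤ : lk j ≤ j + n
    j≤ = ≤-trans (leftDist≤ u (j + n)) (d≤+n j)
    j≢0 : lk j ≢ 0
    j≢0 e = ≢0 (lc-0⁻¹ (trans h (lc-0 e)))
    c = %⇒Congruent {j + n ∸ lk j} {i + n ∸ lk i} (trans (sym (centre-≢0 j≢0)) (trans (sym h) (centre-≢0 ≢0)))
    p = proj₁ c
    q = proj₁ (proj₂ c)
    e : (j + n ∸ lk j) + p * n ≡ (i + n ∸ lk i) + q * n
    e = proj₂ (proj₂ c)

  rc-Congruent : ∀ {i j} → rk i ≢ 0 → rc i ≡ rc j → 1 ≤ rk j × Congruent (j + rk j) (i + rk i)
  rc-Congruent {i} {j} ≢0 h = n≢0⇒n>0 j≢0 , p , q , linear≡ (j + n + rk j ∸ 1 ∷ p * n ∷ i + n + rk i ∸ 1 ∷ q * n ∷ i ∷ n ∷ rk i ∷ j ∷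
      rk j ∷ []) (# 7 ⊕ # 8 ⊕ # 1 ≈ # 4 ⊕ # 6 ⊕ # 3) 1 (1 ⇒ # 0 ⊕ # 1 ≈ # 2 ⊕ # 3 ∋ e ∷ 1 ⇒ # 2 ⊕ κ 1 ≈ # 4 ⊕ # 5 ⊕ # 6 ∋ m∸n+n≡m i≤ ∷
      1 ⇐ # 0 ⊕ κ 1 ≈ # 7 ⊕ # 5 ⊕ # 8 ∋ m∸n+n≡m j≤ ∷ [])
    where
    j≢0 : rk j ≢ 0
    j≢0 e = ≢0 (rc-0⁻¹ (trans h (rc-0 e)))
    i≤ : 1 ≤ i + n + rk i
    i≤ = ≤-trans (n≢0⇒n>0 ≢0) (m≤n+m (rk i) (i + n))
    j≤ : 1 ≤ j + n + rk j
    j≤ = ≤-trans (n≢0⇒n>0 j≢0) (m≤n+m (rk j) (j + n))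
    c = %⇒Congruent {j + n + rk j ∸ 1} {i + n + rk i ∸ 1} (trans (sym (centre-≢0 j≢0)) (trans (sym h) (centre-≢0 ≢0)))
    p = proj₁ c
    q = proj₁ (proj₂ c)
    e : (j + n + rk j ∸ 1) + p * n ≡ (i + n + rk i ∸ 1) + q * n
    e = proj₂ (proj₂ c)

  leftDist-1 : ∀ {I} → a < suc n * u I → leftDist u (suc I) ≡ 1
  leftDist-1 {I} h = firstFrom-found d 1 (leftTest u (suc I)) 0 ≤-refl (s≤s 1≤d)
    (<⇒<ᵇ≡true (subst (_< suc n * u I) (sym (*-identityʳ a)) h)) λ k 1≤k k<1 → ⊥-elim (<⇒≱ k<1 1≤k)

  rightDist-1 : ∀ {I} → suc n * u I < a → rightDist u I ≡ 1
  rightDist-1 {I} h = firstFrom-found d 1 (rightTest u I) 0 ≤-refl (s≤s 1≤d)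
    (<⇒<ᵇ≡true (subst₂ _<_ (cong (λ z → suc n * u z) (sym (+-identityʳ I))) (sym (*-identityʳ a)) h)) λ k 1≤k k<1 → ⊥-elim (<⇒≱ k<1 1≤k)

  module PEntry {f : ℕ} (f<d : f < d) where

    i : ℕ
    i = suc f

    i≤d : i ≤ d
    i≤d = f<d

    li : IsLabel n i
    li = s≤s z≤n , ≤-trans f<d d≤n

    open Windows d m n n≡md 1≤d 2≤m 2d≤n (relOf P) li (⇒relP li li refl)
    open Blocks n d (relOf P) using (ncnw)

    u-f : u (f + n) ≡ u f
    u-f = periodic-n per f

    small : suc n * back u (i + n) 1 ≤ a * 1 → (a <ᵇ suc n * u f) ≡ false
    small h = ≤⇒<ᵇ≡false (subst₂ _≤_ (cong (suc n *_) u-f) (*-identityʳ a) h)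

    -- The cases are the distance to the nearest lower position on the left. Distance 0: the block
    -- is central and the rise before `i` is not high. Distance 1: that rise is high, `i` opens its
    -- block, and the block fits into `[i, i + d)`. Distance `K ≥ 2`: the rise is not high, and the
    -- block also contains the label following position `i - K`; either this label is smaller than
    -- `i`, or it lies on the other side of the passage from `n` to 1 and the block wraps.
    entry : (if (minBlock n (relOf P) i ≡ᵇ i) ∧ ncnw i then rankOf P i else 0) ≡ (if a <ᵇ suc n * u f then u f else 0)
    entry with leftView u (i + n)
    ... | none h e = trans (if-false (trans (cong ((minBlock n (relOf P) i ≡ᵇ i) ∧_) noncentral) (∧-zeroʳ _)))
                           (sym (if-false (small (h 1 ≤-refl 1≤d))))
      where
      noncentral : ncnw i ≡ false
      noncentral = central-block
        (λ {z} lz Rz → ⇒relP li (rotk-label d lz) (trans (relP⇒ li lz Rz) (trans (lc-0 (zero-of lz Rz)) (sym (lc-0 (trans (lk-rotd z) (zero-of lz Rz)))))))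
        (λ {z} lz Rz → let (y , ly , ry) = rotd-onto lz in y , ly ,
           ⇒relP li ly (trans (lc-0 {i} e) (sym (lc-0 {y} (trans (sym (lk-rotd y)) (trans (cong lk ry) (zero-of lz Rz)))))) , ry)
        where
        zero-of : ∀ {z} → IsLabel n z → relOf P i z ≡ true → lk z ≡ 0
        zero-of lz Rz = lc-0⁻¹ (trans (sym (relP⇒ li lz Rz)) (lc-0 {i} e))
    ... | found (suc zero) _ _ t _ e = trans (if-true (∧-intro (≡⇒≡ᵇ≡true min≡i) (straight-block i inside)))
        (trans rank (sym (if-true (<⇒<ᵇ≡true (subst₂ _<_ (*-identityʳ a) (cong (suc n *_) u-f) t)))))
      where
      inside : ∀ {y} → IsLabel n y → relOf P i y ≡ true → i ≤ y × y < i + d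
      inside {y} ly Ry = linear (_ ∷ _ ∷ _ ∷ []) (κ 1 ⊕ # 1 ≼ # 0) 1 (1 ⇐ # 0 ⊕ κ 1 ≈ κ 1 ⊕ # 1 ⊕ # 2 ∋ y≡ ∷ 1 × κ 1 ≼ # 2 ∋ 1≤ly ∷
          []) , linear (_ ∷ f ∷ _ ∷ _ ∷ []) (κ 1 ⊕ # 0 ≼ κ 1 ⊕ # 1 ⊕ # 3) 1 (1 ⇒ # 0 ⊕ κ 1 ≈ κ 1 ⊕ # 1 ⊕ # 2 ∋ y≡ ∷ 1 × # 2 ≼ # 3 ∋
          leftDist≤ u (y + n) ∷ [])
        where
        c = lc-Congruent {i} {y} (λ z → 1+n≢0 (trans (sym e) z)) (relP⇒ li ly Ry)
        1≤ly : 1 ≤ lk y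
        1≤ly = proj₁ c
        y≡ : y + 1 ≡ i + lk y
        y≡ = Congruent-close (subst (λ z → Congruent (y + z) (i + lk y)) e (proj₂ c))
          (linear (_ ∷ _ ∷ _ ∷ _ ∷ []) (κ 1 ⊕ (# 0 ⊕ κ 1) ≼ κ 1 ⊕ # 3 ⊕ # 2 ⊕ # 1) 1 (1 × # 0 ≼ # 1 ∋ proj₂ ly ∷ 1 × κ 1 ≼ # 2 ∋ 1≤ly ∷
              1 × κ 1 ≼ κ 1 ⊕ # 3 ∋ proj₁ li ∷ [])) (linear (_ ∷ _ ∷ _ ∷ _ ∷ _ ∷ [])
              (κ 1 ⊕ (κ 1 ⊕ # 4 ⊕ # 0) ≼ # 3 ⊕ κ 1 ⊕ # 2) 1 (1 × # 0 ≼ # 1 ∋ leftDist≤ u (y + n) ∷ 1 × # 1 ⊕ # 1 ≼ # 2 ∋ 2d≤n ∷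
              1 × κ 1 ≼ # 3 ∋ proj₁ ly ∷ 1 × κ 1 ⊕ # 4 ≼ # 1 ∋ i≤d ∷ []))
      min≡i : minBlock n (relOf P) i ≡ i
      min≡i = ≤-antisym (proj₂ (proj₂ minBlock-spec) li (⇒relP li li refl)) (proj₁ (inside (proj₁ minBlock-spec) (proj₁ (proj₂ minBlock-spec))))
      rank : rankOf P i ≡ u f
      rank = trans (rankOf-fromFun n (λ i j → lc i ≡ᵇ lc j) (λ i → weight u (lc i)) li)
        (trans (cong (λ k → weight u (centre k (i + n ∸ k))) e) (trans (weight-% per (f + n)) u-f))
    ... | found (suc (suc k)) _ k≤d t before e = trans (if-false (position (suc (suc k) ≤? i))) (sym (if-false (small (before 1 ≤-refl (s≤s (s≤s z≤n))))))
      where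
      K = suc (suc k)
      2≤K : 2 ≤ K
      2≤K = s≤s (s≤s z≤n)
      K≤d : K ≤ d
      K≤d = k≤d
      K≤ : K ≤ i + n
      K≤ = ≤-trans k≤d (d≤+n i)
      -- `K` is the first distance at which the walk is lower, so the last step taken backwards is a
      -- high rise. The label right after it has distance 1 and the same bounding position as `i`.
      up : a < suc n * u (i + n ∸ K)
      up = linear (_ ∷ _ ∷ _ ∷ _ ∷ _ ∷ _ ∷ []) (κ 1 ⊕ # 4 ≼ # 5) 1 (1 × κ 1 ⊕ # 0 ≼ # 1 ∋ t ∷ 1 × # 2 ≼ # 3 ∋ before (suc k)
          (s≤s z≤n) ≤-refl ∷ 1 ⇐ # 0 ≈ # 4 ⊕ # 3 ∋ *-suc a (suc k) ∷ 1 ⇒ # 1 ≈ # 2 ⊕ # 5 ∋ expand ∷ [])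
        where
        expand : suc n * back u (i + n) K ≡ suc n * back u (i + n) (suc k) + suc n * u (i + n ∸ K)
        expand = *-distribˡ-+ (suc n) (back u (i + n) (suc k)) (u (i + n ∸ K))
      start : ∀ {x} → IsLabel n x → Congruent (x + n) (suc (i + n ∸ K)) → relOf P i x ≡ true
      start {x} lx c = ⇒relP li lx (trans (cong (λ k → centre k (i + n ∸ k)) e)
          (sym (trans (cong (λ k → centre k (x + n ∸ k)) lk≡1) (Congruent⇒% (unsuc lx c)))))
        where
        lk≡1 : lk x ≡ 1
        lk≡1 = trans (leftDist-Congruent (d≤+n x) (linear (_ ∷ _ ∷ f ∷ _ ∷ _ ∷ [])
            (# 4 ≼ κ 1 ⊕ # 0) 1 (1 ⇐ # 0 ⊕ (κ 1 ⊕ (κ 1 ⊕ # 1)) ≈ κ 1 ⊕ # 2 ⊕ # 3 ∋ m∸n+n≡m K≤ ∷ 1 × # 4 ⊕ # 4 ≼ # 3 ∋ 2d≤n ∷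
            1 × κ 1 ⊕ (κ 1 ⊕ # 1) ≼ # 4 ∋ K≤d ∷ [])) c) (leftDist-1 up)
        unsuc : ∀ {x y} → IsLabel n x → Congruent (x + n) (suc y) → Congruent (x + n ∸ 1) y
        unsuc {suc x} _ (p , q , h) = p , q , suc-injective h
      position : Dec (K ≤ i) → ((minBlock n (relOf P) i ≡ᵇ i) ∧ ncnw i) ≡ false
      position (yes K≤i) = cong (_∧ ncnw i) (≢⇒≡ᵇ≡false (<⇒≢ (≤-<-trans (proj₂ (proj₂ minBlock-spec) lx (start lx (Congruent-≡ x≡))) x<i)))
        where
        x = suc (i ∸ K)
        x<i : x < i
        x<i = linear (_ ∷ _ ∷ _ ∷ []) (κ 1 ⊕ (κ 1 ⊕ # 0) ≼ κ 1 ⊕ # 2) 1 (1 ⇒ # 0 ⊕ (κ 1 ⊕ (κ 1 ⊕ # 1)) ≈ κ 1 ⊕ # 2 ∋ m∸n+n≡m K≤i ∷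
            1 × κ 2 ≼ κ 1 ⊕ (κ 1 ⊕ # 1) ∋ 2≤K ∷ [])
        lx : IsLabel n x
        lx = s≤s z≤n , linear (_ ∷ _ ∷ _ ∷ []) (κ 1 ⊕ # 0 ≼ # 2) 1 (1 × κ 1 ⊕ (κ 1 ⊕ # 0) ≼ κ 1 ⊕ # 1 ∋ x<i ∷ 1 × κ 1 ⊕ # 1 ≼ # 2 ∋ proj₂ li ∷ [])
        x≡ : x + n ≡ suc (i + n ∸ K)
        x≡ = linear≡ (i ∸ K ∷ k ∷ _ ∷ _ ∷ n ∷ []) (κ 1 ⊕ # 0 ⊕ # 4 ≈ κ 1 ⊕ # 3) 1 (1 ⇒ # 0 ⊕ (κ 1 ⊕ (κ 1 ⊕ # 1)) ≈ κ 1 ⊕ # 2 ∋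
            m∸n+n≡m K≤i ∷ 1 ⇐ # 3 ⊕ (κ 1 ⊕ (κ 1 ⊕ # 1)) ≈ κ 1 ⊕ # 2 ⊕ # 4 ∋ m∸n+n≡m K≤ ∷ [])
      position (no K≰i) = trans (cong ((minBlock n (relOf P) i ≡ᵇ i) ∧_) (wrapped-block st window li lst (⇒relP li li refl) (start lst (Congruent-sym (Congruent-wrap refl))) i<st ≤-refl)) (∧-zeroʳ _)
        where
        st = suc (i + n ∸ K)
        i<st : i < st
        i<st = linear (_ ∷ _ ∷ _ ∷ _ ∷ _ ∷ []) (κ 1 ⊕ (κ 1 ⊕ # 2) ≼ κ 1 ⊕ # 0) 1 (1 ⇐ # 0 ⊕ (κ 1 ⊕ (κ 1 ⊕ # 1)) ≈ κ 1 ⊕ # 2 ⊕ # 3 ∋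
            m∸n+n≡m K≤ ∷ 1 × κ 1 ⊕ (κ 1 ⊕ # 1) ≼ # 4 ∋ K≤d ∷ 1 × # 4 ≼ # 3 ∋ d≤n ∷ [])
        lst : IsLabel n st
        lst = s≤s z≤n , linear (_ ∷ _ ∷ _ ∷ _ ∷ []) (κ 1 ⊕ # 0 ≼ # 3) 1 (1 ⇒ # 0 ⊕ (κ 1 ⊕ (κ 1 ⊕ # 1)) ≈ κ 1 ⊕ # 2 ⊕ # 3 ∋ m∸n+n≡m K≤ ∷
            1 × κ 1 ⊕ (κ 1 ⊕ # 2) ≼ κ 1 ⊕ (κ 1 ⊕ # 1) ∋ ≰⇒> K≰i ∷ [])
        window : ∀ {y} → IsLabel n y → relOf P i y ≡ true → ∃ λ o → o < d × Congruent y (st + o)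
        window {y} ly Ry = lk y ∸ 1 , linear (_ ∷ _ ∷ _ ∷ []) (κ 1 ⊕ # 0 ≼ # 2) 1 (1 ⇒ # 0 ⊕ κ 1 ≈ # 1 ∋ m∸n+n≡m 1≤ly ∷ 1 × # 1 ≼ # 2 ∋
            leftDist≤ u (y + n) ∷ []) ,
          Congruent-cancel K (Congruent-trans (subst (λ z → Congruent (y + z) (i + lk y)) e (proj₂ c))
              (Congruent-wrap {i + lk y} {st + (lk y ∸ 1) + K} (linear≡ (lk y ∸ 1 ∷ _ ∷ i + n ∸ K ∷ k ∷ f ∷ n ∷ [])
              (κ 1 ⊕ # 4 ⊕ # 1 ⊕ # 5 ≈ κ 1 ⊕ # 2 ⊕ # 0 ⊕ (κ 1 ⊕ (κ 1 ⊕ # 3))) 1 (1 ⇐ # 0 ⊕ κ 1 ≈ # 1 ∋ m∸n+n≡m 1≤ly ∷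
              1 ⇐ # 2 ⊕ (κ 1 ⊕ (κ 1 ⊕ # 3)) ≈ κ 1 ⊕ # 4 ⊕ # 5 ∋ m∸n+n≡m K≤ ∷ []))))
          where
          c = lc-Congruent {i} {y} (λ z → 1+n≢0 (trans (sym e) z)) (relP⇒ li ly Ry)
          1≤ly : 1 ≤ lk y
          1≤ly = proj₁ c

  module QEntry {f : ℕ} (f<d : f < d) where

    i : ℕ
    i = n ∸ d + suc f

    i≡ : i + d ≡ suc f + n
    i≡ = linear≡ (n ∸ d ∷ d ∷ _ ∷ f ∷ []) (# 0 ⊕ (κ 1 ⊕ # 3) ⊕ # 1 ≈ κ 1 ⊕ # 3 ⊕ # 2) 1 (1 ⇒ # 0 ⊕ # 1 ≈ # 2 ∋ m∸n+n≡m d≤n ∷ [])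

    li : IsLabel n i
    li = linear (n ∸ d ∷ f ∷ _ ∷ _ ∷ []) (κ 1 ≼ # 0 ⊕ (κ 1 ⊕ # 1)) 1 (1 ⇐ # 0 ⊕ (κ 1 ⊕ # 1) ⊕ # 2 ≈ κ 1 ⊕ # 1 ⊕ # 3 ∋ i≡ ∷ 1 × # 2 ≼ # 3 ∋
        d≤n ∷ []) , linear (n ∸ d ∷ _ ∷ _ ∷ _ ∷ []) (# 0 ⊕ (κ 1 ⊕ # 1) ≼ # 3) 1 (1 ⇒ # 0 ⊕ (κ 1 ⊕ # 1) ⊕ # 2 ≈ κ 1 ⊕ # 1 ⊕ # 3 ∋ i≡ ∷
        1 × κ 1 ⊕ # 1 ≼ # 2 ∋ f<d ∷ [])

    open Windows d m n n≡md 1≤d 2≤m 2d≤n (relOf Q) li (⇒relQ li li refl)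
    open Blocks n d (relOf Q) using (ncnw)

    u-f : u (i + n + 0) ≡ u (suc f)
    u-f = trans (cong u (+-identityʳ (i + n))) (trans (periodic-n per i) (trans (sym (per i)) (trans (cong u i≡) (periodic-n per (suc f)))))

    small : a * 1 ≤ suc n * fwd u (i + n) 1 → (suc n * u (suc f) <ᵇ a) ≡ false
    small h = ≤⇒<ᵇ≡false (subst₂ _≤_ (*-identityʳ a) (cong (suc n *_) u-f) h)

    -- The mirror image of the entry for P, with maxima in place of minima: at distance 1 the window
    -- of length `d` ends at `i`, at distance `K ≥ 2` it ends at `i + K - 1`, cyclically.
    entry : (if (maxBlock n (relOf Q) i ≡ᵇ i) ∧ ncnw i then rankOf Q i else 0) ≡ (if suc n * u (suc f) <ᵇ a then u (suc f) else 0)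
    entry with rightView u (i + n)
    ... | none h e = trans (if-false (trans (cong ((maxBlock n (relOf Q) i ≡ᵇ i) ∧_) noncentral) (∧-zeroʳ _)))
                           (sym (if-false (small (h 1 ≤-refl 1≤d))))
      where
      noncentral : ncnw i ≡ false
      noncentral = central-block
        (λ {z} lz Rz → ⇒relQ li (rotk-label d lz) (trans (relQ⇒ li lz Rz) (trans (rc-0 (zero-of lz Rz)) (sym (rc-0 (trans (rk-rotd z) (zero-of lz Rz)))))))
        (λ {z} lz Rz → let (y , ly , ry) = rotd-onto lz in y , ly ,
           ⇒relQ li ly (trans (rc-0 {i} e) (sym (rc-0 {y} (trans (sym (rk-rotd y)) (trans (cong rk ry) (zero-of lz Rz)))))) , ry)
        where
        zero-of : ∀ {z} → IsLabel n z → relOf Q i z ≡ true → rk z ≡ 0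
        zero-of lz Rz = rc-0⁻¹ (trans (sym (relQ⇒ li lz Rz)) (rc-0 {i} e))
    ... | found (suc zero) _ _ t _ e = trans (if-true (∧-intro (≡⇒≡ᵇ≡true max≡i) (straight-block st inside)))
        (trans rank (sym (if-true (<⇒<ᵇ≡true (subst₂ _<_ (cong (suc n *_) u-f) (*-identityʳ a) t)))))
      where
      st = suc i ∸ d
      d≤i : d ≤ suc i
      d≤i = linear (n ∸ d ∷ f ∷ _ ∷ _ ∷ []) (# 2 ≼ κ 1 ⊕ (# 0 ⊕ (κ 1 ⊕ # 1))) 1 (1 ⇐ # 0 ⊕ (κ 1 ⊕ # 1) ⊕ # 2 ≈ κ 1 ⊕ # 1 ⊕ # 3 ∋ i≡ ∷
          1 × # 2 ⊕ # 2 ≼ # 3 ∋ 2d≤n ∷ [])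
      below : ∀ {y} → IsLabel n y → relOf Q i y ≡ true → 1 ≤ rk y × y + rk y ≡ i + 1
      below {y} ly Ry = 1≤ry , Congruent-close (subst (λ z → Congruent (y + rk y) (i + z)) e (proj₂ c))
          (linear (_ ∷ _ ∷ _ ∷ _ ∷ n ∸ d ∷ f ∷ []) (κ 1 ⊕ (# 0 ⊕ # 2) ≼ # 4 ⊕ (κ 1 ⊕ # 5) ⊕ κ 1 ⊕ # 1) 1 (1 × # 0 ≼ # 1 ∋ proj₂ ly ∷
              1 × # 2 ≼ # 3 ∋ rightDist≤ u (y + n) ∷ 1 ⇐ # 4 ⊕ (κ 1 ⊕ # 5) ⊕ # 3 ≈ κ 1 ⊕ # 5 ⊕ # 1 ∋ i≡ ∷ 1 × # 3 ⊕ # 3 ≼ # 1 ∋ 2d≤n ∷ []))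
              (linear (_ ∷ _ ∷ n ∸ d ∷ f ∷ _ ∷ []) (κ 1 ⊕ (# 2 ⊕ (κ 1 ⊕ # 3) ⊕ κ 1) ≼ # 1 ⊕ # 0 ⊕ # 4) 1 (1 × κ 1 ≼ # 0 ∋ 1≤ry ∷
              1 × κ 1 ≼ # 1 ∋ proj₁ ly ∷ 1 × # 2 ⊕ (κ 1 ⊕ # 3) ≼ # 4 ∋ proj₂ li ∷ []))
        where
        c = rc-Congruent {i} {y} (λ z → 1+n≢0 (trans (sym e) z)) (relQ⇒ li ly Ry)
        1≤ry : 1 ≤ rk y
        1≤ry = proj₁ c
      inside : ∀ {y} → IsLabel n y → relOf Q i y ≡ true → st ≤ y × y < st + d
      inside {y} ly Ry = linear (_ ∷ _ ∷ n ∸ d ∷ f ∷ _ ∷ _ ∷ []) (# 0 ≼ # 4) 1 (1 ⇒ # 0 ⊕ # 1 ≈ κ 1 ⊕ (# 2 ⊕ (κ 1 ⊕ # 3)) ∋ m∸n+n≡m d≤i ∷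
          1 ⇐ # 4 ⊕ # 5 ≈ # 2 ⊕ (κ 1 ⊕ # 3) ⊕ κ 1 ∋ proj₂ (below ly Ry) ∷ 1 × # 5 ≼ # 1 ∋ rightDist≤ u (y + n) ∷ []) , linear (suc i ∸ d ∷
          d ∷ n ∸ d ∷ f ∷ _ ∷ _ ∷ []) (κ 1 ⊕ # 4 ≼ # 0 ⊕ # 1) 1 (1 ⇐ # 0 ⊕ # 1 ≈ κ 1 ⊕ (# 2 ⊕ (κ 1 ⊕ # 3)) ∋ m∸n+n≡m d≤i ∷
          1 ⇒ # 4 ⊕ # 5 ≈ # 2 ⊕ (κ 1 ⊕ # 3) ⊕ κ 1 ∋ proj₂ (below ly Ry) ∷ 1 × κ 1 ≼ # 5 ∋ proj₁ (below ly Ry) ∷ [])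
      max≤i : ∀ {y} → IsLabel n y → relOf Q i y ≡ true → y ≤ i
      max≤i ly Ry = linear (_ ∷ _ ∷ n ∸ d ∷ f ∷ []) (# 0 ≼ # 2 ⊕ (κ 1 ⊕ # 3)) 1 (1 ⇒ # 0 ⊕ # 1 ≈ # 2 ⊕ (κ 1 ⊕ # 3) ⊕ κ 1 ∋
          proj₂ (below ly Ry) ∷ 1 × κ 1 ≼ # 1 ∋ proj₁ (below ly Ry) ∷ [])
      max≡i : maxBlock n (relOf Q) i ≡ i
      max≡i = ≤-antisym (max≤i (proj₁ maxBlock-spec) (proj₁ (proj₂ maxBlock-spec))) (proj₂ (proj₂ maxBlock-spec) li (⇒relQ li li refl))
      rank : rankOf Q i ≡ u (suc f)
      rank = trans (rankOf-fromFun n (λ i j → rc i ≡ᵇ rc j) (λ i → weight u (rc i)) li)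
        (trans (cong (λ k → weight u (centre k (i + n + k ∸ 1))) e) (trans (weight-% per (i + n + 1 ∸ 1)) (trans (cong u (trans (m+n∸n≡m (i + n) 1) (sym (+-identityʳ (i + n))))) u-f)))
    ... | found (suc (suc k)) _ k≤d t before e = trans (if-false (position (i + suc k ≤? n))) (sym (if-false (small (before 1 ≤-refl (s≤s (s≤s z≤n))))))
      where
      K = suc (suc k)
      2≤K : 2 ≤ K
      2≤K = s≤s (s≤s z≤n)
      K≤d : K ≤ d
      K≤d = k≤d
      down : suc n * u (i + n + suc k) < a
      down = linear (_ ∷ _ ∷ _ ∷ _ ∷ _ ∷ _ ∷ []) (κ 1 ⊕ # 5 ≼ # 4) 1 (1 × κ 1 ⊕ # 0 ≼ # 1 ∋ t ∷ 1 × # 2 ≼ # 3 ∋ before (suc k)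
          (s≤s z≤n) ≤-refl ∷ 1 ⇒ # 1 ≈ # 4 ⊕ # 2 ∋ *-suc a (suc k) ∷ 1 ⇐ # 0 ≈ # 3 ⊕ # 5 ∋ expand ∷ [])
        where
        expand : suc n * fwd u (i + n) K ≡ suc n * fwd u (i + n) (suc k) + suc n * u (i + n + suc k)
        expand = *-distribˡ-+ (suc n) (fwd u (i + n) (suc k)) (u (i + n + suc k))
      last : ∀ {x} → IsLabel n x → Congruent (x + n) (i + n + suc k) → relOf Q i x ≡ true
      last {x} lx c = ⇒relQ li lx (trans (cong (λ k → centre k (i + n + k ∸ 1)) e)
          (sym (trans (cong (λ k → centre k (x + n + k ∸ 1)) rk≡1) (Congruent⇒% close))))
        where
        rk≡1 : rk x ≡ 1
        rk≡1 = trans (rightDist-Congruent c) (rightDist-1 down)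
        close : Congruent (x + n + 1 ∸ 1) (i + n + K ∸ 1)
        close = Congruent-trans (Congruent-≡ (m+n∸n≡m (x + n) 1)) (Congruent-trans c (Congruent-≡ (sym (cong (_∸ 1) (+-suc (i + n) (suc k))))))
      position : Dec (i + suc k ≤ n) → ((maxBlock n (relOf Q) i ≡ᵇ i) ∧ ncnw i) ≡ false
      position (yes x≤n) = cong (_∧ ncnw i) (≢⇒≡ᵇ≡false λ eq → <⇒≱ (m<m+n i (s≤s z≤n)) (≤-trans (proj₂ (proj₂ maxBlock-spec) lx (last lx (Congruent-≡ (+-right-comm i (suc k) n)))) (≤-reflexive eq)))
        where
        lx : IsLabel n (i + suc k)
        lx = linear (n ∸ d ∷ f ∷ _ ∷ []) (κ 1 ≼ # 0 ⊕ (κ 1 ⊕ # 1) ⊕ (κ 1 ⊕ # 2)) 1 (1 × κ 1 ≼ # 0 ⊕ (κ 1 ⊕ # 1) ∋ proj₁ li ∷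
            1 × κ 1 ≼ κ 1 ⊕ (κ 1 ⊕ # 2) ∋ s≤s z≤n ∷ []) , x≤n
      position (no x≰n) = trans (cong ((maxBlock n (relOf Q) i ≡ᵇ i) ∧_)
          (wrapped-block st window lx li (last lx (Congruent-wrap {x + n} {i + n + suc k} (linear≡ (x ∷ n ∷ n ∸ d ∷ f ∷ k ∷ [])
          (# 0 ⊕ # 1 ⊕ # 1 ≈ # 2 ⊕ (κ 1 ⊕ # 3) ⊕ # 1 ⊕ (κ 1 ⊕ # 4)) 1 (1 ⇒ # 0 ⊕ # 1 ≈ # 2 ⊕ (κ 1 ⊕ # 3) ⊕ (κ 1 ⊕ # 4) ∋ x≡ ∷ []))))
          (⇒relQ li li refl) x<st st≤i)) (∧-zeroʳ _)
        where
        -- The last label of the cyclic block, `i + suc k`, has passed `n` and reappears as `x`; the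
        -- window ending there starts at `st` below.
        x = i + suc k ∸ n
        x≡ : x + n ≡ i + suc k
        x≡ = m∸n+n≡m (<⇒≤ (≰⇒> x≰n))
        lx : IsLabel n x
        lx = linear (_ ∷ _ ∷ n ∸ d ∷ f ∷ k ∷ []) (κ 1 ≼ # 0) 1 (1 ⇐ # 0 ⊕ # 1 ≈ # 2 ⊕ (κ 1 ⊕ # 3) ⊕ (κ 1 ⊕ # 4) ∋ x≡ ∷
            1 × κ 1 ⊕ # 1 ≼ # 2 ⊕ (κ 1 ⊕ # 3) ⊕ (κ 1 ⊕ # 4) ∋ ≰⇒> x≰n ∷ []) , linear (_ ∷ _ ∷ n ∸ d ∷ f ∷ _ ∷ _ ∷ [])
            (# 0 ≼ # 1) 1 (1 ⇒ # 0 ⊕ # 1 ≈ # 2 ⊕ (κ 1 ⊕ # 3) ⊕ (κ 1 ⊕ # 4) ∋ x≡ ∷ 1 × κ 1 ⊕ (κ 1 ⊕ # 4) ≼ # 5 ∋ K≤d ∷ 1 × # 5 ≼ # 1 ∋ d≤n ∷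
            1 × # 2 ⊕ (κ 1 ⊕ # 3) ≼ # 1 ∋ proj₂ li ∷ [])
        st = i + K ∸ d
        st≡ : st + d ≡ i + K
        st≡ = m∸n+n≡m {i + K} {d} (linear (n ∸ d ∷ f ∷ _ ∷ _ ∷ _ ∷ [])
            (# 2 ≼ # 0 ⊕ (κ 1 ⊕ # 1) ⊕ (κ 1 ⊕ (κ 1 ⊕ # 4))) 1 (1 ⇐ # 0 ⊕ (κ 1 ⊕ # 1) ⊕ # 2 ≈ κ 1 ⊕ # 1 ⊕ # 3 ∋ i≡ ∷ 1 × # 2 ⊕ # 2 ≼ # 3 ∋
            2d≤n ∷ 1 × κ 1 ≼ κ 1 ⊕ (κ 1 ⊕ # 4) ∋ s≤s z≤n ∷ []))
        x<st : x < st
        x<st = linear (_ ∷ _ ∷ n ∸ d ∷ f ∷ k ∷ _ ∷ _ ∷ []) (κ 1 ⊕ # 5 ≼ # 0) 1 (1 ⇐ # 0 ⊕ # 1 ≈ # 2 ⊕ (κ 1 ⊕ # 3) ⊕ (κ 1 ⊕ (κ 1 ⊕ # 4)) ∋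
            st≡ ∷ 1 ⇒ # 5 ⊕ # 6 ≈ # 2 ⊕ (κ 1 ⊕ # 3) ⊕ (κ 1 ⊕ # 4) ∋ x≡ ∷ 1 × # 1 ≼ # 6 ∋ d≤n ∷ [])
        st≤i : st ≤ i
        st≤i = linear (_ ∷ _ ∷ n ∸ d ∷ f ∷ _ ∷ []) (# 0 ≼ # 2 ⊕ (κ 1 ⊕ # 3)) 1 (1 ⇒ # 0 ⊕ # 1 ≈ # 2 ⊕ (κ 1 ⊕ # 3) ⊕ (κ 1 ⊕ (κ 1 ⊕ # 4)) ∋
            st≡ ∷ 1 × κ 1 ⊕ (κ 1 ⊕ # 4) ≼ # 1 ∋ K≤d ∷ [])
        window : ∀ {y} → IsLabel n y → relOf Q i y ≡ true → ∃ λ o → o < d × Congruent y (st + o)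
        window {y} ly Ry = d ∸ rk y , linear (_ ∷ _ ∷ _ ∷ []) (κ 1 ⊕ # 0 ≼ # 2) 1 (1 ⇒ # 0 ⊕ # 1 ≈ # 2 ∋ m∸n+n≡m r≤d ∷ 1 × κ 1 ≼ # 1 ∋ 1≤ry ∷ []) ,
          Congruent-cancel (rk y) (Congruent-trans (subst (λ z → Congruent (y + rk y) (i + z)) e (proj₂ c))
              (Congruent-≡ {i + K} {st + (d ∸ rk y) + rk y} (linear≡ (d ∸ rk y ∷ rk y ∷ _ ∷ st ∷ n ∸ d ∷ f ∷ k ∷ [])
              (# 4 ⊕ (κ 1 ⊕ # 5) ⊕ (κ 1 ⊕ (κ 1 ⊕ # 6)) ≈ # 3 ⊕ # 0 ⊕ # 1) 1 (1 ⇐ # 0 ⊕ # 1 ≈ # 2 ∋ m∸n+n≡m r≤d ∷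
              1 ⇐ # 3 ⊕ # 2 ≈ # 4 ⊕ (κ 1 ⊕ # 5) ⊕ (κ 1 ⊕ (κ 1 ⊕ # 6)) ∋ st≡ ∷ []))))
          where
          c = rc-Congruent {i} {y} (λ z → 1+n≢0 (trans (sym e) z)) (relQ⇒ li ly Ry)
          1≤ry : 1 ≤ rk y
          1≤ry = proj₁ c
          r≤d : rk y ≤ d
          r≤d = rightDist≤ u (y + n)

  S-cyclicPair : S d (cyclicPair u) ≡ decode a (suc n) d u
  S-cyclicPair = cong₂ _,_ (tabulate-cong (λ f → PEntry.entry (toℕ<n f))) (tabulate-cong (λ f → QEntry.entry (toℕ<n f)))

-- Comparison of a path with the cyclic walk it opens

sumUpTo-periods : ∀ {d u} → Periodic d u → ∀ m → sumUpTo (m * d) u ≡ m * sumUpTo d u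
sumUpTo-periods {d} {u} per zero    = refl
sumUpTo-periods {d} {u} per (suc m) = trans (sumUpTo-+ u d (m * d)) (cong (sumUpTo d u +_)
  (trans (sumUpTo-cong (m * d) (λ j _ → trans (cong u (+-comm d j)) (per j))) (sumUpTo-periods per m)))

fwd≡sumUpTo : ∀ u I k → fwd u I k ≡ sumUpTo k (shift I u)
fwd≡sumUpTo u I zero    = refl
fwd≡sumUpTo u I (suc k) = cong₂ _+_ (fwd≡sumUpTo u I k) (cong u (+-comm I k))

back-+ : ∀ u I k l → back u I (k + l) ≡ back u I k + back u (I ∸ k) l
back-+ u I k zero    = trans (cong (back u I) (+-identityʳ k)) (sym (+-identityʳ _))
back-+ u I k (suc l) = trans (cong (back u I) (+-suc k l))
  (trans (cong₂ _+_ (back-+ u I k l) (cong u (trans (cong (I ∸_) (sym (+-suc k l))) (sym (∸-+-assoc I k (suc l)))))) (+-assoc (back u I k) _ _))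

fwd-+ : ∀ u I k l → fwd u I (k + l) ≡ fwd u I k + fwd u (I + k) l
fwd-+ u I k zero    = trans (cong (fwd u I) (+-identityʳ k)) (sym (+-identityʳ _))
fwd-+ u I k (suc l) = trans (cong (fwd u I) (+-suc k l))
  (trans (cong₂ _+_ (fwd-+ u I k l) (cong u (sym (+-assoc I k l)))) (+-assoc (fwd u I k) _ _))

module Cut (a d m n : ℕ) (n≡md : n ≡ m * d) (1≤d : 1 ≤ d) (2≤m : 2 ≤ m) .{{nz : NonZero n}}
           (1≤a : 1 ≤ a) (coprime : Coprime a (suc n)) (2≤n : 2 ≤ n)
           (v : Vec ℕ (suc n)) (dyck : IsDyck a (suc n) v) {u : ℕ → ℕ} (per : Periodic d u) where

  open CyclicPair a d m n n≡md 1≤d 2≤m public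
  open DyckPath a n v dyck 1≤a coprime 2≤n public
  open Path a (suc n) v using (vv; hgt)

  period : ℕ
  period = sumUpTo d u

  fwd-period : ∀ I → fwd u I d ≡ period
  fwd-period I = trans (fwd≡sumUpTo u I d) (sumUpTo-shift per I)

  sum-n : sumUpTo n u ≡ m * period
  sum-n = trans (cong (λ z → sumUpTo z u) n≡md) (sumUpTo-periods per m)

  Agree : ℕ → ℕ → Set
  Agree lo hi = ∀ x → lo ≤ x → x < hi → vv x ≡ u x

  module Heights {lo hi : ℕ} (hi≤ : hi ≤ suc n) (agree : Agree lo hi) where

    H-step : ∀ x → lo ≤ x → x < hi → H (suc x) + a ≡ H x + suc n * u x
    H-step x lo≤x x<hi = trans (H-suc x (≤-pred (≤-trans x<hi hi≤))) (cong (λ z → H x + suc n * z) (agree x lo≤x x<hi))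

    H-fwd : ∀ i k → lo ≤ i → i + k ≤ hi → H i + suc n * fwd u i k ≡ H (i + k) + a * k
    H-fwd i zero    lo≤i _ = trans (cong (H i +_) (*-zeroʳ (suc n))) (trans (cong (λ z → H z + 0) (sym (+-identityʳ i))) (cong (H (i + 0) +_) (sym (*-zeroʳ a))))
    H-fwd i (suc k) lo≤i k<hi = subst (λ z → H i + suc n * fwd u i (suc k) ≡ H z + a * suc k) (sym (+-suc i k))
      (linear≡ (H i ∷ suc n * fwd u i k ∷ H (i + k) ∷ a * k ∷ H (suc (i + k)) ∷ a ∷ suc n * u (i + k) ∷ _ ∷ _ ∷ [])
          (# 0 ⊕ # 8 ≈ # 4 ⊕ # 7) 1 (1 ⇒ # 0 ⊕ # 1 ≈ # 2 ⊕ # 3 ∋ H-fwd i k lo≤i (<⇒≤ i+k<hi) ∷ 1 ⇐ # 4 ⊕ # 5 ≈ # 2 ⊕ # 6 ∋ H-step (i + k)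
          (≤-trans lo≤i (m≤m+n i k)) i+k<hi ∷ 1 ⇐ # 7 ≈ # 5 ⊕ # 3 ∋ *-suc a k ∷ 1 ⇒ # 8 ≈ # 1 ⊕ # 6 ∋ expand ∷ []))
      where
      i+k<hi : i + k < hi
      i+k<hi = subst (_≤ hi) (+-suc i k) k<hi
      expand : suc n * fwd u i (suc k) ≡ suc n * fwd u i k + suc n * u (i + k)
      expand = *-distribˡ-+ (suc n) (fwd u i k) (u (i + k))

    H-back : ∀ j k → k ≤ j → lo ≤ j ∸ k → j ≤ hi → H j + a * k ≡ H (j ∸ k) + suc n * back u j k
    H-back j zero    k≤j lo≤ j≤hi = cong (H j +_) (trans (*-zeroʳ a) (sym (*-zeroʳ (suc n))))
    H-back j (suc k) k<j lo≤ j≤hi =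
      linear≡ (H j ∷ a * k ∷ H (j ∸ k) ∷ suc n * back u j k ∷ a ∷ H (j ∸ suc k) ∷ suc n * u (j ∸ suc k) ∷ _ ∷ _ ∷ [])
          (# 0 ⊕ # 7 ≈ # 5 ⊕ # 8) 1 (1 ⇒ # 0 ⊕ # 1 ≈ # 2 ⊕ # 3 ∋ H-back j k (<⇒≤ k<j) (≤-trans lo≤ (∸-monoʳ-≤ j (n≤1+n k))) j≤hi ∷
          1 ⇒ # 2 ⊕ # 4 ≈ # 5 ⊕ # 6 ∋ one ∷ 1 ⇒ # 7 ≈ # 4 ⊕ # 1 ∋ *-suc a k ∷ 1 ⇐ # 8 ≈ # 3 ⊕ # 6 ∋ expand ∷ [])
      where
      eq : suc (j ∸ suc k) ≡ j ∸ k
      eq = sym (+-∸-assoc 1 k<j)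
      one : H (j ∸ k) + a ≡ H (j ∸ suc k) + suc n * u (j ∸ suc k)
      one = subst (λ z → H z + a ≡ H (j ∸ suc k) + suc n * u (j ∸ suc k)) eq
        (H-step (j ∸ suc k) lo≤ (≤-trans (≤-reflexive eq) (≤-trans (m∸n≤m j k) j≤hi)))
      expand : suc n * back u j (suc k) ≡ suc n * back u j k + suc n * u (j ∸ suc k)
      expand = *-distribˡ-+ (suc n) (back u j k) (u (j ∸ suc k))

  back-n : ∀ i k → k ≤ i → back u (i + n) k ≡ back u i k
  back-n i k k≤i = back-cong k λ j 1≤j j≤k → trans (cong u (move j (≤-trans j≤k k≤i))) (periodic-n per (i ∸ j))
    where
    move : ∀ j → j ≤ i → i + n ∸ j ≡ i ∸ j + n
    move j j≤i = trans (cong (_∸ j) (+-comm i n)) (trans (+-∸-assoc n j≤i) (+-comm n _))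

  fwd-n : ∀ i k → fwd u (i + n) k ≡ fwd u i k
  fwd-n i k = fwd-cong k λ j _ → trans (cong u (+-right-comm i n j)) (periodic-n per (i + j))

  module LeftAt {lo hi : ℕ} (hi≤ : hi ≤ suc n) (agree : Agree lo hi) where
    open Heights hi≤ agree

    leftDist-lf : ∀ {i} → IsLabel n i → i ≤ hi → lo ≤ lf i → i ≤ lf i + d → leftDist u (i + n) + lf i ≡ i
    leftDist-lf {i} l i≤hi lo≤ i≤ = trans (cong (_+ lf i) (firstFrom-found d 1 (leftTest u (i + n)) 0 {k}
        (linear (_ ∷ _ ∷ _ ∷ []) (κ 1 ≼ # 0) 1 (1 ⇐ # 0 ⊕ # 1 ≈ # 2 ∋ k≡ ∷ 1 × κ 1 ⊕ # 1 ≼ # 2 ∋ lf< l ∷ [])) (linear (_ ∷ lf i ∷ _ ∷ _ ∷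
            []) (κ 1 ⊕ # 0 ≼ κ 1 ⊕ # 3) 1 (1 ⇒ # 0 ⊕ # 1 ≈ # 2 ∋ k≡ ∷ 1 × # 2 ≼ # 1 ⊕ # 3 ∋ i≤ ∷ [])) (<⇒<ᵇ≡true here) before)) k≡
      where
      k = i ∸ lf i
      k≡ : k + lf i ≡ i
      k≡ = m∸n+n≡m (<⇒≤ (lf< l))
      here : a * k < suc n * back u (i + n) k
      here = linear (_ ∷ _ ∷ _ ∷ _ ∷ _ ∷ []) (κ 1 ⊕ # 2 ≼ # 4) 1 (1 × κ 1 ⊕ # 0 ≼ # 1 ∋ lf-lower l ∷ 1 ⇒ # 1 ⊕ # 2 ≈ # 0 ⊕ # 3 ∋ eq ∷
          1 ⇐ # 4 ≈ # 3 ∋ cong (suc n *_) (back-n i k (m∸n≤m i (lf i))) ∷ [])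
        where
        eq : H i + a * k ≡ H (lf i) + suc n * back u i k
        eq = subst (λ z → H i + a * k ≡ H z + suc n * back u i k) (m∸[m∸n]≡n (<⇒≤ (lf< l)))
          (H-back i k (m∸n≤m i (lf i)) (subst (lo ≤_) (sym (m∸[m∸n]≡n (<⇒≤ (lf< l)))) lo≤) i≤hi)
      before : ∀ j → 1 ≤ j → j < k → leftTest u (i + n) j ≡ false
      before j 1≤j j<k = ≤⇒<ᵇ≡false bound
        where
        j≤i : j ≤ i
        j≤i = linear (_ ∷ lf i ∷ _ ∷ _ ∷ []) (# 3 ≼ # 2) 1 (1 ⇒ # 0 ⊕ # 1 ≈ # 2 ∋ k≡ ∷ 1 × κ 1 ⊕ # 3 ≼ # 0 ∋ j<k ∷ [])
        s<x : lf i < i ∸ j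
        s<x = linear (_ ∷ _ ∷ _ ∷ _ ∷ _ ∷ []) (κ 1 ⊕ # 1 ≼ # 3) 1 (1 ⇒ # 0 ⊕ # 1 ≈ # 2 ∋ k≡ ∷ 1 ⇐ # 3 ⊕ # 4 ≈ # 2 ∋ m∸n+n≡m j≤i ∷
            1 × κ 1 ⊕ # 4 ≼ # 0 ∋ j<k ∷ [])
        x<i : i ∸ j < i
        x<i = linear (_ ∷ _ ∷ _ ∷ []) (κ 1 ⊕ # 0 ≼ # 2) 1 (1 ⇒ # 0 ⊕ # 1 ≈ # 2 ∋ m∸n+n≡m j≤i ∷ 1 × κ 1 ≼ # 1 ∋ 1≤j ∷ [])
        bound : suc n * back u (i + n) j ≤ a * j
        bound = linear (_ ∷ _ ∷ _ ∷ _ ∷ _ ∷ []) (# 4 ≼ # 2) 1 (1 × # 0 ≼ # 1 ∋ lf-high l (i ∸ j) s<x x<i ∷ 1 ⇐ # 0 ⊕ # 2 ≈ # 1 ⊕ # 3 ∋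
            H-back i j j≤i (≤-trans lo≤ (<⇒≤ s<x)) i≤hi ∷ 1 ⇒ # 4 ≈ # 3 ∋ cong (suc n *_) (back-n i j j≤i) ∷ [])

    rightDist-rt : ∀ {i} → IsLabel n i → lo ≤ i → suc (rt i) ≤ hi → rt i < i + d → rightDist u (i + n) + i ≡ suc (rt i)
    rightDist-rt {i} l lo≤i t<hi t< = trans (cong (_+ i) (firstFrom-found d 1 (rightTest u (i + n)) 0 {k}
        (linear (_ ∷ _ ∷ _ ∷ []) (κ 1 ≼ # 0) 1 (1 ⇐ # 0 ⊕ # 1 ≈ κ 1 ⊕ # 2 ∋ k≡ ∷ 1 × # 1 ≼ # 2 ∋ ≤rt l ∷ [])) (linear (_ ∷ i ∷ _ ∷ _ ∷ [])
            (κ 1 ⊕ # 0 ≼ κ 1 ⊕ # 3) 1 (1 ⇒ # 0 ⊕ # 1 ≈ κ 1 ⊕ # 2 ∋ k≡ ∷ 1 × κ 1 ⊕ # 2 ≼ # 1 ⊕ # 3 ∋ t< ∷ [])) (<⇒<ᵇ≡true here) before)) k≡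
      where
      k = suc (rt i) ∸ i
      k≡ : k + i ≡ suc (rt i)
      k≡ = m∸n+n≡m (m≤n⇒m≤1+n (≤rt l))
      here : suc n * fwd u (i + n) k < a * k
      here = linear (_ ∷ _ ∷ _ ∷ _ ∷ _ ∷ []) (κ 1 ⊕ # 4 ≼ # 3) 1 (1 × κ 1 ⊕ # 0 ≼ # 1 ∋ rt-lower l ∷ 1 ⇒ # 1 ⊕ # 2 ≈ # 0 ⊕ # 3 ∋ eq ∷
          1 ⇒ # 4 ≈ # 2 ∋ cong (suc n *_) (fwd-n i k) ∷ [])
        where
        eq : H i + suc n * fwd u i k ≡ H (suc (rt i)) + a * k
        eq = subst (λ z → H i + suc n * fwd u i k ≡ H z + a * k) (trans (+-comm i k) k≡)
          (H-fwd i k lo≤i (≤-trans (≤-reflexive (trans (+-comm i k) k≡)) t<hi))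
      before : ∀ j → 1 ≤ j → j < k → rightTest u (i + n) j ≡ false
      before j 1≤j j<k = ≤⇒<ᵇ≡false bound
        where
        j≤t : i + j ≤ rt i
        j≤t = linear (_ ∷ i ∷ _ ∷ _ ∷ []) (# 1 ⊕ # 3 ≼ # 2) 1 (1 ⇒ # 0 ⊕ # 1 ≈ κ 1 ⊕ # 2 ∋ k≡ ∷ 1 × κ 1 ⊕ # 3 ≼ # 0 ∋ j<k ∷ [])
        bound : a * j ≤ suc n * fwd u (i + n) j
        bound = linear (_ ∷ _ ∷ _ ∷ _ ∷ _ ∷ []) (# 3 ≼ # 4) 1 (1 × # 0 ≼ # 1 ∋ rt-high l (i + j) (m≤m+n i j) j≤t ∷
            1 ⇐ # 0 ⊕ # 2 ≈ # 1 ⊕ # 3 ∋ H-fwd i j lo≤i (≤-trans j≤t (<⇒≤ t<hi)) ∷ 1 ⇐ # 4 ≈ # 2 ∋ cong (suc n *_) (fwd-n i j) ∷ [])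

  code-lf : ∀ {i} → IsLabel n i → leftDist u (i + n) + lf i ≡ i → leftCode u (i + n) ≡ lf i
  code-lf {i} l h = trans (centre-≢0 λ e → <⇒≢ (lf< l) (trans (cong (_+ lf i) (sym e)) h))
    (trans (cong (_% n) move) (trans ([m+n]%n≡m%n (lf i) n) (m<n⇒m%n≡m (<-≤-trans (lf< l) (proj₂ l)))))
    where
    move : i + n ∸ leftDist u (i + n) ≡ lf i + n
    move = trans (cong (_∸ leftDist u (i + n)) (trans (cong (_+ n) (sym h)) (+-assoc (leftDist u (i + n)) (lf i) n))) (m+n∸m≡n (leftDist u (i + n)) (lf i + n))

  code-rt : ∀ {i} → IsLabel n i → rightDist u (i + n) + i ≡ suc (rt i) → rightCode u (i + n) ≡ rt i % n
  code-rt {i} l h = trans (centre-≢0 λ e → <⇒≢ (s≤s (≤rt l)) (trans (cong (_+ i) (sym e)) h))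
    (trans (cong (_% n) move) ([m+n]%n≡m%n (rt i) n))
    where
    move : i + n + rightDist u (i + n) ∸ 1 ≡ rt i + n
    move = cong (_∸ 1) {i + n + rightDist u (i + n)} {suc (rt i) + n} (linear≡ (rightDist u (i + n) ∷ i ∷ _ ∷ n ∷ [])
        (# 1 ⊕ # 3 ⊕ # 0 ≈ κ 1 ⊕ # 2 ⊕ # 3) 1 (1 ⇒ # 0 ⊕ # 1 ≈ κ 1 ⊕ # 2 ∋ h ∷ []))

  -- The cut at a label of a central block of P: vertex 0 is the central block.
  module CutLeft (agree : Agree 1 (suc n)) where
    open Heights ≤-refl agree
    open LeftAt ≤-refl agree

    sum-tail : ∀ k → k ≤ n → hgt (suc k) ≡ vv 0 + sumUpTo k (shift 1 u)
    sum-tail zero    _   = sym (+-identityʳ (vv 0))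
    sum-tail (suc k) k<n = trans (cong₂ _+_ (sum-tail k (<⇒≤ k<n)) (trans (agree (suc k) (s≤s z≤n) (s≤s k<n)) (cong u (+-comm 1 k)))) (+-assoc (vv 0) _ _)

    total : a ≡ vv 0 + sumUpTo n u
    total = trans (sym (proj₁ dyck)) (trans (sum-tail n ≤-refl) (cong (vv 0 +_) (sumUpTo-shift (periodic-n per) 1)))

    weight-centre : weight u n ≡ vv 0
    weight-centre = trans (weight-n u) (trans (cong (_∸ sumUpTo n u) total) (m+n∸n≡m (vv 0) (sumUpTo n u)))

    -- On the `n` steps where path and walk agree, the path falls from `H 1 > 0` to `H (suc n) = 0`.
    -- This is `m` times the change over one period.
    descends : suc n * period < a * d
    descends = *-cancelˡ-< m _ _ (subst₂ _<_ lhs rhs (linear (_ ∷ _ ∷ _ ∷ _ ∷ []) (κ 1 ⊕ # 1 ≼ # 3) 1 (1 ⇒ # 0 ⊕ # 1 ≈ # 2 ⊕ # 3 ∋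
        H-fwd 1 n ≤-refl ≤-refl ∷ 1 ⇒ # 2 ≈ κ 0 ∋ end ∷ 1 × κ 1 ≼ # 0 ∋ positive {1} (≤-refl , <⇒≤ 2≤n) ∷ [])))
      where
      lhs : suc n * fwd u 1 n ≡ m * (suc n * period)
      lhs = trans (cong (suc n *_) (trans (fwd≡sumUpTo u 1 n) (trans (sumUpTo-shift (periodic-n per) 1) sum-n)))
        (trans (sym (*-assoc (suc n) m period)) (trans (cong (_* period) (*-comm (suc n) m)) (*-assoc m (suc n) period)))
      rhs : a * n ≡ m * (a * d)
      rhs = trans (cong (a *_) n≡md) (trans (sym (*-assoc a m d)) (trans (cong (_* d) (*-comm a m)) (*-assoc m a d)))

    H-drop : ∀ i → 1 ≤ i → i + d ≤ suc n → H (i + d) < H i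
    H-drop i 1≤i i+d≤ = linear (_ ∷ _ ∷ _ ∷ _ ∷ _ ∷ []) (κ 1 ⊕ # 2 ≼ # 0) 1 (1 ⇐ # 0 ⊕ # 1 ≈ # 2 ⊕ # 3 ∋ H-fwd i d 1≤i i+d≤ ∷
        1 ⇒ # 1 ≈ # 4 ∋ cong (suc n *_) (fwd-period i) ∷ 1 × κ 1 ⊕ # 4 ≼ # 3 ∋ descends ∷ [])

    -- The position `lf i + d` is even lower than `lf i`, so it cannot lie between `lf i` and `i`.
    -- The argument needs `lf i` on the agreeing stretch, which starts at 1.
    lf-close : ∀ {i} → IsLabel n i → 1 ≤ lf i → i ≤ lf i + d
    lf-close {i} l 1≤s = ≮⇒≥ {lf i + d} {i} λ s+d<i → <⇒≱ (<-trans (H-drop (lf i) 1≤s (linear (_ ∷ _ ∷ lf i ∷ d ∷ [])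
        (# 2 ⊕ # 3 ≼ κ 1 ⊕ # 1) 1 (1 × # 0 ≼ # 1 ∋ proj₂ l ∷ 1 × κ 1 ⊕ (# 2 ⊕ # 3) ≼ # 0 ∋ s+d<i ∷ []))) (lf-lower l))
      (lf-high l (lf i + d) (linear (_ ∷ _ ∷ []) (κ 1 ⊕ # 1 ≼ # 1 ⊕ # 0) 1 (1 × κ 1 ≼ # 0 ∋ 1≤d ∷ [])) s+d<i)

    rt-close : ∀ {i} → IsLabel n i → rt i < i + d
    rt-close {i} l = ≰⇒> {i + d} {rt i} λ i+d≤t → <⇒≱ (H-drop i (proj₁ l) (≤-trans i+d≤t (m≤n⇒m≤1+n (rt≤n l)))) (rt-high l (i + d) (m≤m+n i d) i+d≤t)

    -- To the left of position 1 the walk goes on where the path has ended. Position 1 is glued to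
    -- position `suc n` of the preceding copy; that is the lowest point of the copy, so looking
    -- further back within a period shows nothing lower, and position 1 itself is at least as high
    -- as `i`.
    leftDist-0 : ∀ {i} → IsLabel n i → lf i ≡ 0 → leftDist u (i + n) ≡ 0
    leftDist-0 {i} l@(1≤i , i≤n) lf≡0 = firstFrom-none d 1 (leftTest u (i + n)) 0 λ k 1≤k k≤d → ≤⇒<ᵇ≡false (bound k (≤-pred k≤d))
      where
      low : ∀ x → 1 ≤ x → x ≤ i → H i ≤ H x
      low x 1≤x x≤i with m≤n⇒m<n∨m≡n x≤i
      ... | inj₁ x<i  = lf-high l x (subst (_< x) (sym lf≡0) 1≤x) x<i
      ... | inj₂ refl = ≤-refl
      inner : ∀ k → k < i → suc n * back u (i + n) k ≤ a * k
      inner k k<i = linear (_ ∷ _ ∷ _ ∷ _ ∷ _ ∷ []) (# 4 ≼ # 1) 1 (1 ⇐ # 0 ⊕ # 1 ≈ # 2 ⊕ # 3 ∋ H-back i k (<⇒≤ k<i) (m<n⇒0<n∸m k<i)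
          (m≤n⇒m≤1+n i≤n) ∷ 1 × # 0 ≼ # 2 ∋ low (i ∸ k) (m<n⇒0<n∸m k<i) (m∸n≤m i k) ∷ 1 ⇒ # 4 ≈ # 3 ∋ cong (suc n *_)
          (back-n i k (<⇒≤ k<i)) ∷ [])
      tail : ∀ k → k ≤ n → suc n * back u (suc n) k ≤ a * k
      tail k k≤n = linear (_ ∷ _ ∷ H (suc n ∸ k) ∷ _ ∷ []) (# 3 ≼ # 1) 1 (1 ⇐ # 0 ⊕ # 1 ≈ # 2 ⊕ # 3 ∋ H-back (suc n) k (m≤n⇒m≤1+n k≤n)
          (m<n⇒0<n∸m (s≤s k≤n)) ≤-refl ∷ 1 ⇒ # 0 ≈ κ 0 ∋ end ∷ [])
      bound : ∀ k → k ≤ d → suc n * back u (i + n) k ≤ a * k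
      bound k k≤d = cases (k <? i)
        where
        cases : Dec (k < i) → suc n * back u (i + n) k ≤ a * k
        cases (yes k<i) = inner k k<i
        cases (no k≮i) = subst (λ z → suc n * back u (i + n) z ≤ a * z) k≡ sum≤
         where
         i≡ : i ∸ 1 + 1 ≡ i
         i≡ = m∸n+n≡m 1≤i
         i∸1<i : i ∸ 1 < i
         i∸1<i = linear (_ ∷ _ ∷ []) (κ 1 ⊕ # 0 ≼ # 1) 1 (1 ⇒ # 0 ⊕ κ 1 ≈ # 1 ∋ i≡ ∷ [])
         k≡ : (i ∸ 1) + (k ∸ (i ∸ 1)) ≡ k
         k≡ = m+[n∸m]≡n {i ∸ 1} {k} (linear (_ ∷ _ ∷ _ ∷ []) (# 0 ≼ # 2) 1 (1 ⇒ # 0 ⊕ κ 1 ≈ # 1 ∋ i≡ ∷ 1 × # 1 ≼ # 2 ∋ ≮⇒≥ k≮i ∷ []))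
         position : i + n ∸ (i ∸ 1) ≡ suc n
         position = trans (cong (_∸ (i ∸ 1)) {i + n} {i ∸ 1 + suc n} (linear≡ (i ∸ 1 ∷ _ ∷ n ∷ [])
             (# 1 ⊕ # 2 ≈ # 0 ⊕ (κ 1 ⊕ # 2)) 1 (1 ⇐ # 0 ⊕ κ 1 ≈ # 1 ∋ i≡ ∷ []))) (m+n∸m≡n (i ∸ 1) (suc n))
         split : suc n * back u (i + n) ((i ∸ 1) + (k ∸ (i ∸ 1))) ≡ suc n * back u (i + n) (i ∸ 1) + suc n * back u (suc n) (k ∸ (i ∸ 1))
         split = trans (cong (suc n *_) (trans (back-+ u (i + n) (i ∸ 1) (k ∸ (i ∸ 1))) (cong (λ z → back u (i + n) (i ∸ 1) + back u z (k ∸ (i ∸ 1))) position)))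
           (*-distribˡ-+ (suc n) (back u (i + n) (i ∸ 1)) (back u (suc n) (k ∸ (i ∸ 1))))
         sum≤ : suc n * back u (i + n) ((i ∸ 1) + (k ∸ (i ∸ 1))) ≤ a * ((i ∸ 1) + (k ∸ (i ∸ 1)))
         sum≤ = linear (_ ∷ _ ∷ _ ∷ _ ∷ _ ∷ _ ∷ []) (# 4 ≼ # 5) 1 (1 × # 0 ≼ # 1 ∋ inner (i ∸ 1) i∸1<i ∷ 1 × # 2 ≼ # 3 ∋ tail (k ∸ (i ∸ 1))
             (≤-trans (m∸n≤m k (i ∸ 1)) (≤-trans k≤d d≤n)) ∷ 1 ⇒ # 4 ≈ # 0 ⊕ # 2 ∋ split ∷ 1 ⇐ # 5 ≈ # 1 ⊕ # 3 ∋ *-distribˡ-+ a (i ∸ 1)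
             (k ∸ (i ∸ 1)) ∷ [])

    -- Vertex 0 is the deleted block and gets the code `n`, while the ordinary vertex `n` gets its
    -- residue 0.
    σ τ : ℕ → ℕ
    σ r = if r ≡ᵇ 0 then n else (r % n)
    τ r = if r ≡ᵇ n then 0 else if r ≡ᵇ 0 then n else r

    0<n : 0 < n
    0<n = <⇒≤ 2≤n

    n%n : n % n ≡ 0
    n%n = trans ([m+n]%n≡m%n 0 n) (m<n⇒m%n≡m 0<n)

    data Vertex : ℕ → Set where
      centre-vertex : Vertex 0
      inner-vertex  : ∀ {r} → 1 ≤ r → r < n → σ r ≡ r → Vertex r
      last-vertex   : σ n ≡ 0 → Vertex n

    vertex : ∀ {r} → r ≤ n → Vertex r
    vertex {zero}  _   = centre-vertex
    vertex {suc r} r<n with suc r ≟ n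
    ... | yes refl = last-vertex n%n
    ... | no ≢n    = inner-vertex (s≤s z≤n) (≤∧≢⇒< r<n ≢n) (m<n⇒m%n≡m (≤∧≢⇒< r<n ≢n))

    τσ : ∀ {r} → r ≤ n → τ (σ r) ≡ r
    τσ r≤n with vertex r≤n
    ... | centre-vertex            = if-true (≡⇒≡ᵇ≡true {n} refl)
    ... | inner-vertex 1≤r r<n e   = trans (cong τ e) (trans (if-false (≢⇒≡ᵇ≡false (<⇒≢ r<n))) (if-false (≢⇒≡ᵇ≡false λ z → <⇒≢ 1≤r (sym z))))
    ... | last-vertex e            = trans (cong τ e) (if-false (≢⇒≡ᵇ≡false (<⇒≢ 0<n)))

    weight-σ : ∀ {r} → r ≤ n → weight u (σ r) ≡ vv r
    weight-σ r≤n with vertex r≤n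
    ... | centre-vertex          = weight-centre
    ... | inner-vertex 1≤r r<n e = trans (cong (weight u) e) (trans (weight-< u r<n) (sym (agree _ 1≤r (m<n⇒m<1+n r<n))))
    ... | last-vertex e          = trans (cong (weight u) e) (trans (weight-< u 0<n) (trans (sym (periodic-n per 0)) (sym (agree n 0<n ≤-refl))))

    left : ∀ {i} → IsLabel n i → leftCode u (i + n) ≡ σ (lf i)
    left {i} l with lf i ≟ 0
    ... | yes e = trans (centre-0 (leftDist-0 l e)) (sym (cong σ e))
    ... | no ne = trans (code-lf l (leftDist-lf l (m≤n⇒m≤1+n (proj₂ l)) (n≢0⇒n>0 ne) (lf-close l (n≢0⇒n>0 ne))))
                        (sym (trans (if-false (≢⇒≡ᵇ≡false ne)) (m<n⇒m%n≡m (<-≤-trans (lf< l) (proj₂ l)))))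

    π≡cyclicPair : π a (suc n) v ≡ cyclicPair u
    π≡cyclicPair = trans π-coded (cong₂ _,_
      (coded-relabel n {lf} {λ i → leftCode u (i + n)} {vv} {weight u} σ τ (λ l → <⇒≤ (<-≤-trans (lf< l) (proj₂ l))) τσ weight-σ left)
      (coded-relabel n {rt} {λ i → rightCode u (i + n)} {vv} {weight u} σ τ rt≤n τσ weight-σ right))
      where
      right : ∀ {i} → IsLabel n i → rightCode u (i + n) ≡ σ (rt i)
      right {i} l = trans (code-rt l (rightDist-rt l (proj₁ l) (s≤s (rt≤n l)) (rt-close l))) (sym (if-false (≢⇒≡ᵇ≡false λ e → <⇒≢ (proj₁ (rt-label l)) (sym e))))

  -- The cut at a label of a central block of Q: vertex n is the central block.
  module CutRight (agree : Agree 0 n) where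
    open Heights (n≤1+n n) agree
    open LeftAt (n≤1+n n) agree

    total : a ≡ sumUpTo n u + vv n
    total = trans (sym (proj₁ dyck)) (cong (_+ vv n) (sumUpTo-cong n (λ k k<n → agree k z≤n k<n)))

    weight-centre : weight u n ≡ vv n
    weight-centre = trans (weight-n u) (trans (cong (_∸ sumUpTo n u) total) (m+n∸m≡n (sumUpTo n u) (vv n)))

    -- The mirror image of the descending case: the path climbs from `H 0 = 0` to `H n > 0` on the
    -- stretch where it agrees with the walk.
    ascends : a * d < suc n * period
    ascends = *-cancelˡ-< m _ _ (subst₂ _<_ rhs lhs (linear (_ ∷ _ ∷ _ ∷ _ ∷ []) (κ 1 ⊕ # 3 ≼ # 1) 1 (1 ⇐ # 0 ⊕ # 1 ≈ # 2 ⊕ # 3 ∋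
        H-fwd 0 n z≤n ≤-refl ∷ 1 ⇒ # 0 ≈ κ 0 ∋ start ∷ 1 × κ 1 ≼ # 2 ∋ positive {n} (<⇒≤ 2≤n , ≤-refl) ∷ [])))
      where
      lhs : suc n * fwd u 0 n ≡ m * (suc n * period)
      lhs = trans (cong (suc n *_) (trans (fwd≡sumUpTo u 0 n) (trans (sumUpTo-shift (periodic-n per) 0) sum-n)))
        (trans (sym (*-assoc (suc n) m period)) (trans (cong (_* period) (*-comm (suc n) m)) (*-assoc m (suc n) period)))
      rhs : a * n ≡ m * (a * d)
      rhs = trans (cong (a *_) n≡md) (trans (sym (*-assoc a m d)) (trans (cong (_* d) (*-comm a m)) (*-assoc m a d)))

    H-rise : ∀ i → i + d ≤ n → H i < H (i + d)
    H-rise i i+d≤ = linear (_ ∷ _ ∷ _ ∷ _ ∷ _ ∷ []) (κ 1 ⊕ # 0 ≼ # 2) 1 (1 ⇒ # 0 ⊕ # 1 ≈ # 2 ⊕ # 3 ∋ H-fwd i d z≤n i+d≤ ∷ 1 ⇐ # 1 ≈ # 4 ∋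
        cong (suc n *_) (fwd-period i) ∷ 1 × κ 1 ⊕ # 3 ≼ # 4 ∋ ascends ∷ [])

    H-rise′ : ∀ i → d ≤ i → i ≤ n → H (i ∸ d) < H i
    H-rise′ i d≤i i≤n = subst (λ z → H (i ∸ d) < H z) (m∸n+n≡m d≤i) (H-rise (i ∸ d) (≤-trans (≤-reflexive (m∸n+n≡m d≤i)) i≤n))

    lf-close : ∀ {i} → IsLabel n i → i ≤ lf i + d
    lf-close {i} l = ≮⇒≥ {lf i + d} {i} λ s+d<i → <⇒≱ (H-rise′ i (d≤ s+d<i) (proj₂ l))
      (lf-high l (i ∸ d) (linear (_ ∷ d ∷ _ ∷ _ ∷ []) (κ 1 ⊕ # 0 ≼ # 3) 1 (1 × κ 1 ⊕ (# 0 ⊕ # 1) ≼ # 2 ∋ s+d<i ∷ 1 ⇐ # 3 ⊕ # 1 ≈ # 2 ∋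
          m∸n+n≡m (d≤ s+d<i) ∷ [])) (linear (_ ∷ _ ∷ _ ∷ []) (κ 1 ⊕ # 0 ≼ # 2) 1 (1 ⇒ # 0 ⊕ # 1 ≈ # 2 ∋ m∸n+n≡m (d≤ s+d<i) ∷
          1 × κ 1 ≼ # 1 ∋ 1≤d ∷ [])))
      where
      d≤ : lf i + d < i → d ≤ i
      d≤ h = ≤-trans (m≤n+m d (lf i)) (<⇒≤ h)

    rt-close : ∀ {i} → IsLabel n i → rt i < n → rt i < i + d
    rt-close {i} l t<n = ≰⇒> {i + d} {rt i} λ i+d≤t → <⇒≱ (<-trans (H-rise′ (suc (rt i)) (d≤ i+d≤t) t<n) (rt-lower l))
      (rt-high l (suc (rt i) ∸ d) (linear (_ ∷ d ∷ _ ∷ _ ∷ []) (# 0 ≼ # 3) 1 (1 × # 0 ⊕ # 1 ≼ # 2 ∋ i+d≤t ∷ 1 ⇐ # 3 ⊕ # 1 ≈ κ 1 ⊕ # 2 ∋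
          m∸n+n≡m (d≤ i+d≤t) ∷ [])) (linear (_ ∷ _ ∷ _ ∷ []) (# 0 ≼ # 2) 1 (1 ⇒ # 0 ⊕ # 1 ≈ κ 1 ⊕ # 2 ∋ m∸n+n≡m (d≤ i+d≤t) ∷
          1 × κ 1 ≼ # 1 ∋ 1≤d ∷ [])))
      where
      d≤ : i + d ≤ rt i → d ≤ suc (rt i)
      d≤ h = ≤-trans (m≤n+m d i) (m≤n⇒m≤1+n h)

    -- Past position `n` the walk starts again from position 0 of the next copy. That is its lowest
    -- point there, and position `n` is at least as high as `i`.
    rightDist-0 : ∀ {i} → IsLabel n i → rt i ≡ n → rightDist u (i + n) ≡ 0
    rightDist-0 {i} l@(1≤i , i≤n) rt≡n = firstFrom-none d 1 (rightTest u (i + n)) 0 λ k 1≤k k≤d → ≤⇒<ᵇ≡false (bound k (≤-pred k≤d))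
      where
      low : ∀ x → i ≤ x → x ≤ n → H i ≤ H x
      low x i≤x x≤n = rt-high l x i≤x (subst (x ≤_) (sym rt≡n) x≤n)
      inner : ∀ k → i + k ≤ n → a * k ≤ suc n * fwd u (i + n) k
      inner k k≤ = linear (_ ∷ _ ∷ _ ∷ _ ∷ _ ∷ []) (# 3 ≼ # 4) 1 (1 ⇐ # 0 ⊕ # 1 ≈ # 2 ⊕ # 3 ∋ H-fwd i k z≤n k≤ ∷ 1 × # 0 ≼ # 2 ∋
          low (i + k) (m≤m+n i k) k≤ ∷ 1 ⇐ # 4 ≈ # 1 ∋ cong (suc n *_) (fwd-n i k) ∷ [])
      tail : ∀ k → k ≤ n → a * k ≤ suc n * fwd u (n + n) k
      tail k k≤n = linear (_ ∷ _ ∷ H (0 + k) ∷ _ ∷ _ ∷ []) (# 3 ≼ # 4) 1 (1 ⇐ # 0 ⊕ # 1 ≈ # 2 ⊕ # 3 ∋ H-fwd 0 k z≤n k≤n ∷ 1 ⇒ # 0 ≈ κ 0 ∋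
          start ∷ 1 ⇐ # 4 ≈ # 1 ∋ cong (suc n *_) (trans (fwd-n n k) (fwd-n 0 k)) ∷ [])
      bound : ∀ k → k ≤ d → a * k ≤ suc n * fwd u (i + n) k
      bound k k≤d = cases (i + k ≤? n)
        where
        cases : Dec (i + k ≤ n) → a * k ≤ suc n * fwd u (i + n) k
        cases (yes k≤) = inner k k≤
        cases (no k≰) = subst (λ z → a * z ≤ suc n * fwd u (i + n) z) k≡ sum≤
          where
          x = n ∸ i
          y = k ∸ x
          i+x≡ : i + x ≡ n
          i+x≡ = m+[n∸m]≡n i≤n
          k≡ : x + y ≡ k
          k≡ = m+[n∸m]≡n {x} {k} (linear (i ∷ _ ∷ _ ∷ _ ∷ []) (# 1 ≼ # 3) 1 (1 ⇒ # 0 ⊕ # 1 ≈ # 2 ∋ i+x≡ ∷ 1 × κ 1 ⊕ # 2 ≼ # 0 ⊕ # 3 ∋ ≰⇒> k≰ ∷ []))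
          split : suc n * fwd u (i + n) (x + y) ≡ suc n * fwd u (i + n) x + suc n * fwd u (n + n) y
          split = trans (cong (suc n *_) (trans (fwd-+ u (i + n) x y) (cong (λ z → fwd u (i + n) x + fwd u z y)
              (trans (+-right-comm i n x) (cong (_+ n) i+x≡)))))
            (*-distribˡ-+ (suc n) (fwd u (i + n) x) (fwd u (n + n) y))
          sum≤ : a * (x + y) ≤ suc n * fwd u (i + n) (x + y)
          sum≤ = linear (_ ∷ _ ∷ _ ∷ _ ∷ _ ∷ _ ∷ []) (# 5 ≼ # 4) 1 (1 × # 0 ≼ # 1 ∋ inner x (≤-reflexive i+x≡) ∷ 1 × # 2 ≼ # 3 ∋
              tail y (≤-trans (m∸n≤m k x) (≤-trans k≤d d≤n)) ∷ 1 ⇐ # 4 ≈ # 1 ⊕ # 3 ∋ split ∷ 1 ⇒ # 5 ≈ # 0 ⊕ # 2 ∋ *-distribˡ-+ a x y ∷ [])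

    weight-vertex : ∀ {r} → r ≤ n → weight u r ≡ vv r
    weight-vertex r≤n with m≤n⇒m<n∨m≡n r≤n
    ... | inj₁ r<n  = trans (weight-< u r<n) (sym (agree _ z≤n r<n))
    ... | inj₂ refl = weight-centre

    left : ∀ {i} → IsLabel n i → leftCode u (i + n) ≡ lf i
    left l = code-lf l (leftDist-lf l (proj₂ l) z≤n (lf-close l))

    right : ∀ {i} → IsLabel n i → rightCode u (i + n) ≡ rt i
    right {i} l with m≤n⇒m<n∨m≡n (rt≤n l)
    ... | inj₁ t<n = trans (code-rt l (rightDist-rt l z≤n t<n (rt-close l t<n))) (m<n⇒m%n≡m t<n)
    ... | inj₂ t≡n = trans (centre-0 (rightDist-0 l t≡n)) (sym t≡n)

    π≡cyclicPair : π a (suc n) v ≡ cyclicPair u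
    π≡cyclicPair = trans π-coded (cong₂ _,_
      (coded-relabel n {lf} {λ i → leftCode u (i + n)} {vv} {weight u} (λ r → r) (λ r → r) (λ l → <⇒≤ (<-≤-trans (lf< l) (proj₂ l))) (λ _ → refl) weight-vertex left)
      (coded-relabel n {rt} {λ i → rightCode u (i + n)} {vv} {weight u} (λ r → r) (λ r → r) rt≤n (λ _ → refl) weight-vertex right))

-- Dyck paths from periodic sequences

argmin : ∀ (g : ℕ → ℕ) lo len → ∃ λ k → lo ≤ k × k ≤ lo + len × (∀ x → lo ≤ x → x ≤ lo + len → g k ≤ g x)
argmin g lo zero = lo , ≤-refl , m≤m+n lo 0 , λ x lo≤x x≤ → ≤-reflexive (cong g (≤-antisym lo≤x (≤-trans x≤ (≤-reflexive (+-identityʳ lo)))))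
argmin g lo (suc len) with argmin g lo len
... | k , lo≤k , k≤ , least with g k ≤? g (lo + suc len)
...   | yes gk≤ = k , lo≤k , ≤-trans k≤ (+-monoʳ-≤ lo (n≤1+n len)) , λ x lo≤x x≤ → extend x lo≤x x≤ (x ≟ lo + suc len)
  where
  extend : ∀ x → lo ≤ x → x ≤ lo + suc len → Dec (x ≡ lo + suc len) → g k ≤ g x
  extend x lo≤x x≤ (yes refl) = gk≤
  extend x lo≤x x≤ (no ≢)     = least x lo≤x (≤-pred (≤-trans (≤∧≢⇒< x≤ ≢) (≤-reflexive (+-suc lo len))))
...   | no gk≰ = lo + suc len , m≤m+n lo (suc len) , ≤-refl , λ x lo≤x x≤ → extend x lo≤x x≤ (x ≟ lo + suc len)
  where
  extend : ∀ x → lo ≤ x → x ≤ lo + suc len → Dec (x ≡ lo + suc len) → g (lo + suc len) ≤ g x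
  extend x lo≤x x≤ (yes refl) = ≤-refl
  extend x lo≤x x≤ (no ≢)     = ≤-trans (<⇒≤ (≰⇒> gk≰)) (least x lo≤x (≤-pred (≤-trans (≤∧≢⇒< x≤ ≢) (≤-reflexive (+-suc lo len)))))

module Realize (a d m n : ℕ) (n≡md : n ≡ m * d) (1≤d : 1 ≤ d) (2≤m : 2 ≤ m) .{{nz : NonZero n}}
               (1≤a : 1 ≤ a) (coprime : Coprime a (suc n)) (2≤n : 2 ≤ n) where

  open CyclicPair a d m n n≡md 1≤d 2≤m

  cyclicPair-cong : ∀ {u u′} → (∀ I → u I ≡ u′ I) → cyclicPair u ≡ cyclicPair u′
  cyclicPair-cong {u} {u′} h = cong₂ _,_
    (coded-relabel n {λ i → leftCode u (i + n)} {λ i → leftCode u′ (i + n)} {weight u} {weight u′} (λ r → r) (λ r → r)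
      (λ {i} _ → code≤n (leftDist u (i + n)) _) (λ _ → refl) (λ {r} _ → same-weight r)
      (λ {i} _ → cong (λ k → centre k (i + n ∸ k)) (leftDist-cong λ j _ _ → sym (h (i + n ∸ j)))))
    (coded-relabel n {λ i → rightCode u (i + n)} {λ i → rightCode u′ (i + n)} {weight u} {weight u′} (λ r → r) (λ r → r)
      (λ {i} _ → code≤n (rightDist u (i + n)) _) (λ _ → refl) (λ {r} _ → same-weight r)
      (λ {i} _ → cong (λ k → centre k (i + n + k ∸ 1)) (rightDist-cong λ j _ → sym (h (i + n + j)))))
    where
    same-weight : ∀ r → weight u′ r ≡ weight u r
    same-weight r = cong₂ (λ x y → if r ≡ᵇ n then a ∸ x else y) (sumUpTo-cong n (λ k _ → sym (h k))) (sym (h r))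

  rotLPN-cyclicPair : ∀ {u} → Periodic d u → ∀ k → rotLPN k (cyclicPair u) ≡ cyclicPair (shift (k * pred n) u)
  rotLPN-cyclicPair {u} per zero    = cyclicPair-cong (λ I → cong u (sym (+-identityʳ I)))
  rotLPN-cyclicPair {u} per (suc k) = trans (cong rotLP (rotLPN-cyclicPair per k))
    (trans (rot-cyclicPair (Periodic-shift (k * pred n) per)) (cyclicPair-cong λ I → cong u (+-assoc I (pred n) (k * pred n))))

  unshift : ∀ {u} → Periodic d u → ∀ k I → shift (k * pred n) (shift k u) I ≡ u I
  unshift {u} per k I = trans (cong u (trans (+-assoc I (k * pred n) k) (cong (I +_) whole))) (Periodic-* (periodic-n per) k I)
    where
    whole : k * pred n + k ≡ k * n
    whole = trans (+-comm (k * pred n) k) (trans (sym (*-suc k (pred n))) (cong (k *_) suc-pred-n))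

  NC-rotLPN : ∀ k {x} → NC a (suc n) x → NC a (suc n) (rotLPN k x)
  NC-rotLPN zero    h = h
  NC-rotLPN (suc k) h = NC-rot a n 1≤a coprime 2≤n (NC-rotLPN k h)

  -- Each rotation shifts the sequence back by one, so `k` rotations undo `shift k` up to a multiple
  -- of the period.
  NC-unshift : ∀ {u} → Periodic d u → ∀ k → NC a (suc n) (cyclicPair (shift k u)) → NC a (suc n) (cyclicPair u)
  NC-unshift {u} per k h = subst (NC a (suc n))
    (trans (rotLPN-cyclicPair (Periodic-shift k per) k) (cyclicPair-cong (unshift per k))) (NC-rotLPN k h)

  module Realizing {u : ℕ → ℕ} (per : Periodic d u) (light : sumUpTo d u * n ≤ a * d) where

    period : ℕ
    period = sumUpTo d u

    -- `g x` is the height of the walk after `x` steps, raised by the constant `a * (suc n + d)` so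
    -- that it stays a natural number for all positions up to `suc n + d`.
    U g : ℕ → ℕ
    U x = sumUpTo x u
    g x = suc n * U x + a * (suc n + d ∸ x)

    g-eq : ∀ x → x ≤ suc n + d → g x + a * x ≡ suc n * U x + a * (suc n + d)
    g-eq x x≤ = trans (+-assoc (suc n * U x) (a * (suc n + d ∸ x)) (a * x))
      (cong (suc n * U x +_) (trans (sym (*-distribˡ-+ a (suc n + d ∸ x) x)) (cong (a *_) (m∸n+n≡m x≤))))

    g-≤ : ∀ {x y} → x ≤ suc n + d → y ≤ suc n + d → g x ≤ g y → suc n * U x + a * y ≤ suc n * U y + a * x
    g-≤ {x} {y} x≤ y≤ h = linear (sumUpTo x u ∷ n * sumUpTo x u ∷ a * (suc n + d ∸ x) ∷ a * x ∷ suc n * U x ∷ a * (suc n + d) ∷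
        sumUpTo y u ∷ n * sumUpTo y u ∷ a * (suc n + d ∸ y) ∷ a * y ∷ suc n * U y ∷ [])
        (# 4 ⊕ # 9 ≼ # 10 ⊕ # 3) 1 (1 ⇐ # 0 ⊕ # 1 ⊕ # 2 ⊕ # 3 ≈ # 4 ⊕ # 5 ∋ g-eq x x≤ ∷ 1 ⇒ # 6 ⊕ # 7 ⊕ # 8 ⊕ # 9 ≈ # 10 ⊕ # 5 ∋
        g-eq y y≤ ∷ 1 × # 0 ⊕ # 1 ⊕ # 2 ≼ # 6 ⊕ # 7 ⊕ # 8 ∋ h ∷ [])

    U-+ : ∀ x k → suc n * U (x + k) ≡ suc n * U x + suc n * sumUpTo k (shift x u)
    U-+ x k = trans (cong (suc n *_) (trans (sumUpTo-+ u x k) (cong (U x +_) (sumUpTo-cong k (λ j _ → cong u (+-comm x j))))))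
      (*-distribˡ-+ (suc n) (U x) (sumUpTo k (shift x u)))

    U-d : ∀ x → suc n * U (x + d) ≡ suc n * U x + suc n * period
    U-d x = trans (U-+ x d) (cong (λ z → suc n * U x + suc n * z) (sumUpTo-shift per x))

    sum-n : sumUpTo n u ≡ m * period
    sum-n = trans (cong (λ z → sumUpTo z u) n≡md) (sumUpTo-periods per m)

    sum≤a : sumUpTo n u ≤ a
    sum≤a = ≤-trans (≤-reflexive sum-n) (cancel d 1≤d (≤-trans (≤-reflexive eq) light))
      where
      cancel : ∀ d → 1 ≤ d → m * period * d ≤ a * d → m * period ≤ a
      cancel (suc d) _ h = *-cancelʳ-≤ (m * period) a (suc d) h
      eq : m * period * d ≡ period * n
      eq = trans (cong (_* d) (*-comm m period)) (trans (*-assoc period m d) (cong (period *_) (sym n≡md)))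

    centre-rise : ℕ
    centre-rise = a ∸ sumUpTo n u

    centre+ : centre-rise + sumUpTo n u ≡ a
    centre+ = m∸n+n≡m sum≤a

    -- Otherwise `b` would divide `a d`, hence by coprimality `d`, although `0 < d < b`.
    drift≢0 : suc n * period ≢ a * d
    drift≢0 e = <⇒≱ (s≤s d≤n) (divides-bound d 1≤d (coprime-divisor (coprime-sym coprime) (divides period (trans (sym e) (*-comm (suc n) period)))))
      where
      divides-bound : ∀ d → 1 ≤ d → suc n ∣ d → suc n ≤ d
      divides-bound (suc d) _ h = ∣⇒≤ h

    -- In a falling walk the lowest position of a period is the lowest of all positions to its left
    -- as well. Taking it as the end of the path, at height 0, keeps the `n` steps before it
    -- nonnegative. The missing rise goes to the front and ranks the block of 1 in P.
    realize-left : suc n * period < a * d → NC a (suc n) (cyclicPair u)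
    realize-left descends = NC-unshift per k (v , dyck , Cut.CutLeft.π≡cyclicPair a d m n n≡md 1≤d 2≤m 1≤a coprime 2≤n v dyck (Periodic-shift k per) agree)
      where
      g-drop : ∀ x → x + d ≤ suc n + d → g (x + d) ≤ g x
      g-drop x x≤ = linear (sumUpTo (x + d) u ∷ n * sumUpTo (x + d) u ∷ a * (suc n + d ∸ (x + d)) ∷ _ ∷ _ ∷ a * (suc n + d) ∷ sumUpTo x u ∷
          n * sumUpTo x u ∷ a * (suc n + d ∸ x) ∷ a * x ∷ suc n * U x ∷ _ ∷ _ ∷ [])
          (# 0 ⊕ # 1 ⊕ # 2 ≼ # 6 ⊕ # 7 ⊕ # 8) 1 (1 ⇒ # 0 ⊕ # 1 ⊕ # 2 ⊕ # 3 ≈ # 4 ⊕ # 5 ∋ g-eq (x + d) x≤ ∷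
          1 ⇐ # 6 ⊕ # 7 ⊕ # 8 ⊕ # 9 ≈ # 10 ⊕ # 5 ∋ g-eq x (≤-trans (m≤m+n x d) x≤) ∷ 1 ⇒ # 4 ≈ # 10 ⊕ # 11 ∋ U-d x ∷ 1 ⇐ # 3 ≈ # 9 ⊕ # 12 ∋
          *-distribˡ-+ a x d ∷ 1 × κ 1 ⊕ # 11 ≼ # 12 ∋ descends ∷ [])
      -- The `d` candidates start at `suc n`, which leaves room for the `n` steps of the walk to the
      -- left of the chosen one.
      am = argmin g (suc n) (pred d)
      top = proj₁ am
      sucpred : suc (pred d) ≡ d
      sucpred = suc-pred d {{>-nonZero 1≤d}}
      top≤ : top ≤ n + d
      top≤ = linear (_ ∷ n ∷ _ ∷ _ ∷ []) (# 0 ≼ # 1 ⊕ # 3) 1 (1 × # 0 ≼ κ 1 ⊕ # 1 ⊕ # 2 ∋ proj₁ (proj₂ (proj₂ am)) ∷ 1 ⇒ κ 1 ⊕ # 2 ≈ # 3 ∋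
          sucpred ∷ [])
      -- Jumps of length `d` to the right never raise `g`; they lead into the candidate period, and
      -- `fuel` is the distance that remains up to `n + d`.
      least : ∀ fuel x → x + fuel ≡ n + d → g top ≤ g x
      least = λ fuel x e → go (suc fuel) x fuel ≤-refl e
        where
        go : ∀ gas x fuel → fuel < gas → x + fuel ≡ n + d → g top ≤ g x
        go (suc gas) x fuel lt e = cases (suc n ≤? x)
          where
          cases : Dec (suc n ≤ x) → g top ≤ g x
          cases (yes n<x) = proj₂ (proj₂ (proj₂ am)) x n<x (linear (_ ∷ fuel ∷ n ∷ _ ∷ _ ∷ [])
              (# 0 ≼ κ 1 ⊕ # 2 ⊕ # 4) 1 (1 ⇒ # 0 ⊕ # 1 ≈ # 2 ⊕ # 3 ∋ e ∷ 1 ⇐ κ 1 ⊕ # 4 ≈ # 3 ∋ sucpred ∷ []))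
          cases (no n≮x) = ≤-trans (go gas (x + d) (fuel ∸ d) (linear (_ ∷ _ ∷ _ ∷ _ ∷ []) (κ 1 ⊕ # 0 ≼ # 3) 1 (1 ⇒ # 0 ⊕ # 1 ≈ # 2 ∋
              m∸n+n≡m d≤f ∷ 1 × κ 1 ≼ # 1 ∋ 1≤d ∷ 1 × κ 1 ⊕ # 2 ≼ κ 1 ⊕ # 3 ∋ lt ∷ [])) (linear≡ (fuel ∸ d ∷ d ∷ _ ∷ x ∷ n ∷ [])
              (# 3 ⊕ # 1 ⊕ # 0 ≈ # 4 ⊕ # 1) 1 (1 ⇒ # 0 ⊕ # 1 ≈ # 2 ∋ m∸n+n≡m d≤f ∷ 1 ⇒ # 3 ⊕ # 2 ≈ # 4 ⊕ # 1 ∋ e ∷ [])))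
                                   (g-drop x (linear (_ ∷ _ ∷ d ∷ []) (# 0 ⊕ # 2 ≼ κ 1 ⊕ # 1 ⊕ # 2) 1 (1 × κ 1 ⊕ # 0 ≼ κ 1 ⊕ # 1 ∋ ≰⇒> n≮x ∷ [])))
            where
            d≤f : d ≤ fuel
            d≤f = linear (_ ∷ _ ∷ _ ∷ _ ∷ []) (# 3 ≼ # 2) 1 (1 × κ 1 ⊕ # 0 ≼ κ 1 ⊕ # 1 ∋ ≰⇒> n≮x ∷ 1 ⇐ # 0 ⊕ # 2 ≈ # 1 ⊕ # 3 ∋ e ∷ [])
      k = top ∸ suc n
      k≡ : k + suc n ≡ top
      k≡ = m∸n+n≡m (proj₁ (proj₂ am))
      rise : ℕ → ℕ
      rise zero    = centre-rise
      rise (suc i) = shift k u (suc i)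
      v : Vec ℕ (suc n)
      v = tabulate (λ x → rise (toℕ x))
      v≡ : ∀ i → i < suc n → at 0 v i ≡ rise i
      v≡ i i<b = at-tabulate 0 (suc n) rise i<b
      agree : ∀ x → 1 ≤ x → x < suc n → at 0 v x ≡ shift k u x
      agree (suc x) _ x<b = v≡ (suc x) x<b
      hgt≡ : ∀ j → j ≤ n → sumUpTo (suc j) (at 0 v) ≡ centre-rise + sumUpTo j (shift (suc k) u)
      hgt≡ zero    _   = trans (v≡ 0 (s≤s z≤n)) (sym (+-identityʳ centre-rise))
      hgt≡ (suc j) j<n = trans (cong₂ _+_ (hgt≡ j (<⇒≤ j<n)) (trans (v≡ (suc j) (s≤s j<n)) (cong u (sym (+-suc j k)))))
        (+-assoc centre-rise (sumUpTo j (shift (suc k) u)) (shift (suc k) u j))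
      dyck : IsDyck a (suc n) v
      dyck = trans (hgt≡ n ≤-refl) (trans (cong (centre-rise +_) (sumUpTo-shift (periodic-n per) (suc k))) centre+) , above
        where
        above : ∀ i → 1 ≤ i → i ≤ suc n → a * i ≤ suc n * sumUpTo i (at 0 v)
        above (suc j) _ (s≤s j≤n) = linear (_ ∷ a * x ∷ _ ∷ a * top ∷ suc n * U (suc k) ∷ suc n * sumUpTo j (shift (suc k) u) ∷
            suc n * sumUpTo n u ∷ _ ∷ suc n * centre-rise ∷ a ∷ n * a ∷ a * j ∷ a * n ∷ _ ∷ _ ∷ [])
            (# 14 ≼ # 7) 1 (1 × # 0 ⊕ # 1 ≼ # 2 ⊕ # 3 ∋ g-≤ {top} {x} (m≤n⇒m≤1+n top≤) (≤-trans x≤top (m≤n⇒m≤1+n top≤))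
            (least (n + d ∸ x) x (m+[n∸m]≡n (≤-trans x≤top top≤))) ∷ 1 ⇒ # 2 ≈ # 4 ⊕ # 5 ∋ U-+ (suc k) j ∷ 1 ⇐ # 0 ≈ # 4 ⊕ # 6 ∋ Utop ∷
            1 ⇐ # 7 ≈ # 8 ⊕ # 5 ∋ expand ∷ 1 ⇐ # 8 ⊕ # 6 ≈ # 9 ⊕ # 10 ∋ total ∷ 1 ⇒ # 3 ⊕ # 11 ≈ # 1 ⊕ # 12 ∋ lengths ∷
            1 ⇐ # 9 ⊕ # 10 ≈ # 13 ∋ *-comm (suc n) a ∷ 1 ⇐ # 13 ≈ # 9 ⊕ # 12 ∋ ab ∷ 1 ⇒ # 14 ≈ # 9 ⊕ # 11 ∋ *-suc a j ∷ [])
          where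
          x = suc k + j
          x≤top : x ≤ top
          x≤top = linear (k ∷ _ ∷ _ ∷ _ ∷ []) (κ 1 ⊕ (# 0 ⊕ # 3) ≼ # 2) 1 (1 ⇒ # 0 ⊕ (κ 1 ⊕ # 1) ≈ # 2 ∋ k≡ ∷ 1 × # 3 ≼ # 1 ∋ j≤n ∷ [])
          Utop : suc n * U top ≡ suc n * U (suc k) + suc n * sumUpTo n u
          Utop = trans (cong (λ z → suc n * U z) (trans (sym k≡) (+-suc k n))) (trans (U-+ (suc k) n) (cong (λ z → suc n * U (suc k) + suc n * z) (sumUpTo-shift (periodic-n per) (suc k))))
          expand : suc n * sumUpTo (suc j) (at 0 v) ≡ suc n * centre-rise + suc n * sumUpTo j (shift (suc k) u)
          expand = trans (cong (suc n *_) (hgt≡ j j≤n)) (*-distribˡ-+ (suc n) centre-rise (sumUpTo j (shift (suc k) u)))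
          total : suc n * centre-rise + suc n * sumUpTo n u ≡ suc n * a
          total = trans (sym (*-distribˡ-+ (suc n) centre-rise (sumUpTo n u))) (cong (suc n *_) centre+)
          lengths : a * top + a * j ≡ a * x + a * n
          lengths = trans (sym (*-distribˡ-+ a top j)) (trans (cong (a *_) {top + j} {x + n} (linear≡ (k ∷ n ∷ _ ∷ j ∷ [])
              (# 2 ⊕ # 3 ≈ κ 1 ⊕ (# 0 ⊕ # 3) ⊕ # 1) 1 (1 ⇐ # 0 ⊕ (κ 1 ⊕ # 1) ≈ # 2 ∋ k≡ ∷ []))) (*-distribˡ-+ a x n))
          ab : a * suc n ≡ a + a * n
          ab = *-suc a n

    -- In a rising walk the lowest position of the first period is the lowest of all positions to
    -- its right as well, so the path can start there. The missing rise comes last and ranks the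
    -- block of `n` in Q.
    realize-right : a * d < suc n * period → NC a (suc n) (cyclicPair u)
    realize-right ascends = NC-unshift per k (v , dyck , Cut.CutRight.π≡cyclicPair a d m n n≡md 1≤d 2≤m 1≤a coprime 2≤n v dyck (Periodic-shift k per) agree)
      where
      g-rise : ∀ x → x + d ≤ suc n + d → g x ≤ g (x + d)
      g-rise x x≤ = linear (sumUpTo (x + d) u ∷ n * sumUpTo (x + d) u ∷ a * (suc n + d ∸ (x + d)) ∷ _ ∷ _ ∷ a * (suc n + d) ∷ sumUpTo x u ∷
          n * sumUpTo x u ∷ a * (suc n + d ∸ x) ∷ a * x ∷ suc n * U x ∷ _ ∷ _ ∷ [])
          (# 6 ⊕ # 7 ⊕ # 8 ≼ # 0 ⊕ # 1 ⊕ # 2) 1 (1 ⇐ # 0 ⊕ # 1 ⊕ # 2 ⊕ # 3 ≈ # 4 ⊕ # 5 ∋ g-eq (x + d) x≤ ∷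
          1 ⇒ # 6 ⊕ # 7 ⊕ # 8 ⊕ # 9 ≈ # 10 ⊕ # 5 ∋ g-eq x (≤-trans (m≤m+n x d) x≤) ∷ 1 ⇐ # 4 ≈ # 10 ⊕ # 11 ∋ U-d x ∷ 1 ⇒ # 3 ≈ # 9 ⊕ # 12 ∋
          *-distribˡ-+ a x d ∷ 1 × κ 1 ⊕ # 12 ≼ # 11 ∋ ascends ∷ [])
      am = argmin g 0 (pred d)
      k = proj₁ am
      sucpred : suc (pred d) ≡ d
      sucpred = suc-pred d {{>-nonZero 1≤d}}
      k<d : k < d
      k<d = linear (_ ∷ _ ∷ _ ∷ []) (κ 1 ⊕ # 0 ≼ # 2) 1 (1 × # 0 ≼ κ 0 ⊕ # 1 ∋ proj₁ (proj₂ (proj₂ am)) ∷ 1 ⇒ κ 1 ⊕ # 1 ≈ # 2 ∋ sucpred ∷ [])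
      least : ∀ gas x → x < gas → x ≤ n + d → g k ≤ g x
      least (suc gas) x lt x≤ = cases (d ≤? x)
        where
        cases : Dec (d ≤ x) → g k ≤ g x
        cases (no d≰x) = proj₂ (proj₂ (proj₂ am)) x z≤n (linear (_ ∷ _ ∷ _ ∷ []) (# 0 ≼ κ 0 ⊕ # 2) 1 (1 × κ 1 ⊕ # 0 ≼ # 1 ∋ ≰⇒> d≰x ∷
            1 ⇐ κ 1 ⊕ # 2 ≈ # 1 ∋ sucpred ∷ []))
        cases (yes d≤x) = ≤-trans (least gas (x ∸ d) (linear (_ ∷ _ ∷ _ ∷ _ ∷ []) (κ 1 ⊕ # 0 ≼ # 3) 1 (1 ⇒ # 0 ⊕ # 1 ≈ # 2 ∋ m∸n+n≡m d≤x ∷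
            1 × κ 1 ≼ # 1 ∋ 1≤d ∷ 1 × κ 1 ⊕ # 2 ≼ κ 1 ⊕ # 3 ∋ lt ∷ [])) (≤-trans (m∸n≤m x d) x≤))
          (subst (λ z → g (x ∸ d) ≤ g z) (m∸n+n≡m d≤x) (g-rise (x ∸ d) (≤-trans (≤-reflexive (m∸n+n≡m d≤x)) (m≤n⇒m≤1+n x≤))))
      rise : ℕ → ℕ
      rise i = if i ≡ᵇ n then centre-rise else shift k u i
      v : Vec ℕ (suc n)
      v = tabulate (λ x → rise (toℕ x))
      v≡ : ∀ i → i < suc n → at 0 v i ≡ rise i
      v≡ i i<b = at-tabulate 0 (suc n) rise i<b
      agree : ∀ x → 0 ≤ x → x < n → at 0 v x ≡ shift k u x
      agree x _ x<n = trans (v≡ x (m<n⇒m<1+n x<n)) (if-false (≢⇒≡ᵇ≡false (<⇒≢ x<n)))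
      hgt≡ : ∀ j → j ≤ n → sumUpTo j (at 0 v) ≡ sumUpTo j (shift k u)
      hgt≡ j j≤n = sumUpTo-cong j (λ x x<j → agree x z≤n (<-≤-trans x<j j≤n))
      total : sumUpTo (suc n) (at 0 v) ≡ a
      total = trans (cong₂ _+_ (trans (hgt≡ n ≤-refl) (sumUpTo-shift (periodic-n per) k)) (trans (v≡ n ≤-refl) (if-true (≡⇒≡ᵇ≡true {n} refl))))
        (trans (+-comm (sumUpTo n u) centre-rise) centre+)
      dyck : IsDyck a (suc n) v
      dyck = total , λ i _ i≤b → above i i≤b (i ≟ suc n)
        where
        above : ∀ i → i ≤ suc n → Dec (i ≡ suc n) → a * i ≤ suc n * sumUpTo i (at 0 v)
        above i _ (yes refl) = ≤-reflexive (trans (*-comm a (suc n)) (cong (suc n *_) (sym total)))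
        above i i≤b (no ≢) = linear (suc n * U k ∷ _ ∷ _ ∷ a * k ∷ _ ∷ _ ∷ _ ∷ []) (# 6 ≼ # 5) 1 (1 × # 0 ⊕ # 1 ≼ # 2 ⊕ # 3 ∋
            g-≤ {k} {k + i} (≤-trans (m≤m+n k i) (m≤n⇒m≤1+n k+i≤)) (m≤n⇒m≤1+n k+i≤) (least (suc (k + i)) (k + i) ≤-refl k+i≤) ∷
            1 ⇒ # 2 ≈ # 0 ⊕ # 4 ∋ U-+ k i ∷ 1 ⇐ # 5 ≈ # 4 ∋ expand ∷ 1 ⇐ # 1 ≈ # 3 ⊕ # 6 ∋ *-distribˡ-+ a k i ∷ [])
          where
          i≤n : i ≤ n
          i≤n = ≤-pred (≤∧≢⇒< i≤b ≢)
          k+i≤ : k + i ≤ n + d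
          k+i≤ = linear (_ ∷ _ ∷ _ ∷ _ ∷ []) (# 0 ⊕ # 2 ≼ # 3 ⊕ # 1) 1 (1 × κ 1 ⊕ # 0 ≼ # 1 ∋ k<d ∷ 1 × # 2 ≼ # 3 ∋ i≤n ∷ [])
          expand : suc n * sumUpTo i (at 0 v) ≡ suc n * sumUpTo i (shift k u)
          expand = cong (suc n *_) (hgt≡ i i≤n)

    realize : NC a (suc n) (cyclicPair u)
    realize with <-cmp (suc n * period) (a * d)
    ... | tri< lt _ _ = realize-left lt
    ... | tri≈ _ e _  = ⊥-elim (drift≢0 e)
    ... | tri> _ _ gt = realize-right gt

-- Paths whose labeled pair is fixed by a rotation

unrot1-rot1 : ∀ {n i} → IsLabel n i → unrot1 n (rot1 n i) ≡ i
unrot1-rot1 {n} {suc i} l with suc i ≟ n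
... | yes e = trans (cong (unrot1 n) (if-true (≡⇒≡ᵇ≡true e))) (sym e)
... | no ≢  = cong (unrot1 n) (if-false {x = 1} (≢⇒≡ᵇ≡false ≢))

rotRP-rel : ∀ {n} (P : RP n) {i j} → IsLabel n i → IsLabel n j → relOf (rotRP P) (rot1 n i) (rot1 n j) ≡ relOf P i j
rotRP-rel {n} P li lj = trans (relOf-fromFun n (λ i j → relOf P (unrot1 n i) (unrot1 n j)) (λ i → rankOf P (unrot1 n i)) (rot1-label 1≤n li) (rot1-label 1≤n lj)) (cong₂ (relOf P) (unrot1-rot1 li) (unrot1-rot1 lj))
  where
  1≤n : 1 ≤ n
  1≤n = ≤-trans (proj₁ li) (proj₂ li)

rotRP-rank : ∀ {n} (P : RP n) {i} → IsLabel n i → rankOf (rotRP P) (rot1 n i) ≡ rankOf P i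
rotRP-rank {n} P li = trans (rankOf-fromFun n (λ i j → relOf P (unrot1 n i) (unrot1 n j)) (λ i → rankOf P (unrot1 n i)) (rot1-label (≤-trans (proj₁ li) (proj₂ li)) li)) (cong (rankOf P) (unrot1-rot1 li))

rotLPN-rel : ∀ {n} k (x : LP n) {i j} → IsLabel n i → IsLabel n j →
  relOf (proj₁ (rotLPN k x)) (iter k (rot1 n) i) (iter k (rot1 n) j) ≡ relOf (proj₁ x) i j ×
  relOf (proj₂ (rotLPN k x)) (iter k (rot1 n) i) (iter k (rot1 n) j) ≡ relOf (proj₂ x) i j
rotLPN-rel zero    x li lj = refl , refl
rotLPN-rel (suc k) x li lj = let (p , q) = rotLPN-rel k x li lj ; 1≤n = ≤-trans (proj₁ li) (proj₂ li) in
  trans (rotRP-rel (proj₁ (rotLPN k x)) (iter-rot1-label k 1≤n li) (iter-rot1-label k 1≤n lj)) p ,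
  trans (rotRP-rel (proj₂ (rotLPN k x)) (iter-rot1-label k 1≤n li) (iter-rot1-label k 1≤n lj)) q

rotLPN-rank : ∀ {n} k (x : LP n) {i} → IsLabel n i →
  rankOf (proj₁ (rotLPN k x)) (iter k (rot1 n) i) ≡ rankOf (proj₁ x) i ×
  rankOf (proj₂ (rotLPN k x)) (iter k (rot1 n) i) ≡ rankOf (proj₂ x) i
rotLPN-rank zero    x li = refl , refl
rotLPN-rank (suc k) x li = let (p , q) = rotLPN-rank k x li ; 1≤n = ≤-trans (proj₁ li) (proj₂ li) in
  trans (rotRP-rank (proj₁ (rotLPN k x)) (iter-rot1-label k 1≤n li)) p ,
  trans (rotRP-rank (proj₂ (rotLPN k x)) (iter-rot1-label k 1≤n li)) q

rotLPN-+ : ∀ {n} k l (x : LP n) → rotLPN (k + l) x ≡ rotLPN k (rotLPN l x)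
rotLPN-+ zero    l x = refl
rotLPN-+ (suc k) l x = cong rotLP (rotLPN-+ k l x)

rotLPN-fixed : ∀ {n} d {x : LP n} → rotLPN d x ≡ x → ∀ k → rotLPN (k * d) x ≡ x
rotLPN-fixed d h zero    = refl
rotLPN-fixed d {x} h (suc k) = trans (rotLPN-+ d (k * d) x) (trans (cong (rotLPN d) (rotLPN-fixed d h k)) h)

module Rotations (a d m n : ℕ) (n≡md : n ≡ m * d) (1≤d : 1 ≤ d) (2≤m : 2 ≤ m) .{{nz : NonZero n}}
                 (1≤a : 1 ≤ a) (coprime : Coprime a (suc n)) (2≤n : 2 ≤ n) where

  open CyclicPair a d m n n≡md 1≤d 2≤m
  open Realize a d m n n≡md 1≤d 2≤m 1≤a coprime 2≤n

  rotBy : ℕ → ℕ → ℕ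
  rotBy k = iter k (rot1 n)

  rotBy-low : ∀ k {i} → IsLabel n i → i + k ≤ n → rotBy k i ≡ i + k
  rotBy-low k {i} l i+k≤n = Congruent-close (iter-rot1-Congruent n k i) (linear (_ ∷ _ ∷ _ ∷ k ∷ [])
      (κ 1 ⊕ # 0 ≼ # 2 ⊕ # 3 ⊕ # 1) 1 (1 × # 0 ≼ # 1 ∋ proj₂ l′ ∷ 1 × κ 1 ≼ # 2 ∋ proj₁ l ∷ [])) (linear (_ ∷ i ∷ k ∷ _ ∷ [])
      (κ 1 ⊕ (# 1 ⊕ # 2) ≼ # 0 ⊕ # 3) 1 (1 × κ 1 ≼ # 0 ∋ proj₁ l′ ∷ 1 × # 1 ⊕ # 2 ≼ # 3 ∋ i+k≤n ∷ []))
    where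
    l′ : IsLabel n (rotBy k i)
    l′ = iter-rot1-label k (≤-trans (proj₁ l) (proj₂ l)) l

  rotBy-high : ∀ k {i} → IsLabel n i → n < i + k → i + k ≤ n + n → rotBy k i + n ≡ i + k
  rotBy-high k {i} l n<i+k i+k≤ = Congruent-close (Congruent-trans (Congruent-sym (Congruent-wrap refl)) (iter-rot1-Congruent n k i))
    (linear (_ ∷ _ ∷ i ∷ k ∷ []) (κ 1 ⊕ (# 0 ⊕ # 1) ≼ # 2 ⊕ # 3 ⊕ # 1) 1 (1 × # 0 ≼ # 1 ∋ proj₂ l′ ∷ 1 × κ 1 ⊕ # 1 ≼ # 2 ⊕ # 3 ∋ n<i+k ∷
        [])) (linear (_ ∷ i ∷ k ∷ n ∷ []) (κ 1 ⊕ (# 1 ⊕ # 2) ≼ # 0 ⊕ # 3 ⊕ # 3) 1 (1 × κ 1 ≼ # 0 ∋ proj₁ l′ ∷ 1 × # 1 ⊕ # 2 ≼ # 3 ⊕ # 3 ∋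
        i+k≤ ∷ []))
    where
    l′ : IsLabel n (rotBy k i)
    l′ = iter-rot1-label k (≤-trans (proj₁ l) (proj₂ l)) l

  1≤n : 1 ≤ n
  1≤n = <⇒≤ 2≤n

  first-label : IsLabel n 1
  first-label = ≤-refl , 1≤n

  final-label : IsLabel n n
  final-label = 1≤n , ≤-refl

  module OfPath (v : Vec ℕ (suc n)) (dyck : IsDyck a (suc n) v) where
    open DyckPath a n v dyck 1≤a coprime 2≤n public
    open Path a (suc n) v using (vv) public

    relP-lf : ∀ {i j} → IsLabel n i → IsLabel n j → relOf (proj₁ (π a (suc n) v)) i j ≡ (lf i ≡ᵇ lf j)
    relP-lf {i} {j} li lj = trans (cong (λ x → relOf (proj₁ x) i j) π-coded) (relOf-fromFun n (λ i j → lf i ≡ᵇ lf j) (λ i → vv (lf i)) li lj)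

    relQ-rt : ∀ {i j} → IsLabel n i → IsLabel n j → relOf (proj₂ (π a (suc n) v)) i j ≡ (rt i ≡ᵇ rt j)
    relQ-rt {i} {j} li lj = trans (cong (λ x → relOf (proj₂ x) i j) π-coded) (relOf-fromFun n (λ i j → rt i ≡ᵇ rt j) (λ i → vv (rt i)) li lj)

    rankP-lf : ∀ {i} → IsLabel n i → rankOf (proj₁ (π a (suc n) v)) i ≡ vv (lf i)
    rankP-lf {i} li = trans (cong (λ x → rankOf (proj₁ x) i) π-coded) (rankOf-fromFun n (λ i j → lf i ≡ᵇ lf j) (λ i → vv (lf i)) li)

    rankQ-rt : ∀ {i} → IsLabel n i → rankOf (proj₂ (π a (suc n) v)) i ≡ vv (rt i)
    rankQ-rt {i} li = trans (cong (λ x → rankOf (proj₂ x) i) π-coded) (rankOf-fromFun n (λ i j → rt i ≡ᵇ rt j) (λ i → vv (rt i)) li)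

    lf-1 : lf 1 ≡ 0
    lf-1 = n<1⇒n≡0 (lf< first-label)

    rt-n : rt n ≡ n
    rt-n = ≤-antisym (rt≤n final-label) (≤rt final-label)

    -- e is the unique label on both the block of P containing 1 and the block of Q containing n.
    private
      sucpred : suc (pred n) ≡ n
      sucpred = suc-pred n
      least = argmin H 1 (pred n)

    e : ℕ
    e = proj₁ least

    le : IsLabel n e
    le = proj₁ (proj₂ least) , ≤-trans (proj₁ (proj₂ (proj₂ least))) (≤-reflexive sucpred)

    He≤ : ∀ {j} → IsLabel n j → H e ≤ H j
    He≤ (1≤j , j≤n) = proj₂ (proj₂ (proj₂ least)) _ 1≤j (≤-trans j≤n (≤-reflexive (sym sucpred)))

    lf-0 : ∀ {i} → IsLabel n i → (∀ j → 1 ≤ j → j < i → H i ≤ H j) → lf i ≡ 0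
    lf-0 {i} l low = lf-unique l (proj₁ l , subst (_< H i) (sym start) (positive {i} l) , low)

    rt-last : ∀ {i} → IsLabel n i → (∀ j → i ≤ j → j ≤ n → H i ≤ H j) → rt i ≡ n
    rt-last {i} l low = rt-unique l (proj₂ l , subst (_< H i) (sym end) (positive {i} l) , low)

    0-lf : ∀ {i j} → IsLabel n i → lf i ≡ 0 → 1 ≤ j → j ≤ i → H i ≤ H j
    0-lf {i} {j} l lf≡0 1≤j j≤i with m≤n⇒m<n∨m≡n j≤i
    ... | inj₁ j<i  = lf-high l j (subst (_< j) (sym lf≡0) 1≤j) j<i
    ... | inj₂ refl = ≤-refl

    last-rt : ∀ {i j} → IsLabel n i → rt i ≡ n → i ≤ j → j ≤ n → H i ≤ H j
    last-rt {i} {j} l rt≡n i≤j j≤n = rt-high l j i≤j (subst (j ≤_) (sym rt≡n) j≤n)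

    -- A label with `lf = 0` and `rt = n` is at most as high as every label on either side of it, in
    -- particular as `e`, and `e` has least height.
    e-unique : ∀ {j} → IsLabel n j → lf j ≡ 0 → rt j ≡ n → j ≡ e
    e-unique {j} lj lf≡0 rt≡n with ≤-total j e
    ... | inj₁ j≤e = distinct lj le (≤-antisym (last-rt lj rt≡n j≤e (proj₂ le)) (He≤ lj))
    ... | inj₂ e≤j = distinct lj le (≤-antisym (0-lf lj lf≡0 (proj₁ le) e≤j) (He≤ lj))

    e≤lf : ∀ {j} → IsLabel n j → e < j → e ≤ lf j
    e≤lf {j} lj e<j = ≮⇒≥ λ lf<e → <⇒≢ e<j (distinct le lj (≤-antisym (He≤ lj) (lf-high lj e lf<e e<j)))

    rt<e : ∀ {j} → IsLabel n j → j < e → rt j < e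
    rt<e {j} lj j<e = ≰⇒> λ e≤rt → <⇒≢ j<e (distinct lj le (≤-antisym (rt-high lj e (<⇒≤ j<e) e≤rt) (He≤ lj)))

    module Invariant (inv : rotLPN d (π a (suc n) v) ≡ π a (suc n) v) where

      invP : ∀ {i j} → IsLabel n i → IsLabel n j → (lf (rotBy d i) ≡ᵇ lf (rotBy d j)) ≡ (lf i ≡ᵇ lf j)
      invP {i} {j} li lj = trans (sym (relP-lf (iter-rot1-label d 1≤n li) (iter-rot1-label d 1≤n lj)))
        (trans (cong (λ x → relOf (proj₁ x) (rotBy d i) (rotBy d j)) (sym inv)) (trans (proj₁ (rotLPN-rel d (π a (suc n) v) li lj)) (relP-lf li lj)))

      invQ : ∀ {i j} → IsLabel n i → IsLabel n j → (rt (rotBy d i) ≡ᵇ rt (rotBy d j)) ≡ (rt i ≡ᵇ rt j)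
      invQ {i} {j} li lj = trans (sym (relQ-rt (iter-rot1-label d 1≤n li) (iter-rot1-label d 1≤n lj)))
        (trans (cong (λ x → relOf (proj₂ x) (rotBy d i) (rotBy d j)) (sym inv)) (trans (proj₂ (rotLPN-rel d (π a (suc n) v) li lj)) (relQ-rt li lj)))

      -- Pairs a label with its image under `rot^d`, whichever of the forms `i + d` and `i + d - n`
      -- the image takes, so that invariance can be used in both directions.
      Shifted : ℕ → ℕ → Set
      Shifted i i′ = IsLabel n i × IsLabel n i′ × rotBy d i ≡ i′

      up : ∀ {i} → IsLabel n i → i + d ≤ n → Shifted i (i + d)
      up {i} l h = l , (≤-trans (proj₁ l) (m≤m+n i d) , h) , rotBy-low d l h

      around : ∀ {i j} → IsLabel n i → IsLabel n j → j + n ≡ i + d → Shifted i j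
      around {i} {j} li lj h = li , lj , +-cancelʳ-≡ n (rotBy d i) j (trans (rotBy-high d li (linear (_ ∷ _ ∷ i ∷ d ∷ [])
          (κ 1 ⊕ # 1 ≼ # 2 ⊕ # 3) 1 (1 × κ 1 ≼ # 0 ∋ proj₁ lj ∷ 1 ⇒ # 0 ⊕ # 1 ≈ # 2 ⊕ # 3 ∋ h ∷ [])) (linear (_ ∷ _ ∷ i ∷ d ∷ [])
          (# 2 ⊕ # 3 ≼ # 1 ⊕ # 1) 1 (1 × # 0 ≼ # 1 ∋ proj₂ lj ∷ 1 ⇐ # 0 ⊕ # 1 ≈ # 2 ⊕ # 3 ∋ h ∷ []))) (sym h))

      P⁺ : ∀ {i j i′ j′} → Shifted i i′ → Shifted j j′ → lf i ≡ lf j → lf i′ ≡ lf j′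
      P⁺ (li , _ , refl) (lj , _ , refl) h = ≡ᵇ≡true⇒≡ (trans (invP li lj) (≡⇒≡ᵇ≡true h))

      P⁻ : ∀ {i j i′ j′} → Shifted i i′ → Shifted j j′ → lf i′ ≡ lf j′ → lf i ≡ lf j
      P⁻ (li , _ , refl) (lj , _ , refl) h = ≡ᵇ≡true⇒≡ (trans (sym (invP li lj)) (≡⇒≡ᵇ≡true h))

      Q⁺ : ∀ {i j i′ j′} → Shifted i i′ → Shifted j j′ → rt i ≡ rt j → rt i′ ≡ rt j′
      Q⁺ (li , _ , refl) (lj , _ , refl) h = ≡ᵇ≡true⇒≡ (trans (invQ li lj) (≡⇒≡ᵇ≡true h))

      Q⁻ : ∀ {i j i′ j′} → Shifted i i′ → Shifted j j′ → rt i′ ≡ rt j′ → rt i ≡ rt j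
      Q⁻ (li , _ , refl) (lj , _ , refl) h = ≡ᵇ≡true⇒≡ (trans (sym (invQ li lj)) (≡⇒≡ᵇ≡true h))

      rankP⁺ : ∀ {i i′} → Shifted i i′ → vv (lf i′) ≡ vv (lf i)
      rankP⁺ {i} (li , li′ , refl) = trans (sym (rankP-lf li′)) (trans (cong (λ x → rankOf (proj₁ x) (rotBy d i)) (sym inv)) (trans (proj₁ (rotLPN-rank d (π a (suc n) v) li)) (rankP-lf li)))

      rankQ⁺ : ∀ {i i′} → Shifted i i′ → vv (rt i′) ≡ vv (rt i)
      rankQ⁺ {i} (li , li′ , refl) = trans (sym (rankQ-rt li′)) (trans (cong (λ x → rankOf (proj₂ x) (rotBy d i)) (sym inv)) (trans (proj₂ (rotLPN-rank d (π a (suc n) v) li)) (rankQ-rt li)))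

      -- The two labels n − d + 1 ↦ 1 and e − d ↦ e would lie in one block of P on either side of e.
      e-near-end : e ≤ d ⊎ n < e + d
      e-near-end with e ≤? d | e + d ≤? n
      ... | yes e≤d | _ = inj₁ e≤d
      ... | no _ | no ≰n = inj₂ (≰⇒> ≰n)
      ... | no e≰d | yes e+d≤n = ⊥-elim (<⇒≱ (≤-<-trans (≤-reflexive (sym same)) (lf< lx)) (≤-trans (m∸n≤m e d) (e≤lf ly e<y)))
        where
        x = e ∸ d
        x≡ : x + d ≡ e
        x≡ = m∸n+n≡m (<⇒≤ (≰⇒> e≰d))
        lx : IsLabel n x
        lx = m<n⇒0<n∸m (≰⇒> e≰d) , ≤-trans (m∸n≤m e d) (proj₂ le)
        y = suc (n ∸ d)
        y≡ : y + d ≡ suc n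
        y≡ = cong suc (m∸n+n≡m d≤n)
        ly : IsLabel n y
        ly = s≤s z≤n , linear (_ ∷ _ ∷ _ ∷ []) (κ 1 ⊕ # 0 ≼ # 2) 1 (1 ⇒ κ 1 ⊕ # 0 ⊕ # 1 ≈ κ 1 ⊕ # 2 ∋ y≡ ∷ 1 × κ 1 ≼ # 1 ∋ 1≤d ∷ [])
        e<y : e < y
        e<y = linear (_ ∷ d ∷ _ ∷ _ ∷ []) (κ 1 ⊕ # 3 ≼ κ 1 ⊕ # 0) 1 (1 ⇐ κ 1 ⊕ # 0 ⊕ # 1 ≈ κ 1 ⊕ # 2 ∋ y≡ ∷ 1 × # 3 ⊕ # 1 ≼ # 2 ∋ e+d≤n ∷ [])
        same : lf x ≡ lf y
        same = P⁻ (subst (Shifted x) x≡ (up lx (≤-trans (≤-reflexive x≡) (proj₂ le)))) (around ly first-label (sym y≡))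
          (trans (lf-0 le λ j 1≤j j<e → He≤ (1≤j , ≤-trans (<⇒≤ j<e) (proj₂ le))) (sym lf-1))

      ld : IsLabel n (suc d)
      ld = s≤s z≤n , ≤-trans (+-monoˡ-≤ d 1≤d) 2d≤n

      -- If no gap of the block of 1 exceeds d, its translate by d cannot fit into a gap.
      short-gaps⇒central : (∀ f → IsLabel n f → lf f ≡ 0 → rt f < f + d) → lf (suc d) ≡ 0
      short-gaps⇒central short with lf (suc d) ≟ 0
      ... | yes z = z
      ... | no ≢0 = ⊥-elim (cases (g + d ≤? n))
        where
        h = suc d
        -- The lowest label `g` of `[1, d + 1]` is the last one there that belongs to the block of
        -- 1. Its gap, up to `rt g`, contains `h`, the image of 1, and the image of `g` must lie in
        -- the block of `h`.
        lo = argmin H 1 d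
        g = proj₁ lo
        g≤h : g ≤ h
        g≤h = proj₁ (proj₂ (proj₂ lo))
        lg : IsLabel n g
        lg = proj₁ (proj₂ lo) , ≤-trans g≤h (proj₂ ld)
        Hg≤ : ∀ {x} → 1 ≤ x → x ≤ h → H g ≤ H x
        Hg≤ 1≤x x≤h = proj₂ (proj₂ (proj₂ lo)) _ 1≤x x≤h
        lfg : lf g ≡ 0
        lfg = lf-0 lg λ j 1≤j j<g → Hg≤ 1≤j (≤-trans (<⇒≤ j<g) g≤h)
        h≤rt : h ≤ rt g
        h≤rt = ≮⇒≥ λ rt<h → <⇒≱ (rt-lower lg) (Hg≤ (s≤s z≤n) rt<h)
        g<h : g < h
        g<h = ≤∧≢⇒< g≤h λ eq → ≢0 (trans (cong lf (sym eq)) lfg)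
        g≤lf : g ≤ lf h
        g≤lf = ≮⇒≥ λ lf<g → <⇒≢ g<h (distinct lg ld (≤-antisym (Hg≤ (s≤s z≤n) ≤-refl) (lf-high ld g lf<g g<h)))
        Hg≤s : H g ≤ H (lf h)
        Hg≤s = Hg≤ (≤-trans (proj₁ lg) g≤lf) (<⇒≤ (lf< ld))
        same : ∀ {y} → Shifted g y → lf y ≡ lf h
        same sh = P⁺ sh (up first-label (proj₂ ld)) (trans lfg (sym lf-1))
        cases : Dec (g + d ≤ n) → ⊥
        cases (yes h≤) = beyond (m≤n⇒m<n∨m≡n (short g lg lfg))
          where
          sh = up lg h≤
          ly = proj₁ (proj₂ sh)
          s≡ : lf (g + d) ≡ lf h
          s≡ = same sh
          beyond : suc (rt g) < g + d ⊎ suc (rt g) ≡ g + d → ⊥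
          beyond (inj₁ lt) = <⇒≱ (<-≤-trans (≤-<-trans (lf-high ly (suc (rt g)) (subst (_< suc (rt g)) (sym s≡) (<-≤-trans (lf< ld) (m≤n⇒m≤1+n h≤rt))) lt) (rt-lower lg)) Hg≤s)
            (<⇒≤ (subst (λ z → H z < H (g + d)) s≡ (lf-lower ly)))
          beyond (inj₂ eq) = <⇒≱ (<-≤-trans (subst (λ z → H z < H g) eq (rt-lower lg)) Hg≤s) (<⇒≤ (subst (λ z → H z < H (g + d)) s≡ (lf-lower ly)))
        cases (no ≰n) = <⇒≱ (<-≤-trans (subst (_< y) (same (around lg ly y≡)) (lf< ly)) (linear (_ ∷ _ ∷ _ ∷ _ ∷ [])
            (# 0 ≼ # 2) 1 (1 ⇒ # 0 ⊕ # 1 ≈ # 2 ⊕ # 3 ∋ y≡ ∷ 1 × # 3 ≼ # 1 ∋ d≤n ∷ []))) g≤lf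
          where
          y = g + d ∸ n
          y≡ : y + n ≡ g + d
          y≡ = m∸n+n≡m (<⇒≤ (≰⇒> ≰n))
          ly : IsLabel n y
          ly = m<n⇒0<n∸m (≰⇒> ≰n) , linear (_ ∷ _ ∷ _ ∷ _ ∷ []) (# 0 ≼ # 1) 1 (1 ⇒ # 0 ⊕ # 1 ≈ # 2 ⊕ # 3 ∋ y≡ ∷ 1 × # 3 ≼ # 1 ∋ d≤n ∷
              1 × # 2 ≼ # 1 ∋ proj₂ lg ∷ [])

      -- The mirror image for the block of `n` in Q, with the rotation read backwards: `n - d` is
      -- the label that `rot^d` carries to `n`.
      short-gaps⇒centralQ : (∀ f → IsLabel n f → rt f ≡ n → f ≤ lf f + d) → rt (n ∸ d) ≡ n
      short-gaps⇒centralQ short with rt (n ∸ d) ≟ n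
      ... | yes z = z
      ... | no ≢n = ⊥-elim (cases (suc d ≤? g))
        where
        h = n ∸ d
        h≡ : h + d ≡ n
        h≡ = m∸n+n≡m d≤n
        lh : IsLabel n h
        lh = linear (_ ∷ _ ∷ _ ∷ []) (κ 1 ≼ # 0) 1 (1 ⇐ # 0 ⊕ # 1 ≈ # 2 ∋ h≡ ∷ 1 × # 1 ⊕ # 1 ≼ # 2 ∋ 2d≤n ∷ 1 × κ 1 ≼ # 1 ∋ 1≤d ∷ []) , m∸n≤m n d
        lo = argmin H h d
        g = proj₁ lo
        h≤g : h ≤ g
        h≤g = proj₁ (proj₂ lo)
        lg : IsLabel n g
        lg = ≤-trans (proj₁ lh) h≤g , ≤-trans (proj₁ (proj₂ (proj₂ lo))) (≤-reflexive h≡)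
        Hg≤ : ∀ {x} → h ≤ x → x ≤ n → H g ≤ H x
        Hg≤ h≤x x≤n = proj₂ (proj₂ (proj₂ lo)) _ h≤x (≤-trans x≤n (≤-reflexive (sym h≡)))
        rtg : rt g ≡ n
        rtg = rt-last lg λ j g≤j j≤n → Hg≤ (≤-trans h≤g g≤j) j≤n
        lf<h : lf g < h
        lf<h = ≰⇒> λ h≤lf → <⇒≱ (lf-lower lg) (Hg≤ h≤lf (≤-trans (<⇒≤ (lf< lg)) (proj₂ lg)))
        h<g : h < g
        h<g = ≤∧≢⇒< h≤g λ eq → ≢n (trans (cong rt eq) rtg)
        rt<g : rt h < g
        rt<g = ≰⇒> λ g≤rt → <⇒≢ h<g (distinct lh lg (≤-antisym (rt-high lh g (<⇒≤ h<g) g≤rt) (Hg≤ ≤-refl (proj₂ lh))))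
        same : ∀ {y} → Shifted y g → rt y ≡ rt h
        same sh = Q⁻ sh (subst (Shifted h) h≡ (up lh (≤-reflexive h≡))) (trans rtg (sym rt-n))
        cases : Dec (suc d ≤ g) → ⊥
        cases (yes d<g) = <⇒≱ (<-trans (lf-lower lg) (≤-<-trans Hg≤drop (<-≤-trans drop low))) ≤-refl
          where
          y = g ∸ d
          y≡ : y + d ≡ g
          y≡ = m∸n+n≡m (<⇒≤ d<g)
          ly : IsLabel n y
          ly = m<n⇒0<n∸m d<g , ≤-trans (m∸n≤m g d) (proj₂ lg)
          t≡ : rt y ≡ rt h
          t≡ = same (subst (Shifted y) y≡ (up ly (≤-trans (≤-reflexive y≡) (proj₂ lg))))
          y≤lf : y ≤ lf g
          y≤lf = linear (_ ∷ d ∷ _ ∷ _ ∷ []) (# 0 ≼ # 3) 1 (1 ⇒ # 0 ⊕ # 1 ≈ # 2 ∋ y≡ ∷ 1 × # 2 ≼ # 3 ⊕ # 1 ∋ short g lg rtg ∷ [])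
          low : H y ≤ H (lf g)
          low = rt-high ly (lf g) y≤lf (subst (lf g ≤_) (sym t≡) (≤-trans (<⇒≤ lf<h) (≤rt lh)))
          drop : H (suc (rt h)) < H y
          drop = subst (λ z → H (suc z) < H y) t≡ (rt-lower ly)
          Hg≤drop : H g ≤ H (suc (rt h))
          Hg≤drop = Hg≤ (m≤n⇒m≤1+n (≤rt lh)) (≤-trans rt<g (proj₂ lg))
        cases (no d≮g) = <⇒≱ rt<g (≤-trans (linear (_ ∷ h ∷ _ ∷ _ ∷ []) (# 0 ≼ # 0 ⊕ # 1) 1 (1 ⇐ # 0 ⊕ # 1 ⊕ # 2 ≈ # 0 ⊕ # 3 ∋ y≡ ∷
            1 × # 2 ≼ # 3 ∋ d≤n ∷ [])) (subst (y ≤_) (same (around ly lg (sym y≡))) (≤rt ly)))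
          where
          y = g + h
          y≡ : y + d ≡ g + n
          y≡ = linear≡ (h ∷ d ∷ _ ∷ g ∷ []) (# 3 ⊕ # 0 ⊕ # 1 ≈ # 3 ⊕ # 2) 1 (1 ⇒ # 0 ⊕ # 1 ≈ # 2 ∋ h≡ ∷ [])
          ly : IsLabel n y
          ly = ≤-trans (proj₁ lg) (m≤m+n g h) , linear (h ∷ _ ∷ _ ∷ _ ∷ []) (# 3 ⊕ # 0 ≼ # 2) 1 (1 ⇒ # 0 ⊕ # 1 ≈ # 2 ∋ h≡ ∷
              1 × κ 1 ⊕ # 3 ≼ κ 1 ⊕ # 1 ∋ ≰⇒> d≮g ∷ [])

      suc≤ : ∀ {i} → i + d ≤ n → suc i ≤ n
      suc≤ {i} h = ≤-trans (≤-trans (≤-reflexive (+-comm 1 i)) (+-monoʳ-≤ i 1≤d)) h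

      1≤+d : ∀ {i} → 1 ≤ i + d
      1≤+d {i} = ≤-trans 1≤d (m≤n+m d i)

      -- The rise at `i` is the rank of a block: of the Q block ending in `i` if the height falls,
      -- of the P block opened by `suc i` if it grows. Ranks are invariant, so the extreme label has
      -- to go to the extreme label. For P this could fail only if the image reached back to the
      -- first `d` labels, which the central block through 1 and `suc d` prevents.
      central⇒periodic : lf (suc d) ≡ 0 → ∀ i → 1 ≤ i → i + d ≤ n → vv (i + d) ≡ vv i
      central⇒periodic c i 1≤i i+d≤n with <-cmp (H i) (H (suc i))
      ... | tri≈ _ eq _ = ⊥-elim (1+n≢n (sym (distinct {i} {suc i} li (s≤s z≤n , suc≤ i+d≤n) eq)))
        where
        li : IsLabel n i
        li = 1≤i , ≤-trans (m≤m+n i d) i+d≤n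
      ... | tri> _ _ down = trans (sym (cong vv t≡)) (trans (rankQ⁺ sh) (cong vv (rt-self li down)))
        where
        li : IsLabel n i
        li = 1≤i , ≤-trans (m≤m+n i d) i+d≤n
        sh = up li i+d≤n
        lj = proj₁ (proj₂ sh)
        t = rt (i + d)
        t≡ : rt (i + d) ≡ i + d
        t≡ = ≤-antisym (≮⇒≥ contra) (≤rt lj)
          where
          contra : i + d < t → ⊥
          contra j<t = <⇒≱ i<x (≤-trans (≤rt lx) (≤-reflexive (trans same (rt-self li down))))
            where
            x = t ∸ d
            x≡ : x + d ≡ t
            x≡ = m∸n+n≡m (≤-trans (m≤n+m d i) (<⇒≤ j<t))
            i<x : i < x
            i<x = linear (_ ∷ d ∷ _ ∷ _ ∷ []) (κ 1 ⊕ # 3 ≼ # 0) 1 (1 ⇐ # 0 ⊕ # 1 ≈ # 2 ∋ x≡ ∷ 1 × κ 1 ⊕ (# 3 ⊕ # 1) ≼ # 2 ∋ j<t ∷ [])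
            lx : IsLabel n x
            lx = ≤-trans 1≤i (<⇒≤ i<x) , ≤-trans (m∸n≤m t d) (rt≤n lj)
            same : rt x ≡ rt i
            same = Q⁻ (subst (Shifted x) x≡ (up lx (≤-trans (≤-reflexive x≡) (rt≤n lj)))) sh (rt-rt lj)
      ... | tri< rise _ _ = cases (suc i + d ≤? n)
        where
        li+1 : IsLabel n (suc i)
        li+1 = s≤s z≤n , suc≤ i+d≤n
        lf-i+1 : lf (suc i) ≡ i
        lf-i+1 = lf-suc (proj₂ li+1) rise
        cases : Dec (suc i + d ≤ n) → vv (i + d) ≡ vv i
        -- Here `suc i + d` equals `suc n`, so `suc i` goes to 1. It would then lie in the central
        -- block together with 1, although its `lf` is `i ≥ 1`.
        cases (no ≰n) = ⊥-elim (<⇒≢ 1≤i (sym (trans (sym lf-i+1) (trans (P⁻ (around li+1 first-label (≤-antisym (linear (i ∷ d ∷ _ ∷ [])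
            (κ 1 ⊕ # 2 ≼ κ 1 ⊕ # 0 ⊕ # 1) 1 (1 × κ 1 ⊕ # 2 ≼ κ 1 ⊕ # 0 ⊕ # 1 ∋ ≰⇒> ≰n ∷ [])) (linear (i ∷ d ∷ _ ∷ [])
            (κ 1 ⊕ # 0 ⊕ # 1 ≼ κ 1 ⊕ # 2) 1 (1 × # 0 ⊕ # 1 ≼ # 2 ∋ i+d≤n ∷ [])))) (up first-label (proj₂ ld)) (trans lf-1 (sym c))) lf-1))))
        cases (yes j≤n) = trans (sym (cong vv s≡)) (trans (rankP⁺ sh) (cong vv lf-i+1))
          where
          sh = up li+1 j≤n
          j = suc i + d
          lj = proj₁ (proj₂ sh)
          s = lf j
          ls : IsLabel n (suc s)
          ls = lf-suc-label lj
          s≢0 : s ≢ 0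
          s≢0 z = <⇒≢ 1≤i (trans (sym lf-1) (trans (P⁻ (up first-label (proj₂ ld)) sh (trans c (sym z))) lf-i+1))
          -- `suc d` is at most as high as every earlier label. If the nearest lower position of `j`
          -- were a label before `suc d`, then `suc d` would be lower than `j` as well, and nearer.
          d≤s : suc d ≤ s
          d≤s = ≮⇒≥ contra
            where
            contra : ¬ s < suc d
            contra s≤d = <⇒≱ (≤-<-trans (lf-high lj (suc d) s≤d (s≤s (linear (_ ∷ _ ∷ []) (κ 1 ⊕ # 1 ≼ # 0 ⊕ # 1) 1 (1 × κ 1 ≼ # 0 ∋ 1≤i ∷
                [])))) (≤-<-trans (0-lf ld c (n≢0⇒n>0 s≢0) (<⇒≤ s≤d)) (lf-lower lj))) ≤-refl
          s≡ : s ≡ i + d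
          s≡ = ≤-antisym (≤-pred (lf< lj)) (≮⇒≥ contra)
            where
            x = suc s ∸ d
            x≡ : x + d ≡ suc s
            x≡ = m∸n+n≡m (≤-trans (n≤1+n d) (m≤n⇒m≤1+n d≤s))
            lx : IsLabel n x
            lx = linear (_ ∷ _ ∷ _ ∷ []) (κ 1 ≼ # 0) 1 (1 ⇐ # 0 ⊕ # 1 ≈ κ 1 ⊕ # 2 ∋ x≡ ∷ 1 × κ 1 ⊕ # 1 ≼ # 2 ∋ d≤s ∷
                []) , ≤-trans (m∸n≤m (suc s) d) (proj₂ ls)
            same : lf x ≡ i
            same = trans (P⁻ (subst (Shifted x) x≡ (up lx (≤-trans (≤-reflexive x≡) (proj₂ ls)))) sh (lf-suc-lf lj)) lf-i+1
            contra : ¬ s < i + d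
            contra s<i+d = <⇒≱ (subst (_< x) same (lf< lx)) (linear (_ ∷ d ∷ _ ∷ _ ∷ []) (# 0 ≼ # 3) 1 (1 ⇒ # 0 ⊕ # 1 ≈ κ 1 ⊕ # 2 ∋ x≡ ∷
                1 × κ 1 ⊕ # 2 ≼ # 3 ⊕ # 1 ∋ s<i+d ∷ []))

      -- The mirror image: now it is the image of a maximum in Q that needs care, and the central
      -- block through `n - d` and `n` keeps a noncentral Q block of a label before `n - d` from
      -- extending to `n - d` or beyond.
      centralQ⇒periodic : rt (n ∸ d) ≡ n → ∀ i → i + d < n → vv (i + d) ≡ vv i
      centralQ⇒periodic c i i+d<n with <-cmp (H (i + d)) (H (suc (i + d)))
      ... | tri≈ _ eq _ = ⊥-elim (1+n≢n (sym (distinct {i + d} {suc (i + d)} (1≤+d {i} , <⇒≤ i+d<n) (s≤s z≤n , i+d<n) eq)))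
      ... | tri< rise _ _ = trans (sym (cong vv lf-j)) (trans (rankP⁺ sh) (cong vv s≡))
        where
        li : IsLabel n (suc i)
        li = s≤s z≤n , ≤-trans (s≤s (m≤m+n i d)) i+d<n
        sh = up li i+d<n
        s = lf (suc i)
        lf-j : lf (suc i + d) ≡ i + d
        lf-j = lf-suc i+d<n rise
        s≡ : s ≡ i
        s≡ = ≤-antisym (≤-pred (lf< li)) (≮⇒≥ contra)
          where
          contra : ¬ s < i
          contra s<i = <⇒≱ (subst (_< suc s + d) (trans same lf-j) (lf< lx)) (+-monoˡ-≤ d s<i)
            where
            x≤n : suc s + d ≤ n
            x≤n = ≤-trans (+-monoˡ-≤ d s<i) (<⇒≤ i+d<n)
            shx = up (lf-suc-label li) x≤n
            lx = proj₁ (proj₂ shx)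
            same : lf (suc s + d) ≡ lf (suc i + d)
            same = P⁺ shx sh (lf-suc-lf li)
      ... | tri> _ _ down = cases i refl
        where
        j = i + d
        lj : IsLabel n j
        lj = 1≤+d {i} , <⇒≤ i+d<n
        rt-j : rt j ≡ j
        rt-j = rt-self lj down
        h = n ∸ d
        h≡ : h + d ≡ n
        h≡ = m∸n+n≡m d≤n
        lh : IsLabel n h
        lh = linear (_ ∷ d ∷ _ ∷ i ∷ []) (κ 1 ≼ # 0) 1 (1 ⇐ # 0 ⊕ # 1 ≈ # 2 ∋ h≡ ∷ 1 × κ 1 ⊕ (# 3 ⊕ # 1) ≼ # 2 ∋ i+d<n ∷ []) , m∸n≤m n d
        shh : Shifted h n
        shh = subst (Shifted h) h≡ (up lh (≤-reflexive h≡))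
        cases : ∀ i′ → i ≡ i′ → vv j ≡ vv i′
        cases zero refl = ⊥-elim (<⇒≢ i+d<n (trans (sym rt-j) (trans (sym (Q⁺ shh (around final-label lj (+-comm d n)) (trans c (sym rt-n)))) rt-n)))
        cases (suc i′) refl = trans (sym (cong vv rt-j)) (trans (rankQ⁺ sh) (cong vv t≡))
          where
          li : IsLabel n i
          li = s≤s z≤n , ≤-trans (m≤m+n i d) (<⇒≤ i+d<n)
          sh = up li (<⇒≤ i+d<n)
          t = rt i
          i<h : i < h
          i<h = linear (_ ∷ d ∷ _ ∷ _ ∷ []) (κ 1 ⊕ (κ 1 ⊕ # 3) ≼ # 0) 1 (1 ⇐ # 0 ⊕ # 1 ≈ # 2 ∋ h≡ ∷ 1 × κ 1 ⊕ (κ 1 ⊕ # 3 ⊕ # 1) ≼ # 2 ∋ i+d<n ∷ [])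
          t≢n : t ≢ n
          t≢n z = <⇒≢ i+d<n (trans (sym rt-j) (trans (Q⁺ sh shh (trans z (sym c))) rt-n))
          t<h : t < h
          t<h = ≰⇒> λ h≤t → <⇒≱ (<-≤-trans (rt-lower li) (rt-high li h (<⇒≤ i<h) h≤t)) (last-rt lh c (m≤n⇒m≤1+n h≤t) (≤∧≢⇒< (rt≤n li) t≢n))
          t≡ : t ≡ i
          t≡ = ≤-antisym (≮⇒≥ contra) (≤rt li)
            where
            contra : ¬ i < t
            contra i<t = <⇒≱ (+-monoˡ-< d i<t) (≤-trans (≤rt lx) (≤-reflexive (trans same rt-j)))
              where
              shx = up (rt-label li) (linear (_ ∷ d ∷ _ ∷ _ ∷ []) (# 3 ⊕ # 1 ≼ # 2) 1 (1 ⇒ # 0 ⊕ # 1 ≈ # 2 ∋ h≡ ∷ 1 × κ 1 ⊕ # 3 ≼ # 0 ∋ t<h ∷ []))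
              lx = proj₁ (proj₂ shx)
              same : rt (t + d) ≡ rt j
              same = Q⁺ shx sh (rt-rt li)

-- Every invariant pair comes from a periodic sequence

periodic-below : ∀ d .{{_ : NonZero d}} N (f : ℕ → ℕ) → (∀ x → x + d < N → f (x + d) ≡ f x) → ∀ x → x < N → f x ≡ f (x % d)
periodic-below d N f per x x<N = trans (cong f (m≡m%n+[m/n]*n x d)) (descend (x / d) (x % d) (≤-<-trans (≤-reflexive (sym (m≡m%n+[m/n]*n x d))) x<N))
  where
  descend : ∀ q r → r + q * d < N → f (r + q * d) ≡ f r
  descend zero    r h = cong f (+-identityʳ r)
  descend (suc q) r h = trans (cong f eq) (trans (per (r + q * d) (subst (_< N) eq h))
      (descend q r (≤-<-trans (+-monoʳ-≤ r (m≤n+m (q * d) d)) h)))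
    where
    eq : r + suc q * d ≡ r + q * d + d
    eq = trans (cong (r +_) (+-comm d (q * d))) (sym (+-assoc r (q * d) d))

module Represent (a d m n : ℕ) (n≡md : n ≡ m * d) (1≤d : 1 ≤ d) (2≤m : 2 ≤ m) .{{nz : NonZero n}}
                 (1≤a : 1 ≤ a) (coprime : Coprime a (suc n)) (2≤n : 2 ≤ n) where

  open CyclicPair a d m n n≡md 1≤d 2≤m
  open Realize a d m n n≡md 1≤d 2≤m 1≤a coprime 2≤n
  open Rotations a d m n n≡md 1≤d 2≤m 1≤a coprime 2≤n

  instance
    nonZero-d : NonZero d
    nonZero-d = >-nonZero 1≤d

  -- `rot^d` carries 1 to `suc d` and `n - d` to `n`, and it permutes the blocks. So the
  -- alternatives say that the block of 1 in P, respectively of `n` in Q, is mapped to itself.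
  Central : (v : Vec ℕ (suc n)) → IsDyck a (suc n) v → Set
  Central v dyck = lf (suc d) ≡ 0 ⊎ rt (n ∸ d) ≡ n
    where open OfPath v dyck

  CentralCut : LP n → Set
  CentralCut x = ∃ λ k → ∃ λ v → ∃ λ dyck → π a (suc n) v ≡ rotLPN k x × Central v dyck

  CentralCut-rot : ∀ k {x y} → y ≡ rotLPN k x → CentralCut y → CentralCut x
  CentralCut-rot k {x} refl (l , v , dyck , eq , c) = l + k , v , dyck , trans eq (sym (rotLPN-+ l k x)) , c

  module Transfer (v v′ : Vec ℕ (suc n)) (dyck : IsDyck a (suc n) v) (dyck′ : IsDyck a (suc n) v′)
                  (k : ℕ) (eq : π a (suc n) v′ ≡ rotLPN k (π a (suc n) v)) where
    module O = OfPath v dyck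
    module O′ = OfPath v′ dyck′

    moveP : ∀ {i j} → IsLabel n i → IsLabel n j → O.lf i ≡ O.lf j → O′.lf (rotBy k i) ≡ O′.lf (rotBy k j)
    moveP {i} {j} li lj h = ≡ᵇ≡true⇒≡ (trans (sym (O′.relP-lf (iter-rot1-label k 1≤n li) (iter-rot1-label k 1≤n lj)))
      (trans (cong (λ x → relOf (proj₁ x) (rotBy k i) (rotBy k j)) eq)
      (trans (proj₁ (rotLPN-rel k (π a (suc n) v) li lj)) (trans (O.relP-lf li lj) (≡⇒≡ᵇ≡true h)))))

    moveQ : ∀ {i j} → IsLabel n i → IsLabel n j → O.rt i ≡ O.rt j → O′.rt (rotBy k i) ≡ O′.rt (rotBy k j)
    moveQ {i} {j} li lj h = ≡ᵇ≡true⇒≡ (trans (sym (O′.relQ-rt (iter-rot1-label k 1≤n li) (iter-rot1-label k 1≤n lj)))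
      (trans (cong (λ x → relOf (proj₂ x) (rotBy k i) (rotBy k j)) eq)
      (trans (proj₂ (rotLPN-rel k (π a (suc n) v) li lj)) (trans (O.relQ-rt li lj) (≡⇒≡ᵇ≡true h)))))

    -- Cutting between t and t + 1 turns the label f joining their blocks into e.
    recut : ∀ {t f f′} → IsLabel n t → IsLabel n (suc t) → IsLabel n f → t + k ≡ n → O.lf f ≡ O.lf (suc t) → O.rt f ≡ O.rt t →
      rotBy k f ≡ f′ → f′ ≡ O′.e
    recut {t} {f} {f′} lt lt+1 lf t+k≡n eqP eqQ f↦f′ = O′.e-unique (subst (IsLabel n) f↦f′ (iter-rot1-label k 1≤n lf))
      (trans (cong O′.lf (sym f↦f′)) (trans (moveP lf lt+1 eqP) (trans (cong O′.lf t+1↦1) O′.lf-1)))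
      (trans (cong O′.rt (sym f↦f′)) (trans (moveQ lf lt eqQ) (trans (cong O′.rt t↦n) O′.rt-n)))
      where
      t↦n : rotBy k t ≡ n
      t↦n = trans (rotBy-low k lt (≤-reflexive t+k≡n)) t+k≡n
      t+1↦1 : rotBy k (suc t) ≡ 1
      t+1↦1 = +-cancelʳ-≡ n (rotBy k (suc t)) 1 (trans (rotBy-high k lt+1 (s≤s (≤-reflexive (sym t+k≡n))) (linear (t ∷ k ∷ _ ∷ [])
          (κ 1 ⊕ # 0 ⊕ # 1 ≼ # 2 ⊕ # 2) 1 (1 ⇒ # 0 ⊕ # 1 ≈ # 2 ∋ t+k≡n ∷ 1 × κ 2 ≼ # 2 ∋ 2≤n ∷ []))) (cong suc t+k≡n))

  inv-rot : ∀ k {x : LP n} → rotLPN d x ≡ x → rotLPN d (rotLPN k x) ≡ rotLPN k x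
  inv-rot k {x} h = trans (sym (rotLPN-+ d k x)) (trans (cong (λ z → rotLPN z x) (+-comm d k)) (trans (rotLPN-+ k d x) (cong (rotLPN k) h)))

  -- Recutting at a gap longer than d enlarges the smaller side of e, so the search ends at a central block.
  mutual
    searchP : ∀ fuel v (dyck : IsDyck a (suc n) v) → rotLPN d (π a (suc n) v) ≡ π a (suc n) v →
      n < OfPath.e v dyck + d → d ≤ fuel + (n ∸ OfPath.e v dyck) → CentralCut (π a (suc n) v)
    searchP fuel v dyck inv n<e+d enough with searchFirst n 1 (λ f → (OfPath.lf v dyck f ≡ᵇ 0) ∧ (f + d ≤ᵇ OfPath.rt v dyck f))
    ... | none h = 0 , v , dyck , refl , inj₁ (short-gaps⇒central λ f f-label z → ≰⇒> λ long →
            true≢false (∧-intro (≡⇒≡ᵇ≡true z) (≤⇒≤ᵇ≡true long)) (h f (proj₁ f-label) (s≤s (proj₂ f-label))))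
      where open OfPath v dyck
            open Invariant inv
    ... | found f 1≤f f≤n p _ = next fuel enough
      where
      open OfPath v dyck
      f-label : IsLabel n f
      f-label = 1≤f , ≤-pred f≤n
      z : lf f ≡ 0
      z = ≡ᵇ≡true⇒≡ (∧-elimˡ p)
      t = rt f
      long : f + d ≤ t
      long = ≤ᵇ≡true⇒≤ (∧-elimʳ {lf f ≡ᵇ 0} p)
      -- A gap reaching `n` would make `f` the label `e`, and then `e + d ≤ n` contradicts the
      -- position of `e` near `n`.
      t<n : t < n
      t<n = ≤∧≢⇒< (rt≤n f-label) λ eq → <⇒≱ n<e+d (subst (λ z → z + d ≤ n) (e-unique f-label z eq) (≤-trans long (rt≤n f-label)))
      lt+1 : IsLabel n (suc t)
      lt+1 = s≤s z≤n , t<n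
      z+1 : lf (suc t) ≡ 0
      z+1 = lf-0 lt+1 λ j 1≤j j≤t → ≤-trans (<⇒≤ (rt-lower f-label)) (low j 1≤j (≤-pred j≤t))
        where
        low : ∀ j → 1 ≤ j → j ≤ t → H f ≤ H j
        low j 1≤j j≤t with ≤-total f j
        ... | inj₁ f≤j = rt-high f-label j f≤j j≤t
        ... | inj₂ j≤f = 0-lf f-label z 1≤j j≤f
      t+1≤e : suc t ≤ e
      t+1≤e = ≮⇒≥ λ e<t+1 → <⇒≱ (proj₁ le) (≤-trans (e≤lf lt+1 e<t+1) (≤-reflexive z+1))
      e≤n : n ∸ e + e ≡ n
      e≤n = m∸n+n≡m (proj₂ le)
      -- This rotation puts the cut between `t` and `suc t`. As `f` shares a P block with `suc t`
      -- and a Q block with `t`, its image `f + k` is the new `e`.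
      k = n ∸ t
      t+k≡n : t + k ≡ n
      t+k≡n = m+[n∸m]≡n (rt≤n f-label)
      next : ∀ fuel → d ≤ fuel + (n ∸ e) → CentralCut (π a (suc n) v)
      next zero       enough = ⊥-elim (<⇒≱ n<e+d (linear (_ ∷ _ ∷ e ∷ _ ∷ []) (# 2 ⊕ # 0 ≼ # 3) 1 (1 × # 0 ≼ κ 0 ⊕ # 1 ∋ enough ∷
          1 ⇒ # 1 ⊕ # 2 ≈ # 3 ∋ e≤n ∷ [])))
      next (suc fuel) enough with NC-rotLPN k (v , dyck , refl)
      ... | v′ , dyck′ , eq = CentralCut-rot k eq (continue (OfPath.Invariant.e-near-end v′ dyck′ inv′))
        where
        inv′ : rotLPN d (π a (suc n) v′) ≡ π a (suc n) v′
        inv′ = subst (λ x → rotLPN d x ≡ x) (sym eq) (inv-rot k inv)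
        e′ = OfPath.e v′ dyck′
        e′≡ : f + k ≡ e′
        e′≡ = Transfer.recut v v′ dyck dyck′ k eq (rt-label f-label) lt+1 f-label t+k≡n (trans z (sym z+1)) (sym (rt-rt f-label)) (rotBy-low k f-label (≤-trans (+-monoˡ-≤ k (≤rt f-label)) (≤-reflexive t+k≡n)))
        continue : e′ ≤ d ⊎ n < e′ + d → CentralCut (π a (suc n) v′)
        -- From `1 ≤ f` and `suc t ≤ e` the new distance `e′ - 1` is at least `n - e + 1`, which
        -- makes up for the unit of fuel spent.
        continue (inj₁ e′≤d)  = searchQ fuel v′ dyck′ inv′ e′≤d (linear (_ ∷ fuel ∷ n ∸ e ∷ _ ∷ _ ∷ _ ∷ k ∷ _ ∷ _ ∷ e′ ∸ 1 ∷ [])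
            (# 0 ≼ # 1 ⊕ # 9) 1 (1 × # 0 ≼ κ 1 ⊕ (# 1 ⊕ # 2) ∋ enough ∷ 1 ⇒ # 2 ⊕ # 3 ≈ # 4 ∋ e≤n ∷ 1 ⇒ # 5 ⊕ # 6 ≈ # 7 ∋ e′≡ ∷
            1 ⇐ # 8 ⊕ # 6 ≈ # 4 ∋ t+k≡n ∷ 1 × κ 1 ⊕ # 8 ≼ # 3 ∋ t+1≤e ∷ 1 × κ 1 ≼ # 5 ∋ 1≤f ∷ 1 ⇐ # 9 ⊕ κ 1 ≈ # 7 ∋
            m∸n+n≡m (proj₁ (OfPath.le v′ dyck′)) ∷ []))
        continue (inj₂ n<e′+d) = ⊥-elim (<⇒≱ n<e′+d (linear (f ∷ k ∷ _ ∷ _ ∷ _ ∷ d ∷ []) (# 2 ⊕ # 5 ≼ # 4) 1 (1 ⇐ # 0 ⊕ # 1 ≈ # 2 ∋ e′≡ ∷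
            1 ⇒ # 3 ⊕ # 1 ≈ # 4 ∋ t+k≡n ∷ 1 × # 0 ⊕ # 5 ≼ # 3 ∋ long ∷ [])))

    searchQ : ∀ fuel v (dyck : IsDyck a (suc n) v) → rotLPN d (π a (suc n) v) ≡ π a (suc n) v →
      OfPath.e v dyck ≤ d → d ≤ fuel + (OfPath.e v dyck ∸ 1) → CentralCut (π a (suc n) v)
    searchQ fuel v dyck inv e≤d enough with searchFirst n 1 (λ f → (OfPath.rt v dyck f ≡ᵇ n) ∧ (OfPath.lf v dyck f + d <ᵇ f))
    ... | none h = 0 , v , dyck , refl , inj₂ (short-gaps⇒centralQ λ f f-label z → ≮⇒≥ {lf f + d} {f} λ long →
            true≢false (∧-intro (≡⇒≡ᵇ≡true z) (<⇒<ᵇ≡true long)) (h f (proj₁ f-label) (s≤s (proj₂ f-label))))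
      where open OfPath v dyck
            open Invariant inv
    ... | found f 1≤f f≤n p _ = next fuel enough
      where
      open OfPath v dyck
      f-label : IsLabel n f
      f-label = 1≤f , ≤-pred f≤n
      z : rt f ≡ n
      z = ≡ᵇ≡true⇒≡ (∧-elimˡ p)
      s = lf f
      long : s + d < f
      long = <ᵇ≡true⇒< {s + d} {f} (∧-elimʳ {rt f ≡ᵇ n} p)
      1≤s : 1 ≤ s
      1≤s = n≢0⇒n>0 λ s≡0 → <⇒≱ (≤-<-trans (m≤n+m d s) long) (subst (_≤ d) (sym (e-unique f-label s≡0 z)) e≤d)
      ls : IsLabel n s
      ls = 1≤s , ≤-trans (<⇒≤ (lf< f-label)) (proj₂ f-label)
      z-s : rt s ≡ n
      z-s = rt-last ls low
        where
        low : ∀ j → s ≤ j → j ≤ n → H s ≤ H j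
        low j s≤j j≤n with m≤n⇒m<n∨m≡n s≤j | f ≤? j
        ... | inj₂ refl | _      = ≤-refl
        ... | inj₁ _   | yes f≤j = ≤-trans (<⇒≤ (lf-lower f-label)) (last-rt f-label z f≤j j≤n)
        ... | inj₁ s<j | no f≰j  = ≤-trans (<⇒≤ (lf-lower f-label)) (lf-high f-label j s<j (≰⇒> f≰j))
      e≤s : e ≤ s
      e≤s = ≮⇒≥ λ s<e → <⇒≱ (rt<e ls s<e) (≤-trans (proj₂ le) (≤-reflexive (sym z-s)))
      k = n ∸ s
      s+k≡n : s + k ≡ n
      s+k≡n = m+[n∸m]≡n (proj₂ ls)
      next : ∀ fuel → d ≤ fuel + (e ∸ 1) → CentralCut (π a (suc n) v)
      next zero       enough = ⊥-elim (<⇒≱ (s≤s enough) (linear (_ ∷ _ ∷ _ ∷ []) (κ 1 ⊕ (κ 0 ⊕ # 2) ≼ # 1) 1 (1 × # 0 ≼ # 1 ∋ e≤d ∷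
          1 ⇒ # 2 ⊕ κ 1 ≈ # 0 ∋ m∸n+n≡m (proj₁ le) ∷ [])))
      next (suc fuel) enough with NC-rotLPN k (v , dyck , refl)
      ... | v′ , dyck′ , eq = CentralCut-rot k eq (continue (OfPath.Invariant.e-near-end v′ dyck′ inv′))
        where
        inv′ : rotLPN d (π a (suc n) v′) ≡ π a (suc n) v′
        inv′ = subst (λ x → rotLPN d x ≡ x) (sym eq) (inv-rot k inv)
        e′ = OfPath.e v′ dyck′
        f∸s : f ∸ s + s ≡ f
        f∸s = m∸n+n≡m (<⇒≤ (lf< f-label))
        image : rotBy k f ≡ f ∸ s
        image = +-cancelʳ-≡ n (rotBy k f) (f ∸ s) (trans (rotBy-high k f-label (linear (_ ∷ k ∷ _ ∷ _ ∷ [])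
            (κ 1 ⊕ # 2 ≼ # 3 ⊕ # 1) 1 (1 ⇐ # 0 ⊕ # 1 ≈ # 2 ∋ s+k≡n ∷ 1 × κ 1 ⊕ # 0 ≼ # 3 ∋ lf< f-label ∷ [])) (linear (s ∷ k ∷ _ ∷ _ ∷ [])
            (# 3 ⊕ # 1 ≼ # 2 ⊕ # 2) 2 (2 ⇒ # 0 ⊕ # 1 ≈ # 2 ∋ s+k≡n ∷ 2 × # 3 ≼ # 2 ∋ proj₂ f-label ∷ []))) (linear≡ (s ∷ k ∷ _ ∷ f ∸ s ∷
            _ ∷ []) (# 4 ⊕ # 1 ≈ # 3 ⊕ # 2) 1 (1 ⇒ # 0 ⊕ # 1 ≈ # 2 ∋ s+k≡n ∷ 1 ⇐ # 3 ⊕ # 0 ≈ # 4 ∋ f∸s ∷ [])))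
        e′≡ : f ∸ s ≡ e′
        e′≡ = Transfer.recut v v′ dyck dyck′ k eq ls (lf-suc-label f-label) f-label s+k≡n (sym (lf-suc-lf f-label)) (trans z (sym z-s)) image
        continue : e′ ≤ d ⊎ n < e′ + d → CentralCut (π a (suc n) v′)
        continue (inj₁ e′≤d)  = ⊥-elim (<⇒≱ long (linear (_ ∷ _ ∷ s ∷ _ ∷ _ ∷ []) (# 3 ≼ # 2 ⊕ # 4) 1 (1 ⇒ # 0 ≈ # 1 ∋ e′≡ ∷
            1 ⇐ # 0 ⊕ # 2 ≈ # 3 ∋ f∸s ∷ 1 × # 1 ≼ # 4 ∋ e′≤d ∷ [])))
        -- The new distance is `n - e′ = (n - f) + s`, at least `s ≥ e` and so larger than the old
        -- distance `e - 1`.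
        continue (inj₂ n<e′+d) = searchP fuel v′ dyck′ inv′ n<e′+d (linear (_ ∷ fuel ∷ e ∸ 1 ∷ _ ∷ _ ∷ _ ∷ _ ∷ _ ∷ n ∸ e′ ∷ _ ∷ [])
            (# 0 ≼ # 1 ⊕ # 8) 1 (1 × # 0 ≼ κ 1 ⊕ (# 1 ⊕ # 2) ∋ enough ∷ 1 ⇐ # 3 ≈ # 4 ∋ e′≡ ∷ 1 ⇒ # 3 ⊕ # 5 ≈ # 6 ∋ f∸s ∷ 1 × # 7 ≼ # 5 ∋
            e≤s ∷ 1 ⇒ # 2 ⊕ κ 1 ≈ # 7 ∋ m∸n+n≡m (proj₁ le) ∷ 1 ⇐ # 8 ⊕ # 4 ≈ # 9 ∋ m∸n+n≡m (proj₂ (OfPath.le v′ dyck′)) ∷ 1 × # 6 ≼ # 9 ∋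
            proj₂ f-label ∷ []))

  centralCut : ∀ v (dyck : IsDyck a (suc n) v) → rotLPN d (π a (suc n) v) ≡ π a (suc n) v → CentralCut (π a (suc n) v)
  centralCut v dyck inv with OfPath.Invariant.e-near-end v dyck inv
  ... | inj₁ e≤d   = searchQ d v dyck inv e≤d (m≤m+n d _)
  ... | inj₂ n<e+d = searchP d v dyck inv n<e+d (m≤m+n d _)

  Represented : LP n → Set
  Represented x = ∃ λ u → Periodic d u × sumUpTo d u * n ≤ a * d × x ≡ cyclicPair u

  light : ∀ {u} → Periodic d u → sumUpTo n u ≤ a → sumUpTo d u * n ≤ a * d
  light {u} per h = ≤-trans (≤-reflexive eq) (*-monoˡ-≤ d h)
    where
    eq : sumUpTo d u * n ≡ sumUpTo n u * d
    eq = trans (cong (sumUpTo d u *_) n≡md) (trans (sym (*-assoc (sumUpTo d u) m d))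
      (cong (_* d) (trans (*-comm (sumUpTo d u) m) (sym (trans (cong (λ z → sumUpTo z u) n≡md) (sumUpTo-periods per m))))))

  central⇒represented : ∀ v (dyck : IsDyck a (suc n) v) → rotLPN d (π a (suc n) v) ≡ π a (suc n) v → Central v dyck → Represented (π a (suc n) v)
  central⇒represented v dyck inv (inj₁ c) = u , per , light per (≤-trans (m≤n+m (sumUpTo n u) (at 0 v 0)) (≤-reflexive (sym total))) , π≡cyclicPair
    where
    open OfPath v dyck using (vv)
    u : ℕ → ℕ
    -- The agreement with the path begins at position 1, so the representatives are `1, ..., d`;
    -- `I + pred d` is `I - 1` modulo `d`.
    u I = vv (suc ((I + pred d) % d))
    per : Periodic d u
    per I = cong (λ z → vv (suc z)) (trans (cong (_% d) (+-right-comm I d (pred d))) ([m+n]%n≡m%n (I + pred d) d))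
    agree : ∀ x → 1 ≤ x → x < suc n → vv x ≡ u x
    agree (suc x) _ x<b = trans (periodic-below d n (λ x → vv (suc x)) (λ x h → OfPath.Invariant.central⇒periodic v dyck inv c (suc x) (s≤s z≤n) h) x (≤-pred x<b))
      (cong (λ z → vv (suc z)) (trans (sym ([m+n]%n≡m%n x d)) (cong (_% d) (trans (cong (x +_) (sym (suc-pred d))) (+-suc x (pred d))))))
    open Cut.CutLeft a d m n n≡md 1≤d 2≤m 1≤a coprime 2≤n v dyck per agree
  central⇒represented v dyck inv (inj₂ c) = u , per , light per (≤-trans (m≤m+n (sumUpTo n u) (at 0 v n)) (≤-reflexive (sym total))) , π≡cyclicPair
    where
    open OfPath v dyck using (vv)
    u : ℕ → ℕ
    u I = vv (I % d)
    per : Periodic d u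
    per I = cong vv ([m+n]%n≡m%n I d)
    agree : ∀ x → 0 ≤ x → x < n → vv x ≡ u x
    agree x _ x<n = periodic-below d n vv (OfPath.Invariant.centralQ⇒periodic v dyck inv c) x x<n
    open Cut.CutRight a d m n n≡md 1≤d 2≤m 1≤a coprime 2≤n v dyck per agree

  represent : ∀ {x} → NCd a (suc n) d x → Represented x
  represent ((v , dyck , refl) , inv) with centralCut v dyck inv
  ... | k , v′ , dyck′ , eq , c with central⇒represented v′ dyck′ (subst (λ x → rotLPN d x ≡ x) (sym eq) (inv-rot k inv)) c
  ...   | u , per , lt , eq′ = shift (l * pred n) u , Periodic-shift (l * pred n) per ,
          subst (λ z → z * n ≤ a * d) (sym (sumUpTo-shift per (l * pred n))) lt ,
          trans (sym whole) (trans (rotLPN-+ l k (π a (suc n) v)) (trans (cong (rotLPN l) (trans (sym eq) eq′)) (rotLPN-cyclicPair per l)))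
    where
    -- `l + k` is `k n`, a multiple of `d`, so `l` further rotations undo the `k` rotations that led
    -- to the central cut.
    l = k * pred n
    whole : rotLPN (l + k) (π a (suc n) v) ≡ π a (suc n) v
    whole = trans (cong (λ z → rotLPN z (π a (suc n) v)) (trans (+-comm l k) (trans (sym (*-suc k (pred n))) (trans (cong (k *_) (trans (suc-pred n) n≡md)) (sym (*-assoc k m d))))))
      (rotLPN-fixed d inv (k * m))

  realizeNCd : ∀ {u} → Periodic d u → sumUpTo d u * n ≤ a * d → NCd a (suc n) d (cyclicPair u)
  realizeNCd {u} per lt = Realizing.realize per lt , trans (rotLPN-cyclicPair per d)
    (cyclicPair-cong λ I → trans (cong (λ z → u (I + z)) (*-comm d (pred n))) (Periodic-* per (pred n) I))

-- Good sequence pairs and periodic sequences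

sum-tabulate : ∀ m (f : ℕ → ℕ) → sum (tabulate {n = m} (λ x → f (toℕ x))) ≡ sumUpTo m f
sum-tabulate zero    f = refl
sum-tabulate (suc m) f = trans (cong (f 0 +_) (sum-tabulate m (λ k → f (suc k)))) (sym (sumUpTo-+ f 1 m))

sumUpTo-distrib : ∀ m f g → sumUpTo m f + sumUpTo m g ≡ sumUpTo m (λ k → f k + g k)
sumUpTo-distrib zero    f g = refl
sumUpTo-distrib (suc m) f g = linear≡ (sumUpTo m f ∷ sumUpTo m g ∷ _ ∷ f m ∷ g m ∷ [])
    (# 0 ⊕ # 3 ⊕ (# 1 ⊕ # 4) ≈ # 2 ⊕ (# 3 ⊕ # 4)) 1 (1 ⇒ # 0 ⊕ # 1 ≈ # 2 ∋ sumUpTo-distrib m f g ∷ [])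

module Sequences (a d m n : ℕ) (n≡md : n ≡ m * d) (1≤d : 1 ≤ d) (2≤m : 2 ≤ m) .{{nz : NonZero n}}
                 (1≤a : 1 ≤ a) (coprime : Coprime a (suc n)) (2≤n : 2 ≤ n) where

  open CyclicPair a d m n n≡md 1≤d 2≤m using (periodic-n)

  instance
    nonZero-period : NonZero d
    nonZero-period = >-nonZero 1≤d

  b : ℕ
  b = suc n

  pPart qPart : ℕ → ℕ
  pPart x = if a <ᵇ b * x then x else 0
  qPart x = if b * x <ᵇ a then x else 0

  -- `b` would divide `a` and therefore, by coprimality, 1. So each rise is strictly above or
  -- strictly below `a/b`, and splitting a sequence into the two kinds loses nothing.
  a≢b* : ∀ x → a ≢ b * x
  a≢b* x e = <⇒≱ (m<n⇒m<1+n 2≤n) (∣⇒≤ (coprime-divisor (coprime-sym coprime) (divides x (trans (*-identityʳ a) (trans e (*-comm b x))))))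

  pPart-high : ∀ {x} → a < b * x → pPart x ≡ x
  pPart-high h = if-true (<⇒<ᵇ≡true h)

  pPart-low : ∀ {x} → b * x ≤ a → pPart x ≡ 0
  pPart-low h = if-false (≤⇒<ᵇ≡false h)

  qPart-low : ∀ {x} → b * x < a → qPart x ≡ x
  qPart-low h = if-true (<⇒<ᵇ≡true h)

  qPart-high : ∀ {x} → a ≤ b * x → qPart x ≡ 0
  qPart-high h = if-false (≤⇒<ᵇ≡false h)

  parts : ∀ x → pPart x + qPart x ≡ x
  parts x with <-cmp a (b * x)
  ... | tri< lt _ _ = trans (cong₂ _+_ (pPart-high {x} lt) (qPart-high {x} (<⇒≤ lt))) (+-identityʳ x)
  ... | tri≈ _ e _  = ⊥-elim (a≢b* x e)
  ... | tri> _ _ gt = cong₂ _+_ (pPart-low {x} (<⇒≤ gt)) (qPart-low {x} gt)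

  b*0<a : b * 0 < a
  b*0<a = subst (_< a) (sym (*-zeroʳ b)) 1≤a

  pPart-good : ∀ x → (pPart x ≡ 0) ⊎ (a < b * pPart x)
  pPart-good x with a <ᵇ b * x in eq
  ... | true  = inj₂ (<ᵇ≡true⇒< {a} {b * x} eq)
  ... | false = inj₁ refl

  qPart-good : ∀ x → b * qPart x < a
  qPart-good x with b * x <ᵇ a in eq
  ... | true  = <ᵇ≡true⇒< {b * x} {a} eq
  ... | false = b*0<a

  at-p : ∀ u {j} → j < d → at 0 (proj₁ (decode a b d u)) j ≡ pPart (u j)
  at-p u = at-tabulate 0 d (λ j → pPart (u j))

  at-q : ∀ u {j} → j < d → at 0 (proj₂ (decode a b d u)) j ≡ qPart (u (suc j))
  at-q u = at-tabulate 0 d (λ j → qPart (u (suc j)))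

  periodic-%d : ∀ {u} → Periodic d u → ∀ I → u (I % d) ≡ u I
  periodic-%d {u} per I = sym (trans (cong u (m≡m%n+[m/n]*n I d)) (Periodic-* per (I / d) (I % d)))

  sum-decode : ∀ {u} → Periodic d u → sum (proj₁ (decode a b d u)) + sum (proj₂ (decode a b d u)) ≡ sumUpTo d u
  sum-decode {u} per = trans (cong₂ _+_ (sum-tabulate d (λ j → pPart (u j)))
      (trans (sum-tabulate d (λ j → qPart (u (suc j))))
        (trans (sumUpTo-cong d (λ j _ → cong (λ z → qPart (u z)) (+-comm 1 j))) (sumUpTo-shift {u = λ j → qPart (u j)} (λ I → cong qPart (per I)) 1))))
    (trans (sumUpTo-distrib d (λ j → pPart (u j)) (λ j → qPart (u j))) (sumUpTo-cong d (λ j _ → parts (u j))))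

  next% : ∀ i → IsLabel d i → nextIdx d i ∸ 1 ≡ i % d
  next% i (1≤i , i≤d) with i ≟ d
  ... | yes e = trans (cong (_∸ 1) (if-true (≡⇒≡ᵇ≡true e))) (sym (trans (cong (_% d) e) (trans ([m+n]%n≡m%n 0 d) (m<n⇒m%n≡m 1≤d))))
  ... | no ≢  = trans (cong (_∸ 1) (if-false {x = 1} {y = suc i} (≢⇒≡ᵇ≡false ≢))) (sym (m<n⇒m%n≡m (≤∧≢⇒< i≤d ≢)))

  suc∸1 : ∀ {i} → 1 ≤ i → suc (i ∸ 1) ≡ i
  suc∸1 {suc i} _ = refl

  ∸1< : ∀ {i} → IsLabel d i → i ∸ 1 < d
  ∸1< {suc i} (_ , i<d) = i<d

  decode-good : ∀ {u} → Periodic d u → sumUpTo d u * n ≤ a * d → Good a b d (decode a b d u)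
  decode-good {u} per lt =
    (λ i 1≤i i≤d → subst (λ z → (z ≡ 0) ⊎ (a < b * z)) (sym (at-p u (∸1< (1≤i , i≤d)))) (pPart-good (u (i ∸ 1)))) ,
    (λ i 1≤i i≤d → subst (λ z → b * z < a) (sym (at-q u (∸1< (1≤i , i≤d)))) (qPart-good (u (suc (i ∸ 1))))) ,
    subst (λ z → z * n ≤ a * d) (sym (sum-decode per)) lt ,
    λ { (i , 1≤i , i≤d , p≢0 , q≢0) → clash i (1≤i , i≤d) p≢0 q≢0 }
    where
    -- The entry of `p` at `i + 1` and the entry of `q` at `i` are cut out of the same rise `u i`,
    -- which cannot be both high and low. This is the origin of the last condition on good pairs.
    clash : ∀ i → IsLabel d i → at 0 (proj₁ (decode a b d u)) (nextIdx d i ∸ 1) ≢ 0 → at 0 (proj₂ (decode a b d u)) (i ∸ 1) ≢ 0 → ⊥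
    clash i l p≢0 q≢0 with <-cmp a (b * u i)
    ... | tri< lt _ _ = q≢0 (trans (at-q u (∸1< l)) (trans (cong (λ z → qPart (u z)) (suc∸1 (proj₁ l))) (qPart-high {u i} (<⇒≤ lt))))
    ... | tri≈ _ e _  = a≢b* (u i) e
    ... | tri> _ _ gt = p≢0 (trans (cong (at 0 (proj₁ (decode a b d u))) (next% i l)) (trans (at-p u (m%n<n i d))
          (trans (cong pPart (periodic-%d per i)) (pPart-low {u i} (<⇒≤ gt)))))

  -- `I + pred d` is `I - 1` modulo `d`, which reverses the offset of `q` in `decode`. In a good
  -- pair at most one summand is nonzero, so the sum merges without loss.
  encode : SeqPair d → ℕ → ℕ
  encode (p , q) I = at 0 p (I % d) + at 0 q ((I + pred d) % d)

  encode-periodic : ∀ s → Periodic d (encode s)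
  encode-periodic (p , q) I = cong₂ _+_ (cong (at 0 p) ([m+n]%n≡m%n I d))
    (cong (at 0 q) (trans (cong (_% d) (+-right-comm I d (pred d))) ([m+n]%n≡m%n (I + pred d) d)))

  sum-at : ∀ (p : Vec ℕ d) → sumUpTo d (λ I → at 0 p (I % d)) ≡ sum p
  sum-at p = trans (sumUpTo-cong d (λ I I<d → cong (at 0 p) (m<n⇒m%n≡m I<d))) (trans (sym (sum-tabulate d (at 0 p))) (cong sum (tabulate-at 0 p)))

  sum-encode : ∀ p q → sumUpTo d (encode (p , q)) ≡ sum p + sum q
  sum-encode p q = trans (sym (sumUpTo-distrib d (λ I → at 0 p (I % d)) (λ I → at 0 q ((I + pred d) % d))))
    (cong₂ _+_ (sum-at p) (trans (sumUpTo-shift {u = λ I → at 0 q (I % d)} (λ I → cong (at 0 q) ([m+n]%n≡m%n I d)) (pred d)) (sum-at q)))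

  suc+pred : ∀ i → suc i + pred d ≡ i + d
  suc+pred i = trans (sym (+-suc i (pred d))) (cong (i +_) (suc-pred d))

  suc+pred% : ∀ i → i < d → (suc i + pred d) % d ≡ i
  suc+pred% i i<d = trans (cong (_% d) (suc+pred i)) (trans ([m+n]%n≡m%n i d) (m<n⇒m%n≡m i<d))

  encode-decode : ∀ {u} → Periodic d u → ∀ I → encode (decode a b d u) I ≡ u I
  encode-decode {u} per I = trans (cong₂ _+_
      (trans (at-p u (m%n<n I d)) (cong pPart (periodic-%d per I)))
      (trans (at-q u (m%n<n (I + pred d) d)) (cong qPart (trans (periodic-%d {λ x → u (suc x)} (λ x → per (suc x)) (I + pred d)) (trans (cong u (suc+pred I)) (per I))))))
    (parts (u I))

  parts-sum : ∀ x y → (x ≡ 0) ⊎ (a < b * x) → b * y < a → ¬ (x ≢ 0 × y ≢ 0) → pPart (x + y) ≡ x × qPart (x + y) ≡ y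
  parts-sum zero    y _ by<a _ = pPart-low {y} (<⇒≤ by<a) , qPart-low {y} by<a
  parts-sum (suc x) y (inj₂ a<bx) by<a ¬both with y ≟ 0
  ... | no y≢0   = ⊥-elim (¬both ((λ ()) , y≢0))
  ... | yes refl = trans (cong pPart (+-identityʳ (suc x))) (pPart-high {suc x} a<bx) ,
                   trans (cong qPart (+-identityʳ (suc x))) (qPart-high {suc x} (<⇒≤ a<bx))

  module _ (p q : Vec ℕ d) (good : Good a b d (p , q)) where

    entries : ∀ i → IsLabel d i → pPart (encode (p , q) i) ≡ at 0 p (i % d) × qPart (encode (p , q) i) ≡ at 0 q (i ∸ 1)
    entries (suc i) l@(1≤i , i<d) = subst (λ z → pPart (at 0 p (suc i % d) + z) ≡ at 0 p (suc i % d) × qPart (at 0 p (suc i % d) + z) ≡ at 0 q i)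
      (sym (cong (at 0 q) (suc+pred% i i<d)))
      (parts-sum (at 0 p (suc i % d)) (at 0 q i) (proj₁ good (suc (suc i % d)) (s≤s z≤n) (m%n<n (suc i) d)) (proj₁ (proj₂ good) (suc i) 1≤i i<d)
        λ { (p≢0 , q≢0) → proj₂ (proj₂ (proj₂ good)) (suc i , 1≤i , i<d , subst (λ z → at 0 p z ≢ 0) (sym (next% (suc i) l)) p≢0 , q≢0) })

    decode-encode : decode a b d (encode (p , q)) ≡ (p , q)
    decode-encode = cong₂ _,_
      (trans (tabulate-ext d pEntry) (tabulate-at 0 p))
      (trans (tabulate-ext d (λ i i<d → proj₂ (entries (suc i) (s≤s z≤n , i<d)))) (tabulate-at 0 q))
      where
      pEntry : ∀ i → i < d → pPart (encode (p , q) i) ≡ at 0 p i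
      -- The indices of `entries` run over `1, ..., d`, so position 0 is read as position `d`.
      pEntry zero    _   = trans (cong pPart (sym (encode-periodic (p , q) 0))) (trans (proj₁ (entries d (1≤d , ≤-refl))) (cong (at 0 p) (trans ([m+n]%n≡m%n 0 d) (m<n⇒m%n≡m 1≤d))))
      pEntry (suc i) i<d = trans (proj₁ (entries (suc i) (s≤s z≤n , <⇒≤ i<d))) (cong (at 0 p) (m<n⇒m%n≡m i<d))

    encode-light : sumUpTo d (encode (p , q)) * n ≤ a * d
    encode-light = subst (λ z → z * n ≤ a * d) (sym (sum-encode p q)) (proj₁ (proj₂ (proj₂ good)))

  decode-shift : ∀ {u} → Periodic d u → decode a b d (shift (pred n) u) ≡ rotSP (decode a b d u)
  decode-shift {u} per = cong₂ _,_
    (tabulate-ext d {λ i → pPart (u (i + pred n))} {λ i → at 0 (proj₁ (decode a b d u)) (if i ≡ᵇ 0 then d ∸ 1 else i ∸ 1)} pEntry)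
    (tabulate-ext d {λ i → qPart (u (suc i + pred n))} {λ i → at 0 (proj₂ (decode a b d u)) (if i ≡ᵇ 0 then d ∸ 1 else i ∸ 1)} qEntry)
    where
    u-suc : ∀ i → u (suc i + pred n) ≡ u i
    u-suc i = trans (cong u (trans (sym (+-suc i (pred n))) (cong (i +_) (suc-pred n)))) (periodic-n per i)
    u-0 : u (pred n) ≡ u (d ∸ 1)
    u-0 = trans (sym (per (pred n))) (trans (cong u eq) (periodic-n per (d ∸ 1)))
      where
      eq : pred n + d ≡ d ∸ 1 + n
      eq = linear≡ (_ ∷ _ ∷ _ ∷ _ ∷ []) (# 0 ⊕ # 3 ≈ # 2 ⊕ # 1) 1 (1 ⇒ κ 1 ⊕ # 0 ≈ # 1 ∋ suc-pred n ∷ 1 ⇐ κ 1 ⊕ # 2 ≈ # 3 ∋ suc∸1 1≤d ∷ [])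
    pEntry : ∀ i → i < d → pPart (u (i + pred n)) ≡ at 0 (proj₁ (decode a b d u)) (if i ≡ᵇ 0 then d ∸ 1 else i ∸ 1)
    pEntry zero    _   = trans (cong pPart u-0) (sym (at-p u (∸1< (1≤d , ≤-refl))))
    pEntry (suc i) i<d = trans (cong pPart (u-suc i)) (sym (at-p u (<⇒≤ i<d)))
    qEntry : ∀ i → i < d → qPart (u (suc i + pred n)) ≡ at 0 (proj₂ (decode a b d u)) (if i ≡ᵇ 0 then d ∸ 1 else i ∸ 1)
    qEntry zero    _   = trans (cong qPart (trans (u-suc 0) (trans (sym (per 0)) (cong u (sym (suc∸1 1≤d)))))) (sym (at-q u (∸1< (1≤d , ≤-refl))))
    qEntry (suc i) i<d = trans (cong qPart (u-suc (suc i))) (sym (at-q u (<⇒≤ i<d)))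

theorem5p8 : (a b d : ℕ) → 1 ≤ a → 1 ≤ b → Coprime a b
    → 1 ≤ d → d < b ∸ 1 → d ∣ (b ∸ 1)
    → (∀ x → NCd a b d x → Good a b d (S d x))
    × (∀ x y → NCd a b d x → NCd a b d y → S d x ≡ S d y → x ≡ y)
    × (∀ s → Good a b d s → ∃ λ x → NCd a b d x × S d x ≡ s)
    × (∀ x → NCd a b d x → S d (rotLP x) ≡ rotSP (S d x))
theorem5p8 a (suc n) d 1≤a _ coprime 1≤d d<n (divides m n≡md) = good , injective , surjective , equivariant
  where
  instance
    nonZero-n : NonZero n
    nonZero-n = >-nonZero (≤-trans 1≤d (<⇒≤ d<n))
  2≤m : 2 ≤ m
  2≤m = ≮⇒≥ λ m<2 → <⇒≱ d<n (≤-trans (≤-reflexive n≡md) (≤-trans (*-monoˡ-≤ d (≤-pred m<2)) (≤-reflexive (*-identityˡ d))))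
  2≤n : 2 ≤ n
  2≤n = ≤-trans (s≤s 1≤d) d<n
  open CyclicPair a d m n n≡md 1≤d 2≤m using (cyclicPair; rot-cyclicPair)
  open Realize a d m n n≡md 1≤d 2≤m 1≤a coprime 2≤n using (cyclicPair-cong)
  open Represent a d m n n≡md 1≤d 2≤m 1≤a coprime 2≤n using (represent; realizeNCd)
  open Sequences a d m n n≡md 1≤d 2≤m 1≤a coprime 2≤n
  S≡ : ∀ {u} → Periodic d u → S d (cyclicPair u) ≡ decode a (suc n) d u
  S≡ = Decoding.S-cyclicPair a d m n n≡md 1≤d 2≤m
  good : ∀ x → NCd a (suc n) d x → Good a (suc n) d (S d x)
  good x nc with represent nc
  ... | u , per , lt , refl = subst (Good a (suc n) d) (sym (S≡ per)) (decode-good per lt)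
  -- Injectivity comes from an explicit inverse: an invariant pair is the cyclic pair of some
  -- periodic sequence, and `encode` restores that sequence from the sequence pair.
  recover : ∀ x → NCd a (suc n) d x → cyclicPair (encode (S d x)) ≡ x
  recover x nc with represent nc
  ... | u , per , lt , refl = trans (cong (λ s → cyclicPair (encode s)) (S≡ per)) (cyclicPair-cong (encode-decode per))
  injective : ∀ x y → NCd a (suc n) d x → NCd a (suc n) d y → S d x ≡ S d y → x ≡ y
  injective x y ncx ncy h = trans (sym (recover x ncx)) (trans (cong (λ s → cyclicPair (encode s)) h) (recover y ncy))
  surjective : ∀ s → Good a (suc n) d s → ∃ λ x → NCd a (suc n) d x × S d x ≡ s
  surjective s@(p , q) g = cyclicPair (encode s) , realizeNCd (encode-periodic s) (encode-light p q g) , trans (S≡ (encode-periodic s)) (decode-encode p q g)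
  equivariant : ∀ x → NCd a (suc n) d x → S d (rotLP x) ≡ rotSP (S d x)
  equivariant x nc with represent nc
  ... | u , per , lt , refl = trans (cong (S d) (rot-cyclicPair per)) (trans (S≡ (Periodic-shift (pred n) per))
        (trans (decode-shift per) (cong rotSP (sym (S≡ per)))))
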